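{- Let $m,n$ be positive integers, let $A=\{(p,q)\in\mathbb{Z}^2: 0\le p<m,\ 0\le q<n\}$, and let $D=\{(a_h,b_h): h=1,\ldots,d\}$ be a finite set of $d \geq 1$ primitive directions. Let $f:A\to\mathbb{R}$ be an unknown function, and suppose that all the line sums of $f$ in the directions of $D$ are known. Then one can compute in linear time (that is, by an algorithm whose input is $m$, $n$, $D$ and these line sums, using $\mathcal{O}(dmn)$ basic operations) a function $g:A\to\mathbb{R}$ that satisfies the line sums, i.e. that has the same line sums as $f$ in all the directions of $D$. Moreover, the points which do not belong to any switching domain of $(A,D)$ get their original $f$-value: $g(p,q)=f(p,q)$ for every $(p,q)\in A$ which does not belong to any switching domain of $(A,D)$.
   Context: A primitive direction is a pair $(a,b)$ of coprime integers; the directions $(a,b)$ and $(-a,-b)$ are identified. In particular $(1,0)$ and $(0,1)$ are the horizontal and vertical directions. The elements of $D$ are distinct as directions under this identification, and $d$ is their number. For a direction $(a,b)$ and an integer $c$, let $L(a,b,c)$ be the lattice line $ay=bx+c$. For a function $f:A\to\mathbb{R}$, the line sum of $f$ along $L(a,b,c)$ is $$\ell(a,b,c,f)=\sum_{aq=bp+c,\ (p,q)\in A} f(p,q).$$ The line sums of $f$ in the directions of $D$ are the values $\ell(a,b,c,f)$ for all $(a,b)\in D$ and all $c\in\mathbb{Z}$ (only finitely many of these lines meet $A$). The line sums are exact (no noise). A function $F:A\to\mathbb{R}$ is called a switching function (or ghost) of $(A,D)$ if all the line sums of $F$ in all the directions of $D$ are zero. The support $\{(p,q)\in A: F(p,q)\neq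 0\}$ of a switching function $F$ is called a switching domain of $(A,D)$. Something can be computed in linear time if the number of basic operations needed to compute it is $\mathcal{O}(dmn)$. A basic operation is an addition, subtraction, multiplication, division, decision about which of two quantities is larger, or an assignment (real-number arithmetic counted at unit cost). -}

module Defs where

open import Algebra.Bundles using (RawMonoid)
import Algebra.Definitions.RawMonoid as RawMonoidSum
open import Data.Bool using (if_then_else_; _∧_)
open import Data.Fin using (Fin; toℕ)
open import Data.Integer as ℤ using (ℤ; +_)
open import Data.Integer.Coprimality using (Coprime)
open import Data.Nat as ℕ using (ℕ)
import Data.Nat.Properties as ℕₚ
open import Data.Product using (∃-syntax; _×_; _,_)
open import Data.Rational as ℚ using (ℚ; 0ℚ; 1ℚ; ½)
import Data.Rational.Properties as ℚₚ
open import Data.Rational.Solver using (module +-*-Solver)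
open import Data.Sum using (_⊎_)
open import Level using (0ℓ)
open import Relation.Binary.PropositionalEquality
  using (_≡_; refl; sym; trans; cong; subst)
open import Relation.Nullary using (¬_; does)

-- Real numbers: Cauchy sequences of rationals with a modulus, with
-- equality given by _≈ᴿ_.

IsCauchy : (ℕ → ℚ) → Set
IsCauchy x = ∀ ε → 0ℚ ℚ.< ε →
  ∃[ N ] (∀ i j → N ℕ.≤ i → N ℕ.≤ j → ℚ.∣ x i ℚ.- x j ∣ ℚ.< ε)

record ℝ : Set where
  constructor mkℝ
  field
    seq    : ℕ → ℚ
    cauchy : IsCauchy seq

open ℝ public

infix 4 _≈ᴿ_ _<ᴿ_

_≈ᴿ_ : ℝ → ℝ → Set
x ≈ᴿ y = ∀ ε → 0ℚ ℚ.< ε →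
  ∃[ N ] (∀ i → N ℕ.≤ i → ℚ.∣ seq x i ℚ.- seq y i ∣ ℚ.< ε)

_<ᴿ_ : ℝ → ℝ → Set
x <ᴿ y = ∃[ ε ] (0ℚ ℚ.< ε × ∃[ N ] (∀ i → N ℕ.≤ i → seq x i ℚ.+ ε ℚ.< seq y i))

fromℚ : ℚ → ℝ
fromℚ p = mkℝ (λ _ → p) λ ε 0<ε → 0 , λ _ _ _ _ →
  subst (ℚ._< ε) (sym (cong ℚ.∣_∣ (ℚₚ.+-inverseʳ p))) 0<ε

fromℤ : ℤ → ℝ
fromℤ z = fromℚ (z ℚ./ 1)

0ᴿ : ℝ
0ᴿ = fromℚ 0ℚ

private
  0<½*ε : ∀ ε → 0ℚ ℚ.< ε → 0ℚ ℚ.< ½ ℚ.* ε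
  0<½*ε ε 0<ε = ℚₚ.*-monoʳ-<-pos ½ 0<ε

  ½+½ : ∀ ε → ½ ℚ.* ε ℚ.+ ½ ℚ.* ε ≡ ε
  ½+½ ε = trans (sym (ℚₚ.*-distribʳ-+ ε ½ ½)) (ℚₚ.*-identityˡ ε)

  +-cauchy : ∀ {x y} → IsCauchy x → IsCauchy y → IsCauchy (λ i → x i ℚ.+ y i)
  +-cauchy {x} {y} cx cy ε 0<ε with cx (½ ℚ.* ε) (0<½*ε ε 0<ε) | cy (½ ℚ.* ε) (0<½*ε ε 0<ε)
  ... | M , p | N , q = M ℕ.⊔ N , λ i j M⊔N≤i M⊔N≤j → begin-strict
    ℚ.∣ (x i ℚ.+ y i) ℚ.- (x j ℚ.+ y j) ∣
      ≡⟨ cong ℚ.∣_∣ (rearrange (x i) (y i) (x j) (y j)) ⟩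
    ℚ.∣ (x i ℚ.- x j) ℚ.+ (y i ℚ.- y j) ∣
      ≤⟨ ℚₚ.∣p+q∣≤∣p∣+∣q∣ (x i ℚ.- x j) (y i ℚ.- y j) ⟩
    ℚ.∣ x i ℚ.- x j ∣ ℚ.+ ℚ.∣ y i ℚ.- y j ∣
      <⟨ ℚₚ.+-mono-<
           (p i j (ℕₚ.m⊔n≤o⇒m≤o M N M⊔N≤i) (ℕₚ.m⊔n≤o⇒m≤o M N M⊔N≤j))
           (q i j (ℕₚ.m⊔n≤o⇒n≤o M N M⊔N≤i) (ℕₚ.m⊔n≤o⇒n≤o M N M⊔N≤j)) ⟩
    ½ ℚ.* ε ℚ.+ ½ ℚ.* ε
      ≡⟨ ½+½ ε ⟩
    ε ∎
    where
    open ℚₚ.≤-Reasoning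
    open +-*-Solver
    rearrange : ∀ a b c d → (a ℚ.+ b) ℚ.- (c ℚ.+ d) ≡ (a ℚ.- c) ℚ.+ (b ℚ.- d)
    rearrange = solve 4 (λ a b c d → (a :+ b) :- (c :+ d) := (a :- c) :+ (b :- d)) refl

  neg-cauchy : ∀ {x} → IsCauchy x → IsCauchy (λ i → ℚ.- x i)
  neg-cauchy {x} cx ε 0<ε with cx ε 0<ε
  ... | N , p = N , λ i j N≤i N≤j → subst (ℚ._< ε) (flip-sign (x i) (x j)) (p i j N≤i N≤j)
    where
    flip-sign : ∀ a b → ℚ.∣ a ℚ.- b ∣ ≡ ℚ.∣ (ℚ.- a) ℚ.- (ℚ.- b) ∣
    flip-sign a b = trans (sym (ℚₚ.∣-p∣≡∣p∣ (a ℚ.- b)))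
                          (cong ℚ.∣_∣ (ℚₚ.neg-distrib-+ a (ℚ.- b)))

  eventually-bounded : ∀ {x} → IsCauchy x →
    ∃[ B ] (0ℚ ℚ.< B × ∃[ N ] (∀ i → N ℕ.≤ i → ℚ.∣ x i ∣ ℚ.≤ B))
  eventually-bounded {x} cx with cx 1ℚ (ℚₚ.positive⁻¹ 1ℚ)
  ... | N , p = ℚ.∣ x N ∣ ℚ.+ 1ℚ , ℚₚ.+-mono-≤-< (ℚₚ.0≤∣p∣ (x N)) (ℚₚ.positive⁻¹ 1ℚ) ,
    N , λ i N≤i → begin
    ℚ.∣ x i ∣
      ≡⟨ cong ℚ.∣_∣ (split (x i) (x N)) ⟩
    ℚ.∣ x N ℚ.+ (x i ℚ.- x N) ∣
      ≤⟨ ℚₚ.∣p+q∣≤∣p∣+∣q∣ (x N) (x i ℚ.- x N) ⟩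
    ℚ.∣ x N ∣ ℚ.+ ℚ.∣ x i ℚ.- x N ∣
      ≤⟨ ℚₚ.+-monoʳ-≤ ℚ.∣ x N ∣ (ℚₚ.<⇒≤ (p i N N≤i ℕₚ.≤-refl)) ⟩
    ℚ.∣ x N ∣ ℚ.+ 1ℚ ∎
    where
    open ℚₚ.≤-Reasoning
    open +-*-Solver
    split : ∀ a b → a ≡ b ℚ.+ (a ℚ.- b)
    split = solve 2 (λ a b → a := b :+ (a :- b)) refl

  *-small : ∀ {B p q δ} → 0ℚ ℚ.< B → ℚ.∣ p ∣ ℚ.≤ B → ℚ.∣ q ∣ ℚ.< δ →
            ℚ.∣ p ℚ.* q ∣ ℚ.< B ℚ.* δ
  *-small {B} {p} {q} {δ} 0<B ∣p∣≤B ∣q∣<δ = begin-strict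
    ℚ.∣ p ℚ.* q ∣         ≡⟨ ℚₚ.∣p*q∣≡∣p∣*∣q∣ p q ⟩
    ℚ.∣ p ∣ ℚ.* ℚ.∣ q ∣   ≤⟨ ℚₚ.*-monoʳ-≤-nonNeg ℚ.∣ q ∣ {{ℚₚ.∣-∣-nonNeg q}} ∣p∣≤B ⟩
    B ℚ.* ℚ.∣ q ∣         <⟨ ℚₚ.*-monoʳ-<-pos B {{ℚ.positive 0<B}} ∣q∣<δ ⟩
    B ℚ.* δ               ∎
    where open ℚₚ.≤-Reasoning

  product-difference : ∀ {B C δ} p q r s → 0ℚ ℚ.< B → 0ℚ ℚ.< C →
    ℚ.∣ p ∣ ℚ.≤ B → ℚ.∣ s ∣ ℚ.≤ C → ℚ.∣ q ℚ.- s ∣ ℚ.< δ → ℚ.∣ p ℚ.- r ∣ ℚ.< δ →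
    ℚ.∣ p ℚ.* q ℚ.- r ℚ.* s ∣ ℚ.< B ℚ.* δ ℚ.+ C ℚ.* δ
  product-difference {B} {C} {δ} p q r s 0<B 0<C ∣p∣≤B ∣s∣≤C ∣q-s∣<δ ∣p-r∣<δ = begin-strict
    ℚ.∣ p ℚ.* q ℚ.- r ℚ.* s ∣
      ≡⟨ cong ℚ.∣_∣ (rearrange p q r s) ⟩
    ℚ.∣ p ℚ.* (q ℚ.- s) ℚ.+ s ℚ.* (p ℚ.- r) ∣
      ≤⟨ ℚₚ.∣p+q∣≤∣p∣+∣q∣ (p ℚ.* (q ℚ.- s)) (s ℚ.* (p ℚ.- r)) ⟩
    ℚ.∣ p ℚ.* (q ℚ.- s) ∣ ℚ.+ ℚ.∣ s ℚ.* (p ℚ.- r) ∣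
      <⟨ ℚₚ.+-mono-< (*-small {B} {p} {q ℚ.- s} {δ} 0<B ∣p∣≤B ∣q-s∣<δ)
                     (*-small {C} {s} {p ℚ.- r} {δ} 0<C ∣s∣≤C ∣p-r∣<δ) ⟩
    B ℚ.* δ ℚ.+ C ℚ.* δ ∎
    where
    open ℚₚ.≤-Reasoning
    open +-*-Solver
    rearrange : ∀ p q r s → p ℚ.* q ℚ.- r ℚ.* s ≡ p ℚ.* (q ℚ.- s) ℚ.+ s ℚ.* (p ℚ.- r)
    rearrange = solve 4 (λ p q r s → p :* q :- r :* s := p :* (q :- s) :+ s :* (p :- r)) refl

  split-tolerance : ∀ {B C ε} → 0ℚ ℚ.< B → 0ℚ ℚ.< C → 0ℚ ℚ.< ε →
    ∃[ δ ] (0ℚ ℚ.< δ × B ℚ.* δ ℚ.+ C ℚ.* δ ≡ ε)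
  split-tolerance {B} {C} {ε} 0<B 0<C 0<ε = δ , 0<δ , eq
    where
    S = B ℚ.+ C
    instance
      S-positive : ℚ.Positive S
      S-positive = ℚ.positive (ℚₚ.+-mono-< 0<B 0<C)
      S-nonZero : ℚ.NonZero S
      S-nonZero = ℚₚ.pos⇒nonZero S
    δ = ε ℚ.* ℚ.1/ S
    0<δ : 0ℚ ℚ.< δ
    0<δ = ℚₚ.positive⁻¹ δ
      {{ℚₚ.pos*pos⇒pos ε {{ℚ.positive 0<ε}} (ℚ.1/ S) {{ℚₚ.1/pos⇒pos S}}}}
    eq : B ℚ.* δ ℚ.+ C ℚ.* δ ≡ ε
    eq = trans (sym (ℚₚ.*-distribʳ-+ δ B C)) (trans (ℚₚ.*-comm S δ)
      (trans (ℚₚ.*-assoc ε (ℚ.1/ S) S)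
      (trans (cong (ε ℚ.*_) (ℚₚ.*-inverseˡ S)) (ℚₚ.*-identityʳ ε))))

  *-cauchy : ∀ {x y} → IsCauchy x → IsCauchy y → IsCauchy (λ i → x i ℚ.* y i)
  *-cauchy {x} {y} cx cy ε 0<ε =
    let B , 0<B , K , ∣x∣≤B = eventually-bounded cx
        C , 0<C , L , ∣y∣≤C = eventually-bounded cy
        δ , 0<δ , B*δ+C*δ≡ε = split-tolerance 0<B 0<C 0<ε
        M , p = cx δ 0<δ
        N , q = cy δ 0<δ
    in (M ℕ.⊔ N) ℕ.⊔ (K ℕ.⊔ L) , λ i j ≤i ≤j →
    let MN≤i = ℕₚ.m⊔n≤o⇒m≤o (M ℕ.⊔ N) (K ℕ.⊔ L) ≤i
        KL≤i = ℕₚ.m⊔n≤o⇒n≤o (M ℕ.⊔ N) (K ℕ.⊔ L) ≤i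
        MN≤j = ℕₚ.m⊔n≤o⇒m≤o (M ℕ.⊔ N) (K ℕ.⊔ L) ≤j
        KL≤j = ℕₚ.m⊔n≤o⇒n≤o (M ℕ.⊔ N) (K ℕ.⊔ L) ≤j
    in subst (ℚ.∣ x i ℚ.* y i ℚ.- x j ℚ.* y j ∣ ℚ.<_) B*δ+C*δ≡ε
      (product-difference (x i) (y i) (x j) (y j) 0<B 0<C
        (∣x∣≤B i (ℕₚ.m⊔n≤o⇒m≤o K L KL≤i)) (∣y∣≤C j (ℕₚ.m⊔n≤o⇒n≤o K L KL≤j))
        (q i j (ℕₚ.m⊔n≤o⇒n≤o M N MN≤i) (ℕₚ.m⊔n≤o⇒n≤o M N MN≤j))
        (p i j (ℕₚ.m⊔n≤o⇒m≤o M N MN≤i) (ℕₚ.m⊔n≤o⇒m≤o M N MN≤j)))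

infixl 6 _+ᴿ_ _-ᴿ_
infixl 7 _*ᴿ_
infix  8 -ᴿ_

_+ᴿ_ : ℝ → ℝ → ℝ
mkℝ x cx +ᴿ mkℝ y cy = mkℝ (λ i → x i ℚ.+ y i) (+-cauchy {x} {y} cx cy)

-ᴿ_ : ℝ → ℝ
-ᴿ mkℝ x cx = mkℝ (λ i → ℚ.- x i) (neg-cauchy {x} cx)

_-ᴿ_ : ℝ → ℝ → ℝ
x -ᴿ y = x +ᴿ (-ᴿ y)

_*ᴿ_ : ℝ → ℝ → ℝ
mkℝ x cx *ᴿ mkℝ y cy = mkℝ (λ i → x i ℚ.* y i) (*-cauchy {x} {y} cx cy)

+ᴿ-rawMonoid : RawMonoid 0ℓ 0ℓ
+ᴿ-rawMonoid = record { Carrier = ℝ ; _≈_ = _≈ᴿ_ ; _∙_ = _+ᴿ_ ; ε = 0ᴿ }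

open RawMonoidSum +ᴿ-rawMonoid public using (sum)

record Direction : Set where
  field
    a b     : ℤ
    coprime : Coprime a b

open Direction public

infix 4 _≗ᵈ_

_≗ᵈ_ : Direction → Direction → Set
u ≗ᵈ v = (a u ≡ a v × b u ≡ b v) ⊎ (a u ≡ ℤ.- a v × b u ≡ ℤ.- b v)

DirectionSet : ℕ → Set
DirectionSet d = Fin d → Direction

Distinct : ∀ {d} → DirectionSet d → Set
Distinct D = ∀ h k → D h ≗ᵈ D k → h ≡ k

-- Functions on A = {0,…,m-1} × {0,…,n-1}.
Table : ℕ → ℕ → Set
Table m n = Fin m → Fin n → ℝ

coord : ∀ {k} → Fin k → ℤ
coord p = + toℕ p

module _ {m n : ℕ} where

  lineSum : Direction → ℤ → Table m n → ℝ
  lineSum v c f = sum λ p → sum λ q →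
    if does (a v ℤ.* coord q ℤ.≟ b v ℤ.* coord p ℤ.+ c) then f p q else 0ᴿ

  SameLineSums : ∀ {d} → DirectionSet d → Table m n → Table m n → Set
  SameLineSums D f g = ∀ h c → lineSum (D h) c f ≈ᴿ lineSum (D h) c g

  Switching : ∀ {d} → DirectionSet d → Table m n → Set
  Switching D F = ∀ h c → lineSum (D h) c F ≈ᴿ 0ᴿ

  Support : Table m n → Fin m → Fin n → Set
  Support F p q = ¬ (F p q ≈ᴿ 0ᴿ)

  InSomeSwitchingDomain : ∀ {d} → DirectionSet d → Fin m → Fin n → Set
  InSomeSwitchingDomain D p q = ∃[ F ] (Switching D F × Support F p q)

-- A random access machine at unit cost.  Memory consists of integer
-- arrays and real arrays, named by natural numbers, each with two
-- integer indices.  Only integers can serve as indices, and there is no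
-- rounding operation from reals to integers.

data Sort : Set where
  int real : Sort

Value : Sort → Set
Value int  = ℤ
Value real = ℝ

Store : Set
Store = (s : Sort) → ℕ → ℤ → ℤ → Value s

update : (s : Sort) → ℕ → ℤ → ℤ → Value s → Store → Store
update int x i j v σ int y k l =
  if does (x ℕ.≟ y) ∧ does (i ℤ.≟ k) ∧ does (j ℤ.≟ l) then v else σ int y k l
update real x i j v σ real y k l =
  if does (x ℕ.≟ y) ∧ does (i ℤ.≟ k) ∧ does (j ℤ.≟ l) then v else σ real y k l
update int  _ _ _ _ σ real = σ real
update real _ _ _ _ σ int  = σ int

data Op : Set where
  add sub mul : Op

apply : (s : Sort) → Op → Value s → Value s → Value s
apply int  add = ℤ._+_
apply int  sub = ℤ._-_
apply int  mul = ℤ._*_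
apply real add = _+ᴿ_
apply real sub = _-ᴿ_
apply real mul = _*ᴿ_

Less : (s : Sort) → Value s → Value s → Set
Less int  = ℤ._<_
Less real = _<ᴿ_

data Exp : Sort → Set where
  lit     : ℤ → Exp int
  toReal  : Exp int → Exp real
  _[_,_]  : ∀ {s} → ℕ → Exp int → Exp int → Exp s
  op      : ∀ {s} → Op → Exp s → Exp s → Exp s

eval : ∀ {s} → Store → Exp s → Value s
eval σ (lit z)           = z
eval σ (toReal e)        = fromℤ (eval σ e)
eval {s} σ (x [ i , j ]) = σ s x (eval σ i) (eval σ j)
eval {s} σ (op o e e′)   = apply s o (eval σ e) (eval σ e′)

expCost : ∀ {s} → Exp s → ℕ
expCost (lit _)       = 0
expCost (toReal e)    = expCost e
expCost (x [ i , j ]) = expCost i ℕ.+ expCost j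
expCost (op _ e e′)   = 1 ℕ.+ (expCost e ℕ.+ expCost e′)

infix 5 _≺_
infix 4 _[_,_]≔_ _[_,_]≔_÷_
infixr 3 _⨾_

data Test : Set where
  _≺_ : ∀ {s} → Exp s → Exp s → Test

Holds : Store → Test → Set
Holds σ (_≺_ {s} e e′) = Less s (eval σ e) (eval σ e′)

testCost : Test → ℕ
testCost (e ≺ e′) = 1 ℕ.+ (expCost e ℕ.+ expCost e′)

data Program : Set where
  skip          : Program
  _[_,_]≔_      : ∀ {s} → ℕ → Exp int → Exp int → Exp s → Program
  _[_,_]≔_÷_    : ℕ → Exp int → Exp int → Exp real → Exp real → Program
  _⨾_           : Program → Program → Program
  cond          : Test → Program → Program → Program
  while         : Test → Program → Program

-- ⟨ P , σ ⟩⇓[ k ] τ : started in σ, P halts in τ after k basic operations.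
-- A quotient is specified by its defining equation, and division by zero
-- has no execution.  The order on ℝ is not decidable in Agda, so the
-- branch not taken is expressed by negation.
data ⟨_,_⟩⇓[_]_ : Program → Store → ℕ → Store → Set where

  skip : ∀ {σ} → ⟨ skip , σ ⟩⇓[ 0 ] σ

  assign : ∀ {σ s x i j} {e : Exp s} →
    ⟨ x [ i , j ]≔ e , σ ⟩⇓[ 1 ℕ.+ (expCost i ℕ.+ expCost j ℕ.+ expCost e) ]
      update s x (eval σ i) (eval σ j) (eval σ e) σ

  divide : ∀ {σ x i j e e′ z} →
    ¬ (eval σ e′ ≈ᴿ 0ᴿ) → z *ᴿ eval σ e′ ≈ᴿ eval σ e →
    ⟨ x [ i , j ]≔ e ÷ e′ , σ ⟩⇓[ 2 ℕ.+ (expCost i ℕ.+ expCost j ℕ.+ (expCost e ℕ.+ expCost e′)) ]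
      update real x (eval σ i) (eval σ j) z σ

  chain : ∀ {P Q σ τ υ k l} →
    ⟨ P , σ ⟩⇓[ k ] τ → ⟨ Q , τ ⟩⇓[ l ] υ →
    ⟨ P ⨾ Q , σ ⟩⇓[ k ℕ.+ l ] υ

  cond-true : ∀ {t P Q σ τ k} →
    Holds σ t → ⟨ P , σ ⟩⇓[ k ] τ →
    ⟨ cond t P Q , σ ⟩⇓[ testCost t ℕ.+ k ] τ

  cond-false : ∀ {t P Q σ τ k} →
    ¬ Holds σ t → ⟨ Q , σ ⟩⇓[ k ] τ →
    ⟨ cond t P Q , σ ⟩⇓[ testCost t ℕ.+ k ] τ

  while-true : ∀ {t P σ τ υ k l} →
    Holds σ t → ⟨ P , σ ⟩⇓[ k ] τ → ⟨ while t P , τ ⟩⇓[ l ] υ →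
    ⟨ while t P , σ ⟩⇓[ testCost t ℕ.+ k ℕ.+ l ] υ

  while-false : ∀ {t P σ} →
    ¬ Holds σ t →
    ⟨ while t P , σ ⟩⇓[ testCost t ] σ

-- The store holds m, n, D and the line sums of f.  All other cells are
-- arbitrary.
record Input {m n d : ℕ} (D : DirectionSet d) (f : Table m n) (σ : Store) : Set where
  field
    width      : σ int 0 (+ 0) (+ 0) ≡ + m
    height     : σ int 1 (+ 0) (+ 0) ≡ + n
    size       : σ int 2 (+ 0) (+ 0) ≡ + d
    direction₁ : ∀ h → σ int 3 (coord h) (+ 0) ≡ a (D h)
    direction₂ : ∀ h → σ int 4 (coord h) (+ 0) ≡ b (D h)
    line-sums  : ∀ h c → σ real 0 (coord h) c ≈ᴿ lineSum (D h) c f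

output : ∀ {m n} → Store → Table m n
output σ p q = σ real 1 (coord p) (coord q)

{-# OPTIONS --safe #-}
module Submission where

-- Regard f as a Laurent polynomial, and let v be the first direction.  Pick a
-- point on each line of direction v that meets the grid and place the line sum
-- there: this gives r with f = r + (v − 1) h, where h lives on the smaller grid
-- of the P such that P and P + v both lie in the grid.  In another direction w
-- the line sums T of f − r and H of h satisfy T(c) = H(c − s) − H(c) with
-- s = det(w, v) ≠ 0, so H is computed from T, and one continues with h and the
-- remaining directions until these or the grid are exhausted.  Going back through
-- g = r + (v − 1) g′ from g = 0 yields a function with the given line sums.
-- Its difference with f is a switching function, which is why it agrees with f
-- outside the switching domains.
--
-- Direction (a,b) has O(|a|n + |b|m) lines.  Only the directions up to the one
-- which makes Σ|a| ≥ m or Σ|b| ≥ n are used, so their numbers of lines add up to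
-- O(mn) as long as always |a| < m and |b| < n; in the remaining case each line
-- of the offending direction has at most one point, and f can be read off.

open import Defs
open import Algebra.Bundles using (AbelianGroup; RawMonoid)
import Algebra.Definitions.RawMonoid as RawMonoidSum
import Algebra.Properties.AbelianGroup as AbelianGroupProperties
import Algebra.Properties.CommutativeMonoid.Sum as CommutativeMonoidSum
open import Data.Bool using (Bool; true; false; if_then_else_; _∧_; _∨_)
open import Data.Bool.Properties using (∨-conicalˡ; ∨-conicalʳ)
open import Data.Fin as Fin using (Fin; toℕ; fromℕ<)
import Data.Fin.Properties as Finₚ
open import Data.Integer as ℤ using (ℤ; +_; -[1+_]; 0ℤ; 1ℤ)
open import Data.Integer.Coprimality using (Coprime)
import Data.Integer.Properties as ℤₚ
open import Data.Integer.Tactic.RingSolver using (solve-∀)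
open import Data.List as List using (List; []; _∷_; _++_)
open import Data.List.Relation.Unary.All as All using (All; []; _∷_)
import Data.List.Relation.Unary.All.Properties as Allₚ
open import Data.Nat using (ℕ; NonZero; _*_; _≤_)
open import Data.Nat as ℕ using (zero; suc)
open import Data.Nat.Coprimality using (coprime-Bézout)
open import Data.Nat.Divisibility using (_∣_; _∣0; divides)
open import Data.Nat.GCD using (module Bézout)
import Data.Nat.Properties as ℕₚ
import Data.Nat.Tactic.RingSolver as ℕ-Ring
open import Data.Product using (∃-syntax; _×_; _,_; proj₁; proj₂)
open import Data.Product.Properties using (≡-dec)
open import Data.Rational as ℚ using (ℚ; 0ℚ; ½)
import Data.Rational.Properties as ℚₚ
import Data.Rational.Solver
open import Data.Sum using (_⊎_; inj₁; inj₂; [_,_]′)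
open import Function using (_∘_; mk⇔)
open import Level using (0ℓ)
open import Relation.Binary.PropositionalEquality
  using (_≡_; _≢_; refl; sym; trans; cong; cong₂; subst; module ≡-Reasoning)
open import Relation.Nullary using (¬_; Dec; yes; no; contradiction; does)
open import Relation.Nullary.Decidable using (dec-true; dec-false; does-⇔; _×-dec_)

-- The program never knows h, only line sums. In r all mass of a line of direction v sits in one
-- point, which lies on one line of w, so removing r from the line sums in direction w costs one
-- subtraction per line of v. The quotient h exists in the proof alone, as a formal sum obtained by
-- telescoping along v. Testing formal sums against an arbitrary predicate χ on points makes one
-- identity f = r + (v - 1) h serve for line sums and for values. Finite support makes T(c) = H(c -
-- s) - H(c) solvable: T and H vanish beyond the reach of w, and s ≠ 0 orders the remaining c. H
-- overwrites T, while the row of v keeps the line sums from which r is rebuilt on the way back.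
-- Once the window is empty, h = 0, so 0 has its line sums in all d directions, including those
-- never divided out. A pair of directions costs the sum of their numbers of lines, so the forward
-- pass costs at most d times the total number of lines, besides d sweeps of the grid. Equality of
-- reals is undecidable here: the program branches on integers only, and agreement off the switching
-- domains rests on equality being stable under double negation.

module ℚ-Solver = Data.Rational.Solver.+-*-Solver

-- Real numbers

Null : (ℕ → ℚ) → Set
Null u = ∀ ε → 0ℚ ℚ.< ε → ∃[ N ] (∀ i → N ≤ i → ℚ.∣ u i ∣ ℚ.< ε)

0<½* : ∀ {ε} → 0ℚ ℚ.< ε → 0ℚ ℚ.< ½ ℚ.* ε
0<½* 0<ε = ℚₚ.*-monoʳ-<-pos ½ 0<ε

½*+½* : ∀ ε → ½ ℚ.* ε ℚ.+ ½ ℚ.* ε ≡ ε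
½*+½* ε = trans (sym (ℚₚ.*-distribʳ-+ ε ½ ½)) (ℚₚ.*-identityˡ ε)

null-+ : ∀ {u v w} → Null u → Null v → (∀ i → w i ≡ u i ℚ.+ v i) → Null w
null-+ {u} {v} {w} Nu Nv w≡ ε 0<ε with Nu (½ ℚ.* ε) (0<½* 0<ε) | Nv (½ ℚ.* ε) (0<½* 0<ε)
... | M , p | N , q = M ℕ.⊔ N , λ i ≤i → begin-strict
  ℚ.∣ w i ∣                  ≡⟨ cong ℚ.∣_∣ (w≡ i) ⟩
  ℚ.∣ u i ℚ.+ v i ∣          ≤⟨ ℚₚ.∣p+q∣≤∣p∣+∣q∣ (u i) (v i) ⟩
  ℚ.∣ u i ∣ ℚ.+ ℚ.∣ v i ∣
    <⟨ ℚₚ.+-mono-< (p i (ℕₚ.m⊔n≤o⇒m≤o M N ≤i)) (q i (ℕₚ.m⊔n≤o⇒n≤o M N ≤i)) ⟩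
  ½ ℚ.* ε ℚ.+ ½ ℚ.* ε        ≡⟨ ½*+½* ε ⟩
  ε                          ∎
  where open ℚₚ.≤-Reasoning

null-neg : ∀ {u w} → Null u → (∀ i → w i ≡ ℚ.- u i) → Null w
null-neg {u} Nu w≡ ε 0<ε with Nu ε 0<ε
... | N , p = N , λ i N≤i →
  subst (ℚ._< ε) (sym (trans (cong ℚ.∣_∣ (w≡ i)) (ℚₚ.∣-p∣≡∣p∣ (u i)))) (p i N≤i)

infix 4 _≃_

-- _≈ᴿ_ wrapped in a record, so that both sides can be inferred from the type.
record _≃_ (x y : ℝ) : Set where
  constructor ⌈_⌉
  field ⌊_⌋ : x ≈ᴿ y

open _≃_ public

≗⇒≃ : ∀ {x y} → (∀ i → seq x i ≡ seq y i) → x ≃ y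
≗⇒≃ {x} {y} x≗y = ⌈ (λ ε 0<ε → 0 , λ i _ → subst (ℚ._< ε)
  (sym (cong ℚ.∣_∣ (trans (cong (ℚ._- seq y i) (x≗y i)) (ℚₚ.+-inverseʳ (seq y i))))) 0<ε) ⌉

≃-refl : ∀ {x} → x ≃ x
≃-refl = ≗⇒≃ λ _ → refl

≡⇒≃ : ∀ {x y} → x ≡ y → x ≃ y
≡⇒≃ refl = ≃-refl

≃-sym : ∀ {x y} → x ≃ y → y ≃ x
≃-sym {x} {y} ⌈ x≈y ⌉ = ⌈ null-neg x≈y (λ i →
  solve 2 (λ x y → y :- x := :- (x :- y)) refl (seq x i) (seq y i)) ⌉
  where open ℚ-Solver

≃-trans : ∀ {x y z} → x ≃ y → y ≃ z → x ≃ z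
≃-trans {x} {y} {z} ⌈ x≈y ⌉ ⌈ y≈z ⌉ = ⌈ null-+ x≈y y≈z (λ i →
  solve 3 (λ x y z → x :- z := (x :- y) :+ (y :- z)) refl (seq x i) (seq y i) (seq z i)) ⌉
  where open ℚ-Solver

infixl 6 _⊕_ _⊝_
infix 8 ⊖_

-- Opaque copies of the real operations: the originals unfold to rational
-- arithmetic during unification.
opaque
  _⊕_ : ℝ → ℝ → ℝ
  _⊕_ = _+ᴿ_

  ⊖_ : ℝ → ℝ
  ⊖_ = -ᴿ_

  𝟘 : ℝ
  𝟘 = 0ᴿ

_⊝_ : ℝ → ℝ → ℝ
x ⊝ y = x ⊕ ⊖ y

opaque
  unfolding _⊕_ ⊖_ 𝟘

  +ᴿ≡⊕ : ∀ x y → x +ᴿ y ≡ x ⊕ y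
  +ᴿ≡⊕ x y = refl

  -ᴿ≃⊝ : ∀ x y → x -ᴿ y ≃ x ⊝ y
  -ᴿ≃⊝ x y = ≗⇒≃ {x -ᴿ y} {x ⊝ y} λ i → refl {x = seq x i ℚ.+ ℚ.- seq y i}

  0ᴿ≡𝟘 : 0ᴿ ≡ 𝟘
  0ᴿ≡𝟘 = refl

  fromℤ0≡𝟘 : fromℤ (+ 0) ≡ 𝟘
  fromℤ0≡𝟘 = refl

  ⊕-cong : ∀ {x y u v} → x ≃ y → u ≃ v → x ⊕ u ≃ y ⊕ v
  ⊕-cong {x} {y} {u} {v} ⌈ x≈y ⌉ ⌈ u≈v ⌉ = ⌈ null-+ x≈y u≈v (λ i →
    solve 4 (λ x y u v → (x :+ u) :- (y :+ v) := (x :- y) :+ (u :- v)) refl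
      (seq x i) (seq y i) (seq u i) (seq v i)) ⌉
    where open ℚ-Solver

  ⊖-cong : ∀ {x y} → x ≃ y → ⊖ x ≃ ⊖ y
  ⊖-cong {x} {y} ⌈ x≈y ⌉ = ⌈ null-neg x≈y (λ i →
    solve 2 (λ x y → (:- x) :- (:- y) := :- (x :- y)) refl (seq x i) (seq y i)) ⌉
    where open ℚ-Solver

  ⊕-assoc : ∀ x y z → (x ⊕ y) ⊕ z ≃ x ⊕ (y ⊕ z)
  ⊕-assoc x y z = ≗⇒≃ λ i → ℚₚ.+-assoc (seq x i) (seq y i) (seq z i)

  ⊕-comm : ∀ x y → x ⊕ y ≃ y ⊕ x
  ⊕-comm x y = ≗⇒≃ λ i → ℚₚ.+-comm (seq x i) (seq y i)

  ⊕-identityˡ : ∀ x → 𝟘 ⊕ x ≃ x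
  ⊕-identityˡ x = ≗⇒≃ λ i → ℚₚ.+-identityˡ (seq x i)

  ⊕-identityʳ : ∀ x → x ⊕ 𝟘 ≃ x
  ⊕-identityʳ x = ≗⇒≃ λ i → ℚₚ.+-identityʳ (seq x i)

  ⊖-inverseˡ : ∀ x → ⊖ x ⊕ x ≃ 𝟘
  ⊖-inverseˡ x = ≗⇒≃ λ i → ℚₚ.+-inverseˡ (seq x i)

  ⊖-inverseʳ : ∀ x → x ⊕ ⊖ x ≃ 𝟘
  ⊖-inverseʳ x = ≗⇒≃ λ i → ℚₚ.+-inverseʳ (seq x i)

⊝-cong : ∀ {x y u v} → x ≃ y → u ≃ v → x ⊝ u ≃ y ⊝ v
⊝-cong x≃y u≃v = ⊕-cong x≃y (⊖-cong u≃v)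

ℝ-abelianGroup : AbelianGroup 0ℓ 0ℓ
ℝ-abelianGroup = record
  { Carrier = ℝ ; _≈_ = _≃_ ; _∙_ = _⊕_ ; ε = 𝟘 ; _⁻¹ = ⊖_
  ; isAbelianGroup = record
    { isGroup = record
      { isMonoid = record
        { isSemigroup = record
          { isMagma = record
            { isEquivalence = record { refl = ≃-refl ; sym = ≃-sym ; trans = ≃-trans }
            ; ∙-cong = ⊕-cong }
          ; assoc = ⊕-assoc }
        ; identity = ⊕-identityˡ , ⊕-identityʳ }
      ; inverse = ⊖-inverseˡ , ⊖-inverseʳ
      ; ⁻¹-cong = ⊖-cong }
    ; comm = ⊕-comm } }

module ∑ = CommutativeMonoidSum (AbelianGroup.commutativeMonoid ℝ-abelianGroup)

-- A Cauchy sequence that hardly varies beyond N is small from N on as soon as it is small at N.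
-- Smallness at N compares two rationals, so it is decidable, and this removes the double negation.
null-stable : ∀ u → IsCauchy u → ¬ ¬ Null u → Null u
null-stable u cauchy-u ¬¬Null ε 0<ε = N , near
  where
  η = ½ ℚ.* ε
  0<η = 0<½* 0<ε
  N = proj₁ (cauchy-u (½ ℚ.* η) (0<½* 0<η))
  close : ∀ i → N ≤ i → ℚ.∣ u i ℚ.- u N ∣ ℚ.< ½ ℚ.* η
  close i N≤i = proj₂ (cauchy-u (½ ℚ.* η) (0<½* 0<η)) i N N≤i ℕₚ.≤-refl
  close′ : ∀ i → N ≤ i → ℚ.∣ u N ℚ.- u i ∣ ℚ.< ½ ℚ.* η
  close′ i N≤i = proj₂ (cauchy-u (½ ℚ.* η) (0<½* 0<η)) N i ℕₚ.≤-refl N≤i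
  open ℚₚ.≤-Reasoning
  ½η<η : ½ ℚ.* η ℚ.< η
  ½η<η = begin-strict
    ½ ℚ.* η                 ≡⟨ ℚₚ.+-identityʳ (½ ℚ.* η) ⟨
    ½ ℚ.* η ℚ.+ 0ℚ          <⟨ ℚₚ.+-monoʳ-< (½ ℚ.* η) (0<½* 0<η) ⟩
    ½ ℚ.* η ℚ.+ ½ ℚ.* η     ≡⟨ ½*+½* η ⟩
    η                       ∎
  triangle : ∀ p q → ℚ.∣ p ∣ ℚ.≤ ℚ.∣ q ∣ ℚ.+ ℚ.∣ p ℚ.- q ∣
  triangle p q = begin
    ℚ.∣ p ∣                         ≡⟨ cong ℚ.∣_∣ (split p q) ⟩
    ℚ.∣ q ℚ.+ (p ℚ.- q) ∣           ≤⟨ ℚₚ.∣p+q∣≤∣p∣+∣q∣ q (p ℚ.- q) ⟩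
    ℚ.∣ q ∣ ℚ.+ ℚ.∣ p ℚ.- q ∣       ∎
    where
    open ℚ-Solver
    split = solve 2 (λ p q → p := q :+ (p :- q)) refl
  centre : ℚ.∣ u N ∣ ℚ.< η
  centre with ℚ.∣ u N ∣ ℚₚ.<? η
  ... | yes p = p
  -- A null sequence would have a late term within η/2 both of 0 and of `u N`.
  ... | no ¬p = contradiction (λ (Nu : Null u) →
    let M , small = Nu (½ ℚ.* η) (0<½* 0<η)
        i = M ℕ.⊔ N
    in ¬p (begin-strict
      ℚ.∣ u N ∣
        ≤⟨ triangle (u N) (u i) ⟩
      ℚ.∣ u i ∣ ℚ.+ ℚ.∣ u N ℚ.- u i ∣
        <⟨ ℚₚ.+-mono-< (small i (ℕₚ.m≤m⊔n M N)) (close′ i (ℕₚ.m≤n⊔m M N)) ⟩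
      ½ ℚ.* η ℚ.+ ½ ℚ.* η
        ≡⟨ ½*+½* η ⟩
      η ∎)) ¬¬Null
  near : ∀ i → N ≤ i → ℚ.∣ u i ∣ ℚ.< ε
  near i N≤i = begin-strict
    ℚ.∣ u i ∣                                 ≤⟨ triangle (u i) (u N) ⟩
    ℚ.∣ u N ∣ ℚ.+ ℚ.∣ u i ℚ.- u N ∣   <⟨ ℚₚ.+-mono-< centre (ℚₚ.<-trans (close i N≤i) ½η<η) ⟩
    η ℚ.+ η                                       ≡⟨ ½*+½* ε ⟩
    ε                                             ∎

≈ᴿ-stable : ∀ x y → ¬ ¬ (x ≈ᴿ y) → x ≈ᴿ y
≈ᴿ-stable x y = null-stable (λ i → seq x i ℚ.- seq y i) (cauchy (x -ᴿ y))

-- Lattice lines and boxes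

-- The way linear integer inequalities are proved throughout: the difference of the two sides of the
-- goal is exhibited as a known nonnegative difference, or in `linear₂` as a sum of two, and the
-- ring solver checks the identity.
linear₁ : ∀ {x y u v} → x ℤ.≤ y → y ℤ.- x ≡ v ℤ.- u → u ℤ.≤ v
linear₁ x≤y eq = ℤₚ.0≤i-j⇒j≤i (subst (0ℤ ℤ.≤_) eq (ℤₚ.i≤j⇒0≤j-i x≤y))

linear₂ : ∀ {x y x′ y′ u v} → x ℤ.≤ y → x′ ℤ.≤ y′ →
  (y ℤ.- x) ℤ.+ (y′ ℤ.- x′) ≡ v ℤ.- u → u ℤ.≤ v
linear₂ x≤y x′≤y′ eq =
  ℤₚ.0≤i-j⇒j≤i (subst (0ℤ ℤ.≤_) eq (ℤₚ.+-mono-≤ (ℤₚ.i≤j⇒0≤j-i x≤y) (ℤₚ.i≤j⇒0≤j-i x′≤y′)))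

Point : Set
Point = ℤ × ℤ

infixl 6 _+ᵖ_
infixl 7 _*ᵖ_

_+ᵖ_ : Point → Point → Point
(p , q) +ᵖ (a , b) = p ℤ.+ a , q ℤ.+ b

_*ᵖ_ : ℤ → Point → Point
k *ᵖ (a , b) = k ℤ.* a , k ℤ.* b

-- The c for which P lies on the line L(a,b,c).
line : Point → Point → ℤ
line (a , b) (p , q) = a ℤ.* q ℤ.- b ℤ.* p

line-+ : ∀ v P Q → line v (P +ᵖ Q) ≡ line v P ℤ.+ line v Q
line-+ (a , b) (p , q) (x , y) = identity a b p q x y
  where
  identity : ∀ a b p q x y →
    a ℤ.* (q ℤ.+ y) ℤ.- b ℤ.* (p ℤ.+ x) ≡ (a ℤ.* q ℤ.- b ℤ.* p) ℤ.+ (a ℤ.* y ℤ.- b ℤ.* x)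
  identity = solve-∀

line-self : ∀ v → line v v ≡ 0ℤ
line-self (a , b) = identity a b
  where
  identity : ∀ a b → a ℤ.* b ℤ.- b ℤ.* a ≡ 0ℤ
  identity = solve-∀

Primitive : Point → Set
Primitive (a , b) = Coprime a b

absSign : ∀ i → ∃[ s ] s ℤ.* i ≡ + ℤ.∣ i ∣
absSign (+ n)    = 1ℤ , ℤₚ.*-identityˡ (+ n)
absSign -[1+ n ] = ℤ.- 1ℤ , cong +_ (cong suc (ℕₚ.+-identityʳ n))

-- Bézout's identity for the absolute values, in either of its two signed forms, with the signs of a
-- and b moved into the coefficients.
bézout : ∀ {a b} → Coprime a b → ∃[ u ] ∃[ w ] u ℤ.* a ℤ.+ w ℤ.* b ≡ 1ℤ
bézout {a} {b} a⊥b with coprime-Bézout a⊥b | absSign a | absSign b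
... | Bézout.+- x y eq | s , sa | t , tb = + x ℤ.* s , ℤ.- (+ y) ℤ.* t , (begin
  + x ℤ.* s ℤ.* a ℤ.+ ℤ.- (+ y) ℤ.* t ℤ.* b      ≡⟨ regroup (+ x) s a (+ y) t b ⟩
  + x ℤ.* (s ℤ.* a) ℤ.- + y ℤ.* (t ℤ.* b)        ≡⟨ cong₂ (λ i j → + x ℤ.* i ℤ.- + y ℤ.* j) sa tb ⟩
  + x ℤ.* + m ℤ.- + y ℤ.* + n                    ≡⟨ cong (ℤ._- (+ y ℤ.* + n)) (ℤₚ.pos-* x m) ⟨
  + (x * m) ℤ.- + y ℤ.* + n                    ≡⟨ cong (λ k → + k ℤ.- + y ℤ.* + n) eq ⟨
  + (1 ℕ.+ y * n) ℤ.- + y ℤ.* + n              ≡⟨ cong (λ i → 1ℤ ℤ.+ i ℤ.- + y ℤ.* + n) (ℤₚ.pos-* y n) ⟩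
  1ℤ ℤ.+ + y ℤ.* + n ℤ.- + y ℤ.* + n             ≡⟨ cancel (+ y ℤ.* + n) ⟩
  1ℤ                                             ∎)
  where
  open ≡-Reasoning
  m = ℤ.∣ a ∣
  n = ℤ.∣ b ∣
  regroup : ∀ x s a y t b →
    x ℤ.* s ℤ.* a ℤ.+ ℤ.- y ℤ.* t ℤ.* b ≡ x ℤ.* (s ℤ.* a) ℤ.- y ℤ.* (t ℤ.* b)
  regroup = solve-∀
  cancel : ∀ i → 1ℤ ℤ.+ i ℤ.- i ≡ 1ℤ
  cancel = solve-∀
... | Bézout.-+ x y eq | s , sa | t , tb = ℤ.- (+ x) ℤ.* s , + y ℤ.* t , (begin
  ℤ.- (+ x) ℤ.* s ℤ.* a ℤ.+ + y ℤ.* t ℤ.* b      ≡⟨ regroup (+ x) s a (+ y) t b ⟩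
  + y ℤ.* (t ℤ.* b) ℤ.- + x ℤ.* (s ℤ.* a)        ≡⟨ cong₂ (λ i j → + y ℤ.* j ℤ.- + x ℤ.* i) sa tb ⟩
  + y ℤ.* + n ℤ.- + x ℤ.* + m                    ≡⟨ cong (ℤ._- (+ x ℤ.* + m)) (ℤₚ.pos-* y n) ⟨
  + (y * n) ℤ.- + x ℤ.* + m                    ≡⟨ cong (λ k → + k ℤ.- + x ℤ.* + m) eq ⟨
  + (1 ℕ.+ x * m) ℤ.- + x ℤ.* + m              ≡⟨ cong (λ i → 1ℤ ℤ.+ i ℤ.- + x ℤ.* + m) (ℤₚ.pos-* x m) ⟩
  1ℤ ℤ.+ + x ℤ.* + m ℤ.- + x ℤ.* + m             ≡⟨ cancel (+ x ℤ.* + m) ⟩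
  1ℤ                                             ∎)
  where
  open ≡-Reasoning
  m = ℤ.∣ a ∣
  n = ℤ.∣ b ∣
  regroup : ∀ x s a y t b →
    ℤ.- x ℤ.* s ℤ.* a ℤ.+ y ℤ.* t ℤ.* b ≡ y ℤ.* (t ℤ.* b) ℤ.- x ℤ.* (s ℤ.* a)
  regroup = solve-∀
  cancel : ∀ i → 1ℤ ℤ.+ i ℤ.- i ≡ 1ℤ
  cancel = solve-∀

parallel⇒multiple : ∀ v Q → Primitive v → line v Q ≡ 0ℤ → ∃[ k ] Q ≡ k *ᵖ v
parallel⇒multiple (a , b) (x , y) a⊥b eq = k , sym (cong₂ _,_ k*a≡x k*b≡y)
  where
  open ≡-Reasoning
  u = proj₁ (bézout {a} {b} a⊥b)
  w = proj₁ (proj₂ (bézout {a} {b} a⊥b))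
  ua+wb≡1 : u ℤ.* a ℤ.+ w ℤ.* b ≡ 1ℤ
  ua+wb≡1 = proj₂ (proj₂ (bézout {a} {b} a⊥b))
  -- The functional (x, y) ↦ u x + w y takes v to 1, so its value at Q is the only possible
  -- multiple.
  k = u ℤ.* x ℤ.+ w ℤ.* y
  first : ∀ a b u w x y → (u ℤ.* x ℤ.+ w ℤ.* y) ℤ.* a
    ≡ (u ℤ.* a ℤ.+ w ℤ.* b) ℤ.* x ℤ.+ w ℤ.* (a ℤ.* y ℤ.- b ℤ.* x)
  first = solve-∀
  second : ∀ a b u w x y → (u ℤ.* x ℤ.+ w ℤ.* y) ℤ.* b
    ≡ (u ℤ.* a ℤ.+ w ℤ.* b) ℤ.* y ℤ.- u ℤ.* (a ℤ.* y ℤ.- b ℤ.* x)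
  second = solve-∀
  first′ : ∀ w x → 1ℤ ℤ.* x ℤ.+ w ℤ.* 0ℤ ≡ x
  first′ = solve-∀
  second′ : ∀ u y → 1ℤ ℤ.* y ℤ.- u ℤ.* 0ℤ ≡ y
  second′ = solve-∀
  k*a≡x : k ℤ.* a ≡ x
  k*a≡x = trans (first a b u w x y)
    (trans (cong₂ (λ i j → i ℤ.* x ℤ.+ w ℤ.* j) ua+wb≡1 eq) (first′ w x))
  k*b≡y : k ℤ.* b ≡ y
  k*b≡y = trans (second a b u w x y)
    (trans (cong₂ (λ i j → i ℤ.* y ℤ.- u ℤ.* j) ua+wb≡1 eq) (second′ u y))

collinear⇒shift : ∀ v P Q → Primitive v → line v P ≡ line v Q → ∃[ k ] Q ≡ P +ᵖ k *ᵖ v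
collinear⇒shift v@(a , b) P@(p , q) Q@(x , y) prim eq = k , cong₂ _,_
    (trans (sym (restore p x)) (cong (λ i → p ℤ.+ i) (cong proj₁ Q-P≡kv)))
    (trans (sym (restore q y)) (cong (λ i → q ℤ.+ i) (cong proj₂ Q-P≡kv)))
  where
  difference : ∀ a b p q x y → a ℤ.* (y ℤ.- q) ℤ.- b ℤ.* (x ℤ.- p)
    ≡ (a ℤ.* y ℤ.- b ℤ.* x) ℤ.- (a ℤ.* q ℤ.- b ℤ.* p)
  difference = solve-∀
  restore : ∀ i j → i ℤ.+ (j ℤ.- i) ≡ j
  restore = solve-∀
  multiple = parallel⇒multiple v (x ℤ.- p , y ℤ.- q) prim
    (trans (difference a b p q x y)
      (trans (cong (λ i → line v Q ℤ.- i) eq) (ℤₚ.+-inverseʳ (line v Q))))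
  k = proj₁ multiple
  Q-P≡kv = proj₂ multiple

unit-multiple : ∀ k v → ℤ.∣ k ∣ ≡ 1 → k *ᵖ v ≡ v ⊎ k *ᵖ v ≡ ℤ.- 1ℤ *ᵖ v
unit-multiple (+ 1)     (a , b) refl = inj₁ (cong₂ _,_ (ℤₚ.*-identityˡ a) (ℤₚ.*-identityˡ b))
unit-multiple -[1+ 0 ]  (a , b) refl = inj₂ refl

primitive-multiple : ∀ k v → Primitive (k *ᵖ v) → ℤ.∣ k ∣ ≡ 1
primitive-multiple k (a , b) prim = prim (factor a , factor b)
  where
  factor : ∀ i → ℤ.∣ k ∣ ∣ ℤ.∣ k ℤ.* i ∣
  factor i = divides ℤ.∣ i ∣ (trans (ℤₚ.abs-* k i) (ℕₚ.*-comm ℤ.∣ k ∣ ℤ.∣ i ∣))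

-- Used contrapositively: `line v w` is the determinant of v and w, so distinct directions give a
-- nonzero step s in the recurrence for H.
parallel⇒same : ∀ v w → Primitive v → Primitive w → line v w ≡ 0ℤ →
  w ≡ v ⊎ w ≡ ℤ.- 1ℤ *ᵖ v
parallel⇒same v w v-prim w-prim eq = subst (λ u → u ≡ v ⊎ u ≡ ℤ.- 1ℤ *ᵖ v) (sym w≡kv)
  (unit-multiple k v (primitive-multiple k v (subst Primitive w≡kv w-prim)))
  where
  k = proj₁ (parallel⇒multiple v w v-prim eq)
  w≡kv : w ≡ k *ᵖ v
  w≡kv = proj₂ (parallel⇒multiple v w v-prim eq)

Box : Set
Box = (ℤ × ℤ) × (ℤ × ℤ)

InInterval : ℤ × ℤ → ℤ → Set
InInterval (lo , hi) x = lo ℤ.≤ x × x ℤ.< hi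

InBox : Box → Point → Set
InBox (I , J) (p , q) = InInterval I p × InInterval J q

shrink : ℤ → ℤ × ℤ → ℤ × ℤ
shrink a@(+ _)    (lo , hi) = lo , hi ℤ.- a
shrink a@(-[1+ _ ]) (lo , hi) = lo ℤ.- a , hi

-- The P for which both P and P + v lie in the box.
shrinkBox : Point → Box → Box
shrinkBox (a , b) (I , J) = shrink a I , shrink b J

shrink⁺ : ∀ a x I → InInterval I x → InInterval I (x ℤ.+ a) → InInterval (shrink a I) x
shrink⁺ a@(+ _) x (lo , hi) (lo≤x , x<hi) (lo≤x+a , x+a<hi) =
  lo≤x , ℤₚ.suc[i]≤j⇒i<j (linear₁ (ℤₚ.i<j⇒suc[i]≤j x+a<hi) (identity x a hi))
  where
  identity : ∀ x a hi → hi ℤ.- (1ℤ ℤ.+ (x ℤ.+ a)) ≡ (hi ℤ.- a) ℤ.- (1ℤ ℤ.+ x)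
  identity = solve-∀
shrink⁺ a@(-[1+ _ ]) x (lo , hi) (lo≤x , x<hi) (lo≤x+a , x+a<hi) =
  linear₁ lo≤x+a (identity x a lo) , x<hi
  where
  identity : ∀ x a lo → (x ℤ.+ a) ℤ.- lo ≡ x ℤ.- (lo ℤ.- a)
  identity = solve-∀

shrink⁻ : ∀ a x I → InInterval (shrink a I) x → InInterval I x × InInterval I (x ℤ.+ a)
shrink⁻ a@(+ _) x (lo , hi) (lo≤x , x<hi) =
  (lo≤x , ℤₚ.suc[i]≤j⇒i<j (linear₂ (ℤₚ.i<j⇒suc[i]≤j x<hi) 0≤a (identity₁ x a hi))) ,
  (linear₂ lo≤x 0≤a (identity₂ x a lo) ,
   ℤₚ.suc[i]≤j⇒i<j (linear₁ (ℤₚ.i<j⇒suc[i]≤j x<hi) (identity₃ x a hi)))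
  where
  0≤a : 0ℤ ℤ.≤ a
  0≤a = ℤ.+≤+ ℕ.z≤n
  identity₁ : ∀ x a hi → ((hi ℤ.- a) ℤ.- (1ℤ ℤ.+ x)) ℤ.+ (a ℤ.- 0ℤ) ≡ hi ℤ.- (1ℤ ℤ.+ x)
  identity₁ = solve-∀
  identity₂ : ∀ x a lo → (x ℤ.- lo) ℤ.+ (a ℤ.- 0ℤ) ≡ (x ℤ.+ a) ℤ.- lo
  identity₂ = solve-∀
  identity₃ : ∀ x a hi → (hi ℤ.- a) ℤ.- (1ℤ ℤ.+ x) ≡ hi ℤ.- (1ℤ ℤ.+ (x ℤ.+ a))
  identity₃ = solve-∀
shrink⁻ a@(-[1+ _ ]) x (lo , hi) (lo≤x , x<hi) =
  (linear₂ lo≤x a≤0 (identity₁ x a lo) , x<hi) ,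
  (linear₁ lo≤x (identity₂ x a lo) ,
   ℤₚ.suc[i]≤j⇒i<j (linear₂ (ℤₚ.i<j⇒suc[i]≤j x<hi) a≤0 (identity₃ x a hi)))
  where
  a≤0 : a ℤ.≤ 0ℤ
  a≤0 = ℤ.-≤+
  identity₁ : ∀ x a lo → (x ℤ.- (lo ℤ.- a)) ℤ.+ (0ℤ ℤ.- a) ≡ x ℤ.- lo
  identity₁ = solve-∀
  identity₂ : ∀ x a lo → x ℤ.- (lo ℤ.- a) ≡ (x ℤ.+ a) ℤ.- lo
  identity₂ = solve-∀
  identity₃ : ∀ x a hi → (hi ℤ.- (1ℤ ℤ.+ x)) ℤ.+ (0ℤ ℤ.- a) ≡ hi ℤ.- (1ℤ ℤ.+ (x ℤ.+ a))
  identity₃ = solve-∀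

-- Convexity of the interval: x + a lies between x and x + (k + 1) a, whatever the sign of a.
between : ∀ a x I k → InInterval I x → InInterval I (x ℤ.+ + suc k ℤ.* a) → InInterval I (x ℤ.+ a)
between a@(+ _) x (lo , hi) k (lo≤x , x<hi) (lo≤y , y<hi) =
  linear₂ lo≤x 0≤a (identity₁ x a lo) , ℤₚ.≤-<-trans x+a≤y y<hi
  where
  0≤a : 0ℤ ℤ.≤ a
  0≤a = ℤ.+≤+ ℕ.z≤n
  identity₁ : ∀ x a lo → (x ℤ.- lo) ℤ.+ (a ℤ.- 0ℤ) ≡ (x ℤ.+ a) ℤ.- lo
  identity₁ = solve-∀
  identity₂ : ∀ k x a → k ℤ.* a ℤ.- k ℤ.* 0ℤ ≡ (x ℤ.+ (1ℤ ℤ.+ k) ℤ.* a) ℤ.- (x ℤ.+ a)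
  identity₂ = solve-∀
  x+a≤y : x ℤ.+ a ℤ.≤ x ℤ.+ + suc k ℤ.* a
  x+a≤y = linear₁ (ℤₚ.*-monoˡ-≤-nonNeg (+ k) 0≤a) (identity₂ (+ k) x a)
between a@(-[1+ _ ]) x (lo , hi) k (lo≤x , x<hi) (lo≤y , y<hi) =
  ℤₚ.≤-trans lo≤y y≤x+a , ℤₚ.≤-<-trans (linear₁ a≤0 (identity₁ x a)) x<hi
  where
  a≤0 : a ℤ.≤ 0ℤ
  a≤0 = ℤ.-≤+
  identity₁ : ∀ x a → 0ℤ ℤ.- a ≡ x ℤ.- (x ℤ.+ a)
  identity₁ = solve-∀
  identity₂ : ∀ k x a → k ℤ.* 0ℤ ℤ.- k ℤ.* a ≡ (x ℤ.+ a) ℤ.- (x ℤ.+ (1ℤ ℤ.+ k) ℤ.* a)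
  identity₂ = solve-∀
  y≤x+a : x ℤ.+ + suc k ℤ.* a ℤ.≤ x ℤ.+ a
  y≤x+a = linear₁ (ℤₚ.*-monoˡ-≤-nonNeg (+ k) a≤0) (identity₂ (+ k) x a)

shrinkBox⁺ : ∀ v W P → InBox W P → InBox W (P +ᵖ v) → InBox (shrinkBox v W) P
shrinkBox⁺ (a , b) (I , J) (p , q) (p∈I , q∈J) (p+a∈I , q+b∈J) =
  shrink⁺ a p I p∈I p+a∈I , shrink⁺ b q J q∈J q+b∈J

shrinkBox⁻ : ∀ v W P → InBox (shrinkBox v W) P → InBox W P × InBox W (P +ᵖ v)
shrinkBox⁻ (a , b) (I , J) (p , q) (p∈ , q∈) with shrink⁻ a p I p∈ | shrink⁻ b q J q∈
... | p∈I , p+a∈I | q∈J , q+b∈J = (p∈I , q∈J) , (p+a∈I , q+b∈J)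

betweenBox : ∀ v W P k → InBox W P → InBox W (P +ᵖ + suc k *ᵖ v) → InBox W (P +ᵖ v)
betweenBox (a , b) (I , J) (p , q) k (p∈I , q∈J) (p′∈I , q′∈J) =
  between a p I k p∈I p′∈I , between b q J k q∈J q′∈J

opaque
  unfolding _⊕_ ⊖_ 𝟘

  extend-difference : ∀ x y u v → y ⊕ (u ⊝ v) ≃ x ⊕ ((y ⊕ u) ⊝ (x ⊕ v))
  extend-difference x y u v = ≗⇒≃ λ i →
    solve 4 (λ x y u v → y :+ (u :+ :- v) := x :+ ((y :+ u) :+ :- (x :+ v))) refl
      (seq x i) (seq y i) (seq u i) (seq v i)
    where open ℚ-Solver

  interchange : ∀ x y u v → (x ⊕ y) ⊕ (u ⊕ v) ≃ (x ⊕ u) ⊕ (y ⊕ v)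
  interchange x y u v = ≗⇒≃ λ i →
    solve 4 (λ x y u v → (x :+ y) :+ (u :+ v) := (x :+ u) :+ (y :+ v)) refl
      (seq x i) (seq y i) (seq u i) (seq v i)
    where open ℚ-Solver

  interchange-⊝ : ∀ x y u v → (x ⊕ y) ⊝ (u ⊕ v) ≃ (x ⊝ u) ⊕ (y ⊝ v)
  interchange-⊝ x y u v = ≗⇒≃ λ i →
    solve 4 (λ x y u v → (x :+ y) :+ :- (u :+ v) := (x :+ :- u) :+ (y :+ :- v)) refl
      (seq x i) (seq y i) (seq u i) (seq v i)
    where open ℚ-Solver

  ⊖-⊕ : ∀ x y → ⊖ (x ⊕ y) ≃ ⊖ x ⊕ ⊖ y
  ⊖-⊕ x y = ≗⇒≃ λ i →
    solve 2 (λ x y → :- (x :+ y) := :- x :+ :- y) refl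
      (seq x i) (seq y i)
    where open ℚ-Solver

  ⊖𝟘 : ⊖ 𝟘 ≃ 𝟘
  ⊖𝟘 = ≗⇒≃ λ i → refl

  transpose-difference : ∀ x u v → x ≃ (x ⊕ (u ⊝ v)) ⊕ (⊖ u ⊝ ⊖ v)
  transpose-difference x u v = ≗⇒≃ λ i →
    solve 3 (λ x u v → x := (x :+ (u :+ :- v)) :+ (:- u :+ :- (:- v))) refl
      (seq x i) (seq u i) (seq v i)
    where open ℚ-Solver

-- Formal sums

gate : Bool → ℝ → ℝ
gate true  x = x
gate false x = 𝟘

gate-cong : ∀ b {x y} → x ≃ y → gate b x ≃ gate b y
gate-cong true  x≃y = x≃y
gate-cong false _   = ≃-refl

gate-𝟘 : ∀ b → gate b 𝟘 ≃ 𝟘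
gate-𝟘 true  = ≃-refl
gate-𝟘 false = ≃-refl

gate-⊕ : ∀ b x y → gate b (x ⊕ y) ≃ gate b x ⊕ gate b y
gate-⊕ true  x y = ≃-refl
gate-⊕ false x y = ≃-sym (⊕-identityˡ 𝟘)

gate-⊖ : ∀ b x → gate b (⊖ x) ≃ ⊖ gate b x
gate-⊖ true  x = ≃-refl
gate-⊖ false x = ≃-sym ⊖𝟘

-- A finitely supported function on ℤ², as a formal sum of point masses.
Formal : Set
Formal = List (Point × ℝ)

-- The total mass on the points satisfying χ. With χ a line it is a line sum, with χ a single point
-- it is a value, so an identity for all χ covers both.
⟦_⟧ : Formal → (Point → Bool) → ℝ
⟦ [] ⟧          χ = 𝟘
⟦ (P , x) ∷ f ⟧ χ = gate (χ P) x ⊕ ⟦ f ⟧ χ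

relocate : (Point → Point) → Formal → Formal
relocate φ = List.map λ (P , x) → φ P , x

shift : Point → Formal → Formal
shift v = relocate (_+ᵖ v)

negate : Formal → Formal
negate = List.map λ (P , x) → P , ⊖ x

Supported : Box → Formal → Set
Supported W = All (InBox W ∘ proj₁)

onLine : Point → ℤ → Point → Bool
onLine v c P = does (line v P ℤ.≟ c)

at : Point → Point → Bool
at (k , l) (i , j) = does (i ℤ.≟ k) ∧ does (j ℤ.≟ l)

⟦⟧-++ : ∀ f g χ → ⟦ f ++ g ⟧ χ ≃ ⟦ f ⟧ χ ⊕ ⟦ g ⟧ χ
⟦⟧-++ []            g χ = ≃-sym (⊕-identityˡ _)
⟦⟧-++ ((P , x) ∷ f) g χ =
  ≃-trans (⊕-cong ≃-refl (⟦⟧-++ f g χ)) (≃-sym (⊕-assoc (gate (χ P) x) (⟦ f ⟧ χ) (⟦ g ⟧ χ)))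

⟦⟧-relocate : ∀ φ f χ → ⟦ relocate φ f ⟧ χ ≡ ⟦ f ⟧ (χ ∘ φ)
⟦⟧-relocate φ []            χ = refl
⟦⟧-relocate φ ((P , x) ∷ f) χ = cong (gate (χ (φ P)) x ⊕_) (⟦⟧-relocate φ f χ)

⟦⟧-negate : ∀ f χ → ⟦ negate f ⟧ χ ≃ ⊖ ⟦ f ⟧ χ
⟦⟧-negate []            χ = ≃-sym ⊖𝟘
⟦⟧-negate ((P , x) ∷ f) χ =
  ≃-trans (⊕-cong (gate-⊖ (χ P) x) (⟦⟧-negate f χ)) (≃-sym (⊖-⊕ (gate (χ P) x) (⟦ f ⟧ χ)))

⟦⟧-cong : ∀ f {χ ψ : Point → Bool} → All (λ (P , _) → χ P ≡ ψ P) f → ⟦ f ⟧ χ ≡ ⟦ f ⟧ ψ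
⟦⟧-cong []            []         = refl
⟦⟧-cong ((P , x) ∷ f) (eq ∷ eqs) = cong₂ (λ b y → gate b x ⊕ y) eq (⟦⟧-cong f eqs)

⟦⟧-zero : ∀ f {χ : Point → Bool} → All (λ (P , _) → χ P ≡ false) f → ⟦ f ⟧ χ ≃ 𝟘
⟦⟧-zero []            []         = ≃-refl
⟦⟧-zero ((P , x) ∷ f) (eq ∷ eqs) =
  ≃-trans (⊕-cong (≡⇒≃ (cong (λ b → gate b x) eq)) (⟦⟧-zero f eqs)) (⊕-identityˡ 𝟘)

lineTotal : Point → ℤ → Formal → ℝ
lineTotal v c f = ⟦ f ⟧ (onLine v c)

lineTotal-shift : ∀ v w c f → lineTotal w c (shift v f) ≡ lineTotal w (c ℤ.- line w v) f
lineTotal-shift v w c f = trans (⟦⟧-relocate (_+ᵖ v) f (onLine w c)) (⟦⟧-cong f (All.universal same f))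
  where
  forth : ∀ {i j k} → i ℤ.+ j ≡ k → i ≡ k ℤ.- j
  forth {i} {j} refl = identity i j
    where
    identity : ∀ i j → i ≡ i ℤ.+ j ℤ.- j
    identity = solve-∀
  back : ∀ {i j k} → i ≡ k ℤ.- j → i ℤ.+ j ≡ k
  back {_} {j} {k} refl = identity j k
    where
    identity : ∀ j k → k ℤ.- j ℤ.+ j ≡ k
    identity = solve-∀
  same : ∀ t → onLine w c (proj₁ t +ᵖ v) ≡ onLine w (c ℤ.- line w v) (proj₁ t)
  same (P , _) = does-⇔
    (mk⇔ (λ eq → forth (trans (sym (line-+ w P v)) eq)) (λ eq → trans (line-+ w P v) (back eq)))
    (line w (P +ᵖ v) ℤ.≟ c) (line w P ℤ.≟ c ℤ.- line w v)

-- The value at χ of (v − 1) h.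
δ : Point → Formal → (Point → Bool) → ℝ
δ v h χ = ⟦ shift v h ⟧ χ ⊝ ⟦ h ⟧ χ

δ-negate : ∀ v h χ → δ v (negate h) χ ≃ ⊖ ⟦ shift v h ⟧ χ ⊝ ⊖ ⟦ h ⟧ χ
δ-negate v h χ = ⊝-cong
  (≃-trans (≡⇒≃ (⟦⟧-relocate (_+ᵖ v) (negate h) χ))
    (≃-trans (⟦⟧-negate h (χ ∘ (_+ᵖ v))) (⊖-cong (≡⇒≃ (sym (⟦⟧-relocate (_+ᵖ v) h χ))))))
  (⟦⟧-negate h χ)

δ-++ : ∀ v g h χ → δ v (g ++ h) χ ≃ δ v g χ ⊕ δ v h χ
δ-++ v g h χ = ≃-trans
  (⊝-cong
    (≃-trans (≡⇒≃ (⟦⟧-relocate (_+ᵖ v) (g ++ h) χ))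
      (≃-trans (⟦⟧-++ g h (χ ∘ (_+ᵖ v)))
        (⊕-cong (≡⇒≃ (sym (⟦⟧-relocate (_+ᵖ v) g χ))) (≡⇒≃ (sym (⟦⟧-relocate (_+ᵖ v) h χ))))))
    (⟦⟧-++ g h χ))
  (interchange-⊝ _ _ _ _)

module _ (v : Point) (W : Box) where

  *ᵖ-zero : ∀ P → P +ᵖ 0ℤ *ᵖ v ≡ P
  *ᵖ-zero P = cong₂ _,_ (identity (proj₁ P) (proj₁ v)) (identity (proj₂ P) (proj₂ v))
    where
    identity : ∀ p a → p ℤ.+ 0ℤ ℤ.* a ≡ p
    identity = solve-∀

  *ᵖ-suc : ∀ P k → P +ᵖ + suc k *ᵖ v ≡ (P +ᵖ v) +ᵖ + k *ᵖ v
  *ᵖ-suc P k = cong₂ _,_ (identity (+ k) (proj₁ P) (proj₁ v)) (identity (+ k) (proj₂ P) (proj₂ v))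
    where
    identity : ∀ k p a → p ℤ.+ (1ℤ ℤ.+ k) ℤ.* a ≡ p ℤ.+ a ℤ.+ k ℤ.* a
    identity = solve-∀

  *ᵖ-neg : ∀ P k → P ≡ (P +ᵖ ℤ.- k *ᵖ v) +ᵖ k *ᵖ v
  *ᵖ-neg P k = cong₂ _,_ (identity k (proj₁ P) (proj₁ v)) (identity k (proj₂ P) (proj₂ v))
    where
    identity : ∀ k p a → p ≡ p ℤ.+ ℤ.- k ℤ.* a ℤ.+ k ℤ.* a
    identity = solve-∀

  Moved : Point → Point → ℝ → Set
  Moved P Q x = ∃[ h ] (Supported (shrinkBox v W) h ×
    (∀ χ → gate (χ Q) x ≃ gate (χ P) x ⊕ δ v h χ))

  -- Telescoping: h puts x at P, P + v, ..., P + (k - 1) v, and (v - 1) h leaves only the two ends.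
  -- By convexity each of these points lies in the box together with its successor, so h lives in
  -- the shrunken box.
  walk : ∀ k P x → InBox W P → InBox W (P +ᵖ + k *ᵖ v) → Moved P (P +ᵖ + k *ᵖ v) x
  walk zero    P x P∈W Q∈W = [] , [] , λ χ → ≃-trans
    (≡⇒≃ (cong (λ Q → gate (χ Q) x) (*ᵖ-zero P)))
    (≃-sym (≃-trans (⊕-cong ≃-refl (⊖-inverseʳ 𝟘)) (⊕-identityʳ _)))
  walk (suc k) P x P∈W Q∈W =
    let P+v∈W = betweenBox v W P k P∈W Q∈W
        h , h∈ , eq = walk k (P +ᵖ v) x P+v∈W (subst (InBox W) (*ᵖ-suc P k) Q∈W)
    in (P , x) ∷ h , shrinkBox⁺ v W P P∈W P+v∈W ∷ h∈ , λ χ →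
      ≃-trans (≡⇒≃ (cong (λ Q → gate (χ Q) x) (*ᵖ-suc P k)))
        (≃-trans (eq χ) (extend-difference (gate (χ P) x) _ _ _))

  reverse : ∀ P Q x → Moved P Q x → Moved Q P x
  reverse P Q x (h , h∈ , eq) = negate h , Allₚ.map⁺ (All.map (λ P∈ → P∈) h∈) , λ χ →
    ≃-trans (transpose-difference (gate (χ P) x) (⟦ shift v h ⟧ χ) (⟦ h ⟧ χ))
      (⊕-cong (≃-sym (eq χ)) (≃-sym (δ-negate v h χ)))

  shifted⇒moved : ∀ k P Q x → Q ≡ P +ᵖ k *ᵖ v → InBox W P → InBox W Q → Moved P Q x
  shifted⇒moved (+ k)      P _ x refl P∈W Q∈W = walk k P x P∈W Q∈W
  shifted⇒moved -[1+ k ]   P _ x refl P∈W Q∈W = reverse Q P x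
    (subst (λ R → Moved Q R x) (sym P≡)
      (walk (suc k) Q x Q∈W (subst (InBox W) P≡ P∈W)))
    where
    Q = P +ᵖ -[1+ k ] *ᵖ v
    P≡ : P ≡ Q +ᵖ + suc k *ᵖ v
    P≡ = *ᵖ-neg P (+ suc k)

  Represents : (ℤ → Point) → Set
  Represents rep = ∀ P → InBox W P →
    InBox W (rep (line v P)) × line v (rep (line v P)) ≡ line v P

  collinear⇒moved : Primitive v → ∀ P Q x → InBox W P → InBox W Q →
    line v P ≡ line v Q → Moved P Q x
  collinear⇒moved prim P Q x P∈W Q∈W same = from-multiple (collinear⇒shift v P Q prim same)
    where
    from-multiple : ∃[ k ] Q ≡ P +ᵖ k *ᵖ v → Moved P Q x
    from-multiple (k , Q≡) = shifted⇒moved k P Q x Q≡ P∈W Q∈W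

  Decomposed : (Point → Point) → Formal → Set
  Decomposed φ f = ∃[ h ] (Supported (shrinkBox v W) h ×
    (∀ χ → ⟦ f ⟧ χ ≃ ⟦ relocate φ f ⟧ χ ⊕ δ v h χ))

  decomposed-∷ : ∀ φ P x f → Moved (φ P) P x → Decomposed φ f → Decomposed φ ((P , x) ∷ f)
  decomposed-∷ φ P x f (g , g∈ , eq) (h , h∈ , eqs) = g ++ h , Allₚ.++⁺ g∈ h∈ , λ χ →
    ≃-trans (⊕-cong (eq χ) (eqs χ)) (≃-trans (interchange _ _ _ _)
      (⊕-cong ≃-refl (≃-sym (δ-++ v g h χ))))

  -- As v is primitive, the chosen point of the line of P differs from P by a multiple of v. So
  -- every mass can be moved there, and the corrections add up because `δ` is additive.
  decompose : Primitive v → ∀ rep → Represents rep → ∀ f → Supported W f →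
    Decomposed (rep ∘ line v) f
  decompose prim rep good []            []          = [] , [] , λ χ →
    ≃-sym (≃-trans (⊕-cong ≃-refl (⊖-inverseʳ 𝟘)) (⊕-identityʳ _))
  decompose prim rep good ((P , x) ∷ f) (P∈W ∷ f∈W) = decomposed-∷ (rep ∘ line v) P x f
    (collinear⇒moved prim (rep (line v P)) P x (proj₁ (good P P∈W)) P∈W (proj₂ (good P P∈W)))
    (decompose prim rep good f f∈W)

-- Adds in the order of a counting loop, so that it can stand for the partial sum in a loop
-- invariant.
rangeSum : ℤ → ℕ → (ℤ → ℝ) → ℝ
rangeSum lo zero    F = 𝟘
rangeSum lo (suc N) F = rangeSum lo N F ⊕ F (lo ℤ.+ + N)

module _ (lo : ℤ) where

  rangeSum-zero : ∀ N {F} → (∀ k → k ℕ.< N → F (lo ℤ.+ + k) ≃ 𝟘) → rangeSum lo N F ≃ 𝟘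
  rangeSum-zero zero    zeros = ≃-refl
  rangeSum-zero (suc N) zeros = ≃-trans
    (⊕-cong (rangeSum-zero N (λ k k<N → zeros k (ℕₚ.m≤n⇒m≤1+n k<N))) (zeros N ℕₚ.≤-refl))
    (⊕-identityˡ 𝟘)

  rangeSum-single : ∀ N {F} k → k ℕ.< N → (∀ j → j ≢ k → F (lo ℤ.+ + j) ≃ 𝟘) →
    rangeSum lo N F ≃ F (lo ℤ.+ + k)
  rangeSum-single (suc N) {F} k k<1+N zeros with k ℕ.≟ N
  ... | yes refl = ≃-trans
    (⊕-cong (rangeSum-zero N (λ j j<N → zeros j (ℕₚ.<⇒≢ j<N))) ≃-refl) (⊕-identityˡ _)
  ... | no k≢N = ≃-trans
    (⊕-cong (rangeSum-single N k (ℕₚ.≤∧≢⇒< (ℕₚ.≤-pred k<1+N) k≢N) zeros) (zeros N (k≢N ∘ sym)))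
    (⊕-identityʳ _)

  rangeSum-⊕ : ∀ N F G → rangeSum lo N (λ t → F t ⊕ G t) ≃ rangeSum lo N F ⊕ rangeSum lo N G
  rangeSum-⊕ zero    F G = ≃-sym (⊕-identityˡ 𝟘)
  rangeSum-⊕ (suc N) F G =
    ≃-trans (⊕-cong (rangeSum-⊕ N F G) ≃-refl) (interchange _ _ _ _)

  rangeSum-cong : ∀ N {F G} → (∀ t → F t ≃ G t) → rangeSum lo N F ≃ rangeSum lo N G
  rangeSum-cong zero    eq = ≃-refl
  rangeSum-cong (suc N) eq = ⊕-cong (rangeSum-cong N eq) (eq _)

  InRange : ℕ → ℤ → Set
  InRange N c = ∃[ k ] (k ℕ.< N × c ≡ lo ℤ.+ + k)

  -- The left side involves f only through its line sums, so the program can form it; the right side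
  -- is r. A mass of f contributes for exactly one t, the number of its line.
  rangeSum-relocate : ∀ N v rep f → All (λ (P , _) → InRange N (line v P)) f → ∀ χ →
    rangeSum lo N (λ t → gate (χ (rep t)) (lineTotal v t f)) ≃ ⟦ relocate (rep ∘ line v) f ⟧ χ
  rangeSum-relocate N v rep []            []                   χ =
    rangeSum-zero N (λ k _ → gate-𝟘 (χ (rep (lo ℤ.+ + k))))
  rangeSum-relocate N v rep ((P , x) ∷ f) ((k , k<N , c≡) ∷ ks) χ = ≃-trans
    (rangeSum-cong N (λ t → gate-⊕ (χ (rep t)) _ _))
    (≃-trans (rangeSum-⊕ N _ _) (⊕-cong here (rangeSum-relocate N v rep f ks χ)))
    where
    F : ℤ → ℝ
    F t = gate (χ (rep t)) (gate (onLine v t P) x)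
    other : ∀ j → j ≢ k → F (lo ℤ.+ + j) ≃ 𝟘
    other j j≢k = ≃-trans
      (gate-cong (χ (rep (lo ℤ.+ + j))) (≡⇒≃ (cong (λ b → gate b x)
        (dec-false (line v P ℤ.≟ lo ℤ.+ + j)
          (λ eq → j≢k (ℤₚ.+-injective (AbelianGroupProperties.∙-cancelˡ ℤₚ.+-0-abelianGroup lo (+ j) (+ k) (trans (sym eq) c≡))))))))
      (gate-𝟘 (χ (rep (lo ℤ.+ + j))))
    here : rangeSum lo N F ≃ gate (χ (rep (line v P))) x
    here = ≃-trans (rangeSum-single N k k<N other)
      (≡⇒≃ (trans (cong F (sym c≡))
        (cong (λ b → gate (χ (rep (line v P))) (gate b x)) (dec-true (line v P ℤ.≟ line v P) refl))))

-- Sums over the grid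

∑-zero : ∀ {n} (F : Fin n → ℝ) → (∀ j → F j ≃ 𝟘) → ∑.sum F ≃ 𝟘
∑-zero {n} F zeros = ≃-trans (∑.sum-cong-≋ zeros) (∑.sum-replicate-zero n)

∑-single : ∀ {n} (F : Fin n → ℝ) i → (∀ j → j ≢ i → F j ≃ 𝟘) → ∑.sum F ≃ F i
∑-single F Fin.zero zeros = ≃-trans
  (⊕-cong ≃-refl (∑-zero (F ∘ Fin.suc) (λ j → zeros (Fin.suc j) λ ()))) (⊕-identityʳ _)
∑-single F (Fin.suc i) zeros = ≃-trans
  (⊕-cong (zeros Fin.zero λ ())
    (∑-single (F ∘ Fin.suc) i (λ j j≢i → zeros (Fin.suc j) (j≢i ∘ Finₚ.suc-injective))))
  (⊕-identityˡ _)

module _ (M N : RawMonoid 0ℓ 0ℓ) where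

  private
    module M = RawMonoid M
    module N = RawMonoid N
    module M∑ = RawMonoidSum M
    module N∑ = RawMonoidSum N

  -- The sum in the definition of line sums folds `_+ᴿ_`, the one with algebraic laws folds the
  -- opaque copy; this carries a relation between terms over to the two sums.
  sum-homomorphic : (_∼_ : M.Carrier → N.Carrier → Set) → M.ε ∼ N.ε →
    (∀ {x x′ y y′} → x ∼ x′ → y ∼ y′ → (x M.∙ y) ∼ (x′ N.∙ y′)) →
    ∀ {n} (F : Fin n → M.Carrier) (G : Fin n → N.Carrier) → (∀ i → F i ∼ G i) → M∑.sum F ∼ N∑.sum G
  sum-homomorphic _∼_ ε∼ ∙∼ {zero}  F G F∼G = ε∼
  sum-homomorphic _∼_ ε∼ ∙∼ {suc n} F G F∼G =
    ∙∼ (F∼G Fin.zero) (sum-homomorphic _∼_ ε∼ ∙∼ (F ∘ Fin.suc) (G ∘ Fin.suc) (F∼G ∘ Fin.suc))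

sum≃∑ : ∀ {n} (F G : Fin n → ℝ) → (∀ i → F i ≃ G i) → sum F ≃ ∑.sum G
sum≃∑ = sum-homomorphic +ᴿ-rawMonoid (AbelianGroup.rawMonoid ℝ-abelianGroup) _≃_ (≡⇒≃ 0ᴿ≡𝟘)
  (λ {x} {x′} {y} {y′} x≃x′ y≃y′ → ≃-trans (≡⇒≃ (+ᴿ≡⊕ x y)) (⊕-cong x≃x′ y≃y′))

position : ∀ {m n} → Fin m → Fin n → Point
position p q = coord p , coord q

vec : Direction → Point
vec v = a v , b v

at-refl : ∀ P → at P P ≡ true
at-refl (i , j) = cong₂ _∧_ (dec-true (i ℤ.≟ i) refl) (dec-true (j ℤ.≟ j) refl)

at-≢ : ∀ P Q → P ≢ Q → at Q P ≡ false
at-≢ (i , j) (k , l) P≢Q with i ℤ.≟ k | j ℤ.≟ l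
... | yes refl | yes refl = contradiction refl P≢Q
... | yes _    | no _     = refl
... | no _     | _        = refl

module _ {m n : ℕ} where

  grid : Box
  grid = (0ℤ , + m) , (0ℤ , + n)

  position∈grid : ∀ p q → InBox grid (position {m} {n} p q)
  position∈grid p q = (ℤ.+≤+ ℕ.z≤n , ℤ.+<+ (Finₚ.toℕ<n p)) , (ℤ.+≤+ ℕ.z≤n , ℤ.+<+ (Finₚ.toℕ<n q))

  tableSum : (Point → Bool) → Table m n → ℝ
  tableSum χ T = ∑.sum λ p → ∑.sum λ q → gate (χ (position p q)) (T p q)

  tableSum-cong : ∀ χ {T U} → (∀ p q → T p q ≃ U p q) → tableSum χ T ≃ tableSum χ U
  tableSum-cong χ eq = ∑.sum-cong-≋ λ p → ∑.sum-cong-≋ λ q → gate-cong (χ (position p q)) (eq p q)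

  tableSum-⊕ : ∀ χ T U → tableSum χ (λ p q → T p q ⊕ U p q) ≃ tableSum χ T ⊕ tableSum χ U
  tableSum-⊕ χ T U = ≃-trans
    (∑.sum-cong-≋ λ p → ≃-trans
      (∑.sum-cong-≋ λ q → gate-⊕ (χ (position p q)) (T p q) (U p q))
      (∑.∑-distrib-+ (λ q → gate (χ (position p q)) (T p q)) _))
    (∑.∑-distrib-+ (λ p → ∑.sum λ q → gate (χ (position p q)) (T p q)) _)

  tableSum-𝟘 : ∀ χ → tableSum χ (λ _ _ → 𝟘) ≃ 𝟘
  tableSum-𝟘 χ = ∑-zero {m} (λ p → ∑.sum {n} λ q → gate (χ (position p q)) 𝟘) λ p →
    ∑-zero {n} (λ q → gate (χ (position p q)) 𝟘) λ q → gate-𝟘 (χ (position p q))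

  tableSum-single : ∀ χ T p q → (∀ p′ q′ → ¬ (p′ ≡ p × q′ ≡ q) → gate (χ (position p′ q′)) (T p′ q′) ≃ 𝟘) →
    tableSum χ T ≃ gate (χ (position p q)) (T p q)
  tableSum-single χ T p q zeros = ≃-trans
    (∑-single _ p λ p′ p′≢p → ∑-zero _ λ q′ → zeros p′ q′ (p′≢p ∘ proj₁))
    (∑-single _ q λ q′ q′≢q → zeros p q′ (q′≢q ∘ proj₂))

  lineSum≃tableSum : ∀ v c T → lineSum v c T ≃ tableSum (onLine (vec v) c) T
  lineSum≃tableSum v c T =
    sum≃∑ (λ p → sum λ q → cell p q) (λ p → ∑.sum λ q → gate (onLine (vec v) c (position p q)) (T p q))
      λ p → sum≃∑ (cell p) (λ q → gate (onLine (vec v) c (position p q)) (T p q)) λ q → ≡⇒≃ (cell≡ p q)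
    where
    forth : ∀ x y → x ≡ y ℤ.+ c → x ℤ.- y ≡ c
    forth x y refl = identity y c
      where
      identity : ∀ y c → y ℤ.+ c ℤ.- y ≡ c
      identity = solve-∀
    back : ∀ x y → x ℤ.- y ≡ c → x ≡ y ℤ.+ c
    back x y refl = identity x y
      where
      identity : ∀ x y → x ≡ y ℤ.+ (x ℤ.- y)
      identity = solve-∀
    if≡gate : ∀ b x → (if b then x else 0ᴿ) ≡ gate b x
    if≡gate true  x = refl
    if≡gate false x = 0ᴿ≡𝟘
    cell : Fin m → Fin n → ℝ
    cell p q = if does (a v ℤ.* coord q ℤ.≟ b v ℤ.* coord p ℤ.+ c) then T p q else 0ᴿ
    cell≡ : ∀ p q → cell p q ≡ gate (onLine (vec v) c (position p q)) (T p q)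
    cell≡ p q = trans (if≡gate (does (x ℤ.≟ y ℤ.+ c)) (T p q)) (cong (λ b → gate b (T p q))
      (does-⇔ (mk⇔ (forth x y) (back x y)) (x ℤ.≟ y ℤ.+ c) (x ℤ.- y ℤ.≟ c)))
      where
      x = a v ℤ.* coord q
      y = b v ℤ.* coord p

  formal : Table m n → Formal
  formal T = List.concat (List.tabulate λ p → List.tabulate λ q → position p q , T p q)

  ⟦⟧-tabulate : ∀ {k} (P : Fin k → Point) (z : Fin k → ℝ) χ →
    ⟦ List.tabulate (λ q → P q , z q) ⟧ χ ≃ ∑.sum (λ q → gate (χ (P q)) (z q))
  ⟦⟧-tabulate {zero}  P z χ = ≃-refl
  ⟦⟧-tabulate {suc k} P z χ = ⊕-cong ≃-refl (⟦⟧-tabulate (P ∘ Fin.suc) (z ∘ Fin.suc) χ)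

  ⟦⟧-concat : ∀ {k} (f : Fin k → Formal) χ →
    ⟦ List.concat (List.tabulate f) ⟧ χ ≃ ∑.sum (λ p → ⟦ f p ⟧ χ)
  ⟦⟧-concat {zero}  f χ = ≃-refl
  ⟦⟧-concat {suc k} f χ = ≃-trans (⟦⟧-++ (f Fin.zero) _ χ)
    (⊕-cong ≃-refl (⟦⟧-concat (f ∘ Fin.suc) χ))

  ⟦formal⟧ : ∀ T χ → ⟦ formal T ⟧ χ ≃ tableSum χ T
  ⟦formal⟧ T χ = ≃-trans (⟦⟧-concat (λ p → List.tabulate λ q → position p q , T p q) χ)
    (∑.sum-cong-≋ λ p → ⟦⟧-tabulate (position p) (T p) χ)

  formal-supported : ∀ T → Supported grid (formal T)
  formal-supported T = Allₚ.concat⁺ (Allₚ.tabulate⁺ λ p → Allₚ.tabulate⁺ λ q → position∈grid p q)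

  grid-position : ∀ P → InBox grid P → ∃[ p ] ∃[ q ] P ≡ position {m} {n} p q
  grid-position (+ x , + y) ((_ , ℤ.+<+ x<m) , (_ , ℤ.+<+ y<n)) =
    fromℕ< x<m , fromℕ< y<n , sym (cong₂ (λ i j → + i , + j) (Finₚ.toℕ-fromℕ< x<m) (Finₚ.toℕ-fromℕ< y<n))

  position-injective : ∀ {p p′ : Fin m} {q q′ : Fin n} → position p q ≡ position p′ q′ → p ≡ p′ × q ≡ q′
  position-injective eq = Finₚ.toℕ-injective (ℤₚ.+-injective (cong proj₁ eq))
                        , Finₚ.toℕ-injective (ℤₚ.+-injective (cong proj₂ eq))

  -- Reading f off cell by cell loses no mass, because f is supported in the grid. This is how facts
  -- about formal sums reach the output table.
  tableSum-formal : ∀ f → Supported grid f → ∀ χ →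
    tableSum χ (λ p q → ⟦ f ⟧ (at (position p q))) ≃ ⟦ f ⟧ χ
  tableSum-formal []            []        χ = tableSum-𝟘 χ
  tableSum-formal ((P , x) ∷ f) (P∈ ∷ f∈) χ with grid-position P P∈
  ... | p , q , refl = ≃-trans
    (tableSum-⊕ χ (λ p′ q′ → gate (at (position p′ q′) P) x) _)
    (⊕-cong here (tableSum-formal f f∈ χ))
    where
    here = ≃-trans
      (tableSum-single χ (λ p′ q′ → gate (at (position p′ q′) P) x) p q λ p′ q′ ≢ → ≃-trans
        (gate-cong (χ (position p′ q′)) (≡⇒≃ (cong (λ b → gate b x)
          (at-≢ P (position p′ q′) λ eq → ≢ (position-injective (sym eq))))))
        (gate-𝟘 (χ (position p′ q′))))
      (gate-cong (χ P) (≡⇒≃ (cong (λ b → gate b x) (at-refl P))))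

-- Bounds |c| for the lines a y = b x + c that meet the grid. It measures the number of lines of a
-- direction and is the unit of the cost estimates.
reach : ℕ → ℕ → Point → ℕ
reach m n (a , b) = ℤ.∣ a ∣ * n ℕ.+ ℤ.∣ b ∣ * m

line-bound : ∀ m n v P → InBox (grid {m} {n}) P → ℤ.∣ line v P ∣ ≤ reach m n v
line-bound m n (a , b) (+ x , + y) ((_ , ℤ.+<+ x<m) , (_ , ℤ.+<+ y<n)) = begin
  ℤ.∣ a ℤ.* + y ℤ.- b ℤ.* + x ∣                  ≤⟨ ℤₚ.∣i-j∣≤∣i∣+∣j∣ (a ℤ.* + y) (b ℤ.* + x) ⟩
  ℤ.∣ a ℤ.* + y ∣ ℕ.+ ℤ.∣ b ℤ.* + x ∣            ≡⟨ cong₂ ℕ._+_ (ℤₚ.abs-* a (+ y)) (ℤₚ.abs-* b (+ x)) ⟩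
  ℤ.∣ a ∣ * y ℕ.+ ℤ.∣ b ∣ * x
    ≤⟨ ℕₚ.+-mono-≤ (ℕₚ.*-monoʳ-≤ ℤ.∣ a ∣ (ℕₚ.<⇒≤ y<n)) (ℕₚ.*-monoʳ-≤ ℤ.∣ b ∣ (ℕₚ.<⇒≤ x<m)) ⟩
  ℤ.∣ a ∣ * n ℕ.+ ℤ.∣ b ∣ * m                ∎
  where open ℕₚ.≤-Reasoning

-- The number of c with |c| ≤ R.
width₂ : ℕ → ℕ
width₂ R = suc (R ℕ.+ R)

bounded⇒inRange : ∀ R c → ℤ.∣ c ∣ ≤ R → InRange (ℤ.- + R) (width₂ R) c
bounded⇒inRange R (+ k)    k≤R = R ℕ.+ k , ℕ.s≤s (ℕₚ.+-monoʳ-≤ R k≤R) , identity (+ R) (+ k)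
  where
  identity : ∀ i j → j ≡ ℤ.- i ℤ.+ (i ℤ.+ j)
  identity = solve-∀
bounded⇒inRange R -[1+ k ] k<R = R ℕ.∸ suc k , ℕ.s≤s (ℕₚ.≤-trans (ℕₚ.m∸n≤m R (suc k)) (ℕₚ.m≤m+n R R)) ,
  trans (identity (+ R) (+ suc k)) (cong (λ i → ℤ.- + R ℤ.+ i) (ℤₚ.⊖-≥ k<R))
  where
  identity : ∀ i j → ℤ.- j ≡ ℤ.- i ℤ.+ (i ℤ.- j)
  identity = solve-∀

-- Supplies the initial values of the recurrence for H: beyond the reach T and H are both 0.
lineTotal-zero : ∀ R v c f → All (λ (P , _) → ℤ.∣ line v P ∣ ≤ R) f → R ℕ.< ℤ.∣ c ∣ →
  lineTotal v c f ≃ 𝟘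
lineTotal-zero R v c f bounds R<∣c∣ = ⟦⟧-zero f (All.map (λ {t} ≤R →
  dec-false (line v (proj₁ t) ℤ.≟ c) (λ eq → ℕₚ.<-irrefl (cong ℤ.∣_∣ eq) (ℕₚ.≤-<-trans ≤R R<∣c∣))) bounds)

-- Program logic

-- Total correctness with an upper bound on the number of basic operations; a bound, unlike the
-- exact number, need not depend on the branches taken.
Run : Program → Store → ℕ → (Store → Set) → Set
Run P σ K Q = ∃[ k ] ∃[ τ ] (⟨ P , σ ⟩⇓[ k ] τ × k ≤ K × Q τ)

run-map : ∀ {P σ K Q Q′} → (∀ τ → Q τ → Q′ τ) → Run P σ K Q → Run P σ K Q′
run-map f (k , τ , P⇓ , k≤K , q) = k , τ , P⇓ , k≤K , f τ q

run-cost : ∀ {P σ K L Q} → K ≤ L → Run P σ K Q → Run P σ L Q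
run-cost K≤L (k , τ , P⇓ , k≤K , q) = k , τ , P⇓ , ℕₚ.≤-trans k≤K K≤L , q

run-skip : ∀ {σ} {Q : Store → Set} → Q σ → Run skip σ 0 Q
run-skip q = 0 , _ , skip , ℕₚ.≤-refl , q

run-assign : ∀ {σ s x i j} {e : Exp s} {i′ j′ e′} {Q : Store → Set} →
  eval σ i ≡ i′ → eval σ j ≡ j′ → eval σ e ≡ e′ → Q (update s x i′ j′ e′ σ) →
  Run (x [ i , j ]≔ e) σ (1 ℕ.+ (expCost i ℕ.+ expCost j ℕ.+ expCost e)) Q
run-assign refl refl refl q = _ , _ , assign , ℕₚ.≤-refl , q

infixr 3 _then_

_then_ : ∀ {P P′ σ K L Q Q′} → Run P σ K Q → (∀ τ → Q τ → Run P′ τ L Q′) →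
  Run (P ⨾ P′) σ (K ℕ.+ L) Q′
(k , τ , P⇓ , k≤K , q) then next with next τ q
... | l , υ , P′⇓ , l≤L , q′ = k ℕ.+ l , υ , chain P⇓ P′⇓ , ℕₚ.+-mono-≤ k≤K l≤L , q′

assign-then : ∀ {σ s x i j} {e : Exp s} {i′ j′ e′ P L Q} →
  eval σ i ≡ i′ → eval σ j ≡ j′ → eval σ e ≡ e′ → Run P (update s x i′ j′ e′ σ) L Q →
  Run (x [ i , j ]≔ e ⨾ P) σ (1 ℕ.+ (expCost i ℕ.+ expCost j ℕ.+ expCost e) ℕ.+ L) Q
assign-then refl refl refl (k , τ , P⇓ , k≤L , q) = _ , τ , chain assign P⇓ , ℕₚ.+-monoʳ-≤ _ k≤L , q

-- Integer tests are decidable. The costs of the two branches are added, which is harmless for short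
-- branches; a branch that cannot be taken may be charged 0.
run-cond : ∀ {σ} {e e′ : Exp int} {P P′ K L Q} {z z′ : ℤ} → eval σ e ≡ z → eval σ e′ ≡ z′ →
  (z ℤ.< z′ → Run P σ K Q) → (¬ z ℤ.< z′ → Run P′ σ L Q) →
  Run (cond (e ≺ e′) P P′) σ (testCost (e ≺ e′) ℕ.+ (K ℕ.+ L)) Q
run-cond {K = K} {L} {z = z} {z′} refl refl p p′ with z ℤₚ.<? z′
... | yes z<z′ = let k , τ , P⇓ , k≤K , q = p z<z′ in
  _ , τ , cond-true z<z′ P⇓ , ℕₚ.+-monoʳ-≤ _ (ℕₚ.≤-trans k≤K (ℕₚ.m≤m+n K L)) , q
... | no z≮z′ = let k , τ , P⇓ , k≤L , q = p′ z≮z′ in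
  _ , τ , cond-false z≮z′ P⇓ , ℕₚ.+-monoʳ-≤ _ (ℕₚ.≤-trans k≤L (ℕₚ.m≤n+m L K)) , q

sameArray : Sort → ℕ → Sort → ℕ → Bool
sameArray int  x int  y = x ℕ.≡ᵇ y
sameArray real x real y = x ℕ.≡ᵇ y
sameArray int  _ real _ = false
sameArray real _ int  _ = false

-- Purely syntactic, so that for a concrete program and array the side conditions of `Frame` hold by
-- `refl`.
writes : Program → Sort → ℕ → Bool
writes skip                      t y = false
writes (_[_,_]≔_ {s} x _ _ _)    t y = sameArray s x t y
writes (x [ _ , _ ]≔ _ ÷ _)      t y = sameArray real x t y
writes (P ⨾ P′)                  t y = writes P t y ∨ writes P′ t y
writes (cond _ P P′)             t y = writes P t y ∨ writes P′ t y
writes (while _ P)               t y = writes P t y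

Frame : Program → Store → Store → Set
Frame P σ τ = ∀ t y → writes P t y ≡ false → ∀ k l → τ t y k l ≡ σ t y k l

update-other : ∀ s x i j v σ t y → sameArray s x t y ≡ false → ∀ k l →
  update s x i j v σ t y k l ≡ σ t y k l
update-other int  x i j v σ int  y eq k l =
  cong (λ b → if b ∧ does (i ℤ.≟ k) ∧ does (j ℤ.≟ l) then v else σ int y k l) eq
update-other real x i j v σ real y eq k l =
  cong (λ b → if b ∧ does (i ℤ.≟ k) ∧ does (j ℤ.≟ l) then v else σ real y k l) eq
update-other int  x i j v σ real y eq k l = refl
update-other real x i j v σ int  y eq k l = refl

frame : ∀ {P σ k τ} → ⟨ P , σ ⟩⇓[ k ] τ → Frame P σ τ
frame skip                   t y eq k l = refl
frame (assign {σ} {s} {x})   t y eq k l = update-other s x _ _ _ σ t y eq k l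
frame (divide {σ} {x} _ _)   t y eq k l = update-other real x _ _ _ σ t y eq k l
frame (chain {P} {Q} p q)    t y eq k l = trans
  (frame q t y (∨-conicalʳ (writes P t y) _ eq) k l) (frame p t y (∨-conicalˡ _ (writes Q t y) eq) k l)
frame (cond-true {P = P} {Q} _ p)    t y eq k l = frame p t y (∨-conicalˡ _ (writes Q t y) eq) k l
frame (cond-false {P = P} {Q} _ q)   t y eq k l = frame q t y (∨-conicalʳ (writes P t y) _ eq) k l
frame (while-true _ p w)     t y eq k l = trans (frame w t y eq k l) (frame p t y eq k l)
frame (while-false _)        t y eq k l = refl

framed : ∀ {P σ K Q} → Run P σ K Q → Run P σ K (λ τ → Frame P σ τ × Q τ)
framed (k , τ , P⇓ , k≤K , q) = k , τ , P⇓ , k≤K , frame P⇓ , q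

var : ℕ → Exp int
var x = x [ lit (+ 0) , lit (+ 0) ]

setVar : ℕ → ℤ → Store → Store
setVar x v = update int x (+ 0) (+ 0) v

value : Store → ℕ → ℤ
value σ x = σ int x (+ 0) (+ 0)

≡ᵇ-refl : ∀ x → (x ℕ.≡ᵇ x) ≡ true
≡ᵇ-refl zero    = refl
≡ᵇ-refl (suc x) = ≡ᵇ-refl x

value-setVar : ∀ x v σ → value (setVar x v σ) x ≡ v
value-setVar x v σ = cong (λ b → if b ∧ true then v else value σ x) (≡ᵇ-refl x)

infix 4 _≔_

_≔_ : ℕ → Exp int → Program
x ≔ e = x [ lit (+ 0) , lit (+ 0) ]≔ e

step : ℕ → Program → Program
step x P = P ⨾ x ≔ op add (var x) (lit 1ℤ)

for : ℕ → Exp int → Exp int → Program → Program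
for x lo hi P = x ≔ lo ⨾ while (var x ≺ hi) (step x P)

for-writes : ∀ x lo hi P t y → writes (for x lo hi P) t y ≡ false → writes P t y ≡ false
for-writes x lo hi P t y eq =
  ∨-conicalˡ (writes P t y) _ (∨-conicalʳ (sameArray int x t y) _ eq)

sumFrom : ℕ → ℕ → (ℕ → ℕ) → ℕ
sumFrom u zero    K = 0
sumFrom u (suc N) K = K u ℕ.+ sumFrom (suc u) N K

forCost : Exp int → Exp int → ℕ → (ℕ → ℕ) → ℕ
forCost lo hi N K = 1 ℕ.+ expCost lo ℕ.+
  (sumFrom 0 N (λ u → 1 ℕ.+ expCost hi ℕ.+ (K u ℕ.+ 2)) ℕ.+ (1 ℕ.+ expCost hi))

-- N bounds the number of rounds from above only: the range from l to h may be shorter, or empty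
-- with h below l, and then the exit gives some u ≤ N with h ≤ l + u. Stability of the invariant is
-- asked for because each round ends with an assignment to the counter.
module _ (x : ℕ) (lo hi : Exp int) (P : Program) (σ : Store) {l h : ℤ} (N : ℕ) (K : ℕ → ℕ)
  (Inv : ℕ → Store → Set)
  (lo≡ : eval σ lo ≡ l)
  (h≤l+N : h ℤ.≤ l ℤ.+ + N)
  (hi≡ : ∀ τ → Frame (for x lo hi P) σ τ → eval τ hi ≡ h)
  (x-unwritten : writes P int x ≡ false)
  (stable : ∀ u v τ → Inv u τ → Inv u (setVar x v τ))
  (start : Inv 0 σ)
  (body : ∀ u τ → Frame (for x lo hi P) σ τ → value τ x ≡ l ℤ.+ + u → l ℤ.+ + u ℤ.< h →
    Inv u τ → Run P τ (K u) (Inv (suc u)))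
  where

  private
    Head : ℕ → Store → Set
    Head u τ = Frame (for x lo hi P) σ τ × value τ x ≡ l ℤ.+ + u × Inv u τ

    one-step : ∀ u τ → l ℤ.+ + u ℤ.< h → Head u τ → Run (step x P) τ (K u ℕ.+ 2) (Head (suc u))
    one-step u τ <h (fr , x≡ , inv) = framed (body u τ fr x≡ <h inv) then λ υ (frP , inv′) →
      run-assign refl refl (trans
          (cong (ℤ._+ 1ℤ) (trans (frP int x x-unwritten (+ 0) (+ 0)) x≡)) (assoc-suc l (+ u)))
        ( (λ t y eq k m → trans
            (update-other int x _ _ _ υ t y (∨-conicalˡ _ (writes (step x P) t y) eq) k m)
            (trans (frP t y (∨-conicalˡ _ _ (∨-conicalʳ (sameArray int x t y) _ eq)) k m)
              (fr t y eq k m)))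
        , value-setVar x _ υ , stable (suc u) _ υ inv′ )
      where
      assoc-suc : ∀ i j → i ℤ.+ j ℤ.+ 1ℤ ≡ i ℤ.+ (1ℤ ℤ.+ j)
      assoc-suc = solve-∀

    Exit : Store → Set
    Exit τ = ∃[ u ] (u ≤ N × h ℤ.≤ l ℤ.+ + u × Inv u τ)

    loop : ∀ fuel u τ → u ℕ.+ fuel ≡ N → Head u τ → Run (while (var x ≺ hi) (step x P)) τ
      (sumFrom u fuel (λ u → 1 ℕ.+ expCost hi ℕ.+ (K u ℕ.+ 2)) ℕ.+ (1 ℕ.+ expCost hi)) Exit
    loop fuel u τ eq head@(fr , x≡ , inv) with l ℤ.+ + u ℤₚ.<? h
    ... | no ≮h = _ , τ ,
      while-false (λ lt → ≮h (subst (ℤ._< h) x≡ (subst (value τ x ℤ.<_) (hi≡ τ fr) lt))) ,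
      ℕₚ.m≤n+m _ (sumFrom u fuel _) ,
      u , subst (u ℕ.≤_) eq (ℕₚ.m≤m+n u fuel) , ℤₚ.≮⇒≥ ≮h , inv
    -- Without fuel u = N, and l + u < h contradicts h ≤ l + N.
    loop zero u τ eq head | yes <h = contradiction
      (ℤₚ.<-≤-trans <h (subst (λ k → h ℤ.≤ l ℤ.+ + k) (trans (sym eq) (ℕₚ.+-identityʳ u)) h≤l+N))
      (ℤₚ.<-irrefl refl)
    loop (suc fuel) u τ eq head@(fr , x≡ , inv) | yes <h =
      let k , υ , P⇓ , k≤ , head′ = one-step u τ <h head
          k′ , ω , W⇓ , k′≤ , exit = loop fuel (suc u) υ (trans (sym (ℕₚ.+-suc u fuel)) eq) head′
      in _ , ω , while-true (subst (value τ x ℤ.<_) (sym (hi≡ τ fr)) (subst (ℤ._< h) (sym x≡) <h)) P⇓ W⇓ ,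
        ℕₚ.≤-trans (ℕₚ.+-mono-≤ (ℕₚ.+-monoʳ-≤ (1 ℕ.+ expCost hi) k≤) k′≤)
          (ℕₚ.≤-reflexive (sym (ℕₚ.+-assoc (1 ℕ.+ expCost hi ℕ.+ (K u ℕ.+ 2)) _ _))) ,
        exit

  for-rule′ : Run (for x lo hi P) σ (forCost lo hi N K) Exit
  for-rule′ = run-assign refl refl lo≡
    ( (λ t y eq k m → update-other int x _ _ _ σ t y (∨-conicalˡ _ (writes (step x P) t y) eq) k m)
    , trans (value-setVar x l σ) (sym (ℤₚ.+-identityʳ l)) , stable 0 l σ start)
    then λ τ → loop N 0 τ refl

  for-rule : h ≡ l ℤ.+ + N → Run (for x lo hi P) σ (forCost lo hi N K) (Inv N)
  for-rule refl = run-map (λ τ (u , u≤N , h≤ , inv) → subst (λ u → Inv u τ)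
    (ℕₚ.≤-antisym u≤N (ℤₚ.drop‿+≤+ (linear₁ h≤ (identity l (+ N) (+ u))))) inv) for-rule′
    where
    identity : ∀ l i j → (l ℤ.+ j) ℤ.- (l ℤ.+ i) ≡ j ℤ.- i
    identity = solve-∀

update-same : ∀ s x i j v σ → update s x i j v σ s x i j ≡ v
update-same int  x i j v σ
  rewrite ≡ᵇ-refl x | dec-true (i ℤ.≟ i) refl | dec-true (j ℤ.≟ j) refl = refl
update-same real x i j v σ
  rewrite ≡ᵇ-refl x | dec-true (i ℤ.≟ i) refl | dec-true (j ℤ.≟ j) refl = refl

update-elsewhere : ∀ s x i j v σ k l → ¬ (k ≡ i × l ≡ j) → update s x i j v σ s x k l ≡ σ s x k l
update-elsewhere int  x i j v σ k l ≢ with i ℤ.≟ k | j ℤ.≟ l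
... | yes refl | yes refl = contradiction (refl , refl) ≢
... | yes _    | no _     rewrite ≡ᵇ-refl x = refl
... | no _     | _        rewrite ≡ᵇ-refl x = refl
update-elsewhere real x i j v σ k l ≢ with i ℤ.≟ k | j ℤ.≟ l
... | yes refl | yes refl = contradiction (refl , refl) ≢
... | yes _    | no _     rewrite ≡ᵇ-refl x = refl
... | no _     | _        rewrite ≡ᵇ-refl x = refl

update-cases : ∀ s x i j v σ k l →
  (k ≡ i × l ≡ j × update s x i j v σ s x k l ≡ v) ⊎ update s x i j v σ s x k l ≡ σ s x k l
update-cases s x i j v σ k l with k ℤ.≟ i | l ℤ.≟ j
... | yes refl | yes refl = inj₁ (refl , refl , update-same s x i j v σ)
... | yes _    | no l≢j   = inj₂ (update-elsewhere s x i j v σ k l (λ eq → l≢j (proj₂ eq)))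
... | no k≢i   | _        = inj₂ (update-elsewhere s x i j v σ k l (λ eq → k≢i (proj₁ eq)))

<⇒<suc : ∀ l u {j} → j ℤ.< l ℤ.+ + suc u → j ℤ.< l ℤ.+ + u ⊎ j ≡ l ℤ.+ + u
<⇒<suc l u {j} j< with j ℤₚ.<? l ℤ.+ + u
... | yes j<l+u = inj₁ j<l+u
... | no  j≮l+u = inj₂ (ℤₚ.≤-antisym
  (linear₁ (ℤₚ.i<j⇒suc[i]≤j j<) (identity l (+ u) j)) (ℤₚ.≮⇒≥ j≮l+u))
  where
  identity : ∀ l u j → (l ℤ.+ (1ℤ ℤ.+ u)) ℤ.- (1ℤ ℤ.+ j) ≡ (l ℤ.+ u) ℤ.- j
  identity = solve-∀

≤l+ : ∀ l u → l ℤ.≤ l ℤ.+ + u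
≤l+ l u = ℤₚ.i≤i+j l (+ u)

not-empty : ∀ {l i} → ¬ (l ℤ.≤ i × i ℤ.< l ℤ.+ + 0)
not-empty {l} (l≤i , i<l) = ℤₚ.<-irrefl refl (ℤₚ.≤-<-trans l≤i (subst (_ ℤ.<_) (ℤₚ.+-identityʳ l) i<l))

-- Loops over a rectangle of points

p-var q-var : ℕ
p-var = 20
q-var = 21

scan : Exp int → Exp int → Exp int → Exp int → Program → Program
scan p₀ p₁ q₀ q₁ P = for p-var p₀ p₁ (for q-var q₀ q₁ P)

scanCost : Exp int → Exp int → Exp int → Exp int → ℕ → ℕ → ℕ → ℕ
scanCost p₀ p₁ q₀ q₁ M N K = forCost p₀ p₁ M (λ _ → forCost q₀ q₁ N (λ _ → K))

-- `Done Q` is what the visit to Q achieves and every other visit must preserve; `Rest` is an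
-- ordinary invariant. The sides are bounded by M and N from above only, so empty rectangles are
-- covered.
module _ (p₀ p₁ q₀ q₁ : Exp int) (P : Program) (σ : Store) {a b c d : ℤ} (M N K : ℕ)
  (Done : Point → Store → Set) (Rest : Store → Set)
  (p₀≡ : eval σ p₀ ≡ a)
  (b≤a+M : b ℤ.≤ a ℤ.+ + M)
  (d≤c+N : d ℤ.≤ c ℤ.+ + N)
  (p₁≡ : ∀ τ → Frame (scan p₀ p₁ q₀ q₁ P) σ τ → eval τ p₁ ≡ b)
  (q₀≡ : ∀ τ → Frame (scan p₀ p₁ q₀ q₁ P) σ τ → eval τ q₀ ≡ c)
  (q₁≡ : ∀ τ → Frame (scan p₀ p₁ q₀ q₁ P) σ τ → eval τ q₁ ≡ d)
  (p-unwritten : writes P int p-var ≡ false)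
  (q-unwritten : writes P int q-var ≡ false)
  (stable : ∀ Q v τ → Done Q τ → Done Q (setVar p-var v τ) × Done Q (setVar q-var v τ))
  (stableRest : ∀ v τ → Rest τ → Rest (setVar p-var v τ) × Rest (setVar q-var v τ))
  (start : Rest σ)
  (body : ∀ p q τ → Frame (scan p₀ p₁ q₀ q₁ P) σ τ → value τ p-var ≡ p → value τ q-var ≡ q →
    InBox ((a , b) , (c , d)) (p , q) → Rest τ →
    Run P τ K (λ υ → Rest υ × Done (p , q) υ × (∀ Q → Done Q τ → Done Q υ)))
  where

  private
    Row : ℤ → ℕ → Store → Store → Set
    Row p w τ υ = Rest υ × (∀ q → c ℤ.≤ q × q ℤ.< c ℤ.+ + w → Done (p , q) υ) ×
      (∀ Q → Done Q τ → Done Q υ)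

    Rows : ℕ → Store → Set
    Rows u τ = Rest τ × (∀ p q → a ℤ.≤ p × p ℤ.< a ℤ.+ + u → InInterval (c , d) q → Done (p , q) τ)

    Whole : Store → Set
    Whole τ = Frame (scan p₀ p₁ q₀ q₁ P) σ τ

    row-frame : ∀ {τ υ} → Whole τ → Frame (for q-var q₀ q₁ P) τ υ → Whole υ
    row-frame fr fr′ t y eq k l =
      trans (fr′ t y (for-writes p-var p₀ p₁ (for q-var q₀ q₁ P) t y eq) k l) (fr t y eq k l)

    row : ∀ u τ → Whole τ → value τ p-var ≡ a ℤ.+ + u → a ℤ.+ + u ℤ.< b → Rest τ →
      Run (for q-var q₀ q₁ P) τ (forCost q₀ q₁ N (λ _ → K))
        (λ υ → ∃[ w ] (w ≤ N × d ℤ.≤ c ℤ.+ + w × Row (a ℤ.+ + u) w τ υ))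
    row u τ fr p≡ p<b rest = for-rule′ q-var q₀ q₁ P τ N (λ _ → K) (λ w υ → Row (a ℤ.+ + u) w τ υ)
      (q₀≡ τ fr) d≤c+N (λ υ fr′ → q₁≡ υ (row-frame fr fr′)) q-unwritten
      (λ w v υ (rest , done , kept) → proj₂ (stableRest v υ rest) ,
        (λ q q∈ → proj₂ (stable _ v υ (done q q∈))) , (λ Q D → proj₂ (stable Q v υ (kept Q D))))
      (rest , (λ q q∈ → contradiction q∈ not-empty) , (λ Q D → D))
      (λ w υ fr′ q≡ q<d (rest , done , kept) → run-map
        (λ ω (rest′ , here , kept′) → rest′ ,
          (λ q (c≤q , q<) → [ (λ q< → kept′ _ (done q (c≤q , q<))) , (λ { refl → here }) ]′ (<⇒<suc c w q<)) ,
          (λ Q D → kept′ Q (kept Q D)))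
        (body (a ℤ.+ + u) (c ℤ.+ + w) υ (row-frame fr fr′)
          (trans (fr′ int p-var (cong (_∨ false) p-unwritten) (+ 0) (+ 0)) p≡) q≡
          ((≤l+ a u , p<b) , (≤l+ c w , q<d)) rest))

  scan-rule : Run (scan p₀ p₁ q₀ q₁ P) σ (scanCost p₀ p₁ q₀ q₁ M N K)
    (λ τ → Rest τ × (∀ Q → InBox ((a , b) , (c , d)) Q → Done Q τ))
  scan-rule = run-map
    (λ τ (u , _ , b≤ , rest , done) → rest , λ (p , q) ((a≤p , p<b) , q∈) →
      done p q (a≤p , ℤₚ.<-≤-trans p<b b≤) q∈)
    (for-rule′ p-var p₀ p₁ (for q-var q₀ q₁ P) σ M (λ _ → forCost q₀ q₁ N (λ _ → K)) Rows
      p₀≡ b≤a+M p₁≡ (cong (_∨ false) p-unwritten)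
      (λ u v τ (rest , done) → proj₁ (stableRest v τ rest) , λ p q p∈ q∈ → proj₁ (stable _ v τ (done p q p∈ q∈)))
      (start , λ p q p∈ → contradiction p∈ not-empty)
      (λ u τ fr p≡ p<b (rest , done) → run-map
        (λ υ (w , _ , d≤ , rest′ , here , kept) → rest′ , λ p q (a≤p , p<) (c≤q , q<d) →
          [ (λ p< → kept _ (done p q (a≤p , p<) (c≤q , q<d)))
          , (λ { refl → here q (c≤q , ℤₚ.<-≤-trans q<d d≤) }) ]′ (<⇒<suc a u p<))
        (row u τ fr p≡ p<b rest)))

run-assign-real : ∀ {σ x i j} (e : Exp real) {i′ j′ y} {Q : Store → Set} →
  eval σ i ≡ i′ → eval σ j ≡ j′ → eval σ e ≃ y → (∀ z → z ≃ y → Q (update real x i′ j′ z σ)) →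
  Run (x [ i , j ]≔ e) σ (1 ℕ.+ (expCost i ℕ.+ expCost j ℕ.+ expCost e)) Q
run-assign-real {σ} e refl refl e≃ q = run-assign refl refl refl (q (eval σ e) e≃)

module _ (x : ℕ) (p₀ p₁ q₀ q₁ : Exp int) (E : Exp real) where

  fill : Program
  fill = scan p₀ p₁ q₀ q₁ (x [ var p-var , var q-var ]≔ E)

  fillCost : ℕ → ℕ → ℕ
  fillCost M N = scanCost p₀ p₁ q₀ q₁ M N (1 ℕ.+ expCost E)

  -- The value of E may depend on the visited point and on whatever the loop leaves unchanged, but
  -- not on the array being filled: `E≡` has to hold in every store within the frame.
  fill-rule : ∀ σ {a b c d} M N (val : Point → ℝ) →
    eval σ p₀ ≡ a → b ℤ.≤ a ℤ.+ + M → d ℤ.≤ c ℤ.+ + N →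
    (∀ τ → Frame fill σ τ → eval τ p₁ ≡ b) →
    (∀ τ → Frame fill σ τ → eval τ q₀ ≡ c) →
    (∀ τ → Frame fill σ τ → eval τ q₁ ≡ d) →
    (∀ τ p q → Frame fill σ τ → value τ p-var ≡ p → value τ q-var ≡ q → InBox ((a , b) , (c , d)) (p , q) →
      eval τ E ≃ val (p , q)) →
    Run fill σ (fillCost M N) (λ τ →
      (∀ P → ¬ InBox ((a , b) , (c , d)) P → τ real x (proj₁ P) (proj₂ P) ≡ σ real x (proj₁ P) (proj₂ P)) ×
      (∀ P → InBox ((a , b) , (c , d)) P → τ real x (proj₁ P) (proj₂ P) ≃ val P))
  fill-rule σ M N val p₀≡ b≤ d≤ p₁≡ q₀≡ q₁≡ E≡ =
    scan-rule p₀ p₁ q₀ q₁ (x [ var p-var , var q-var ]≔ E) σ M N (1 ℕ.+ expCost E)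
      (λ P τ → τ real x (proj₁ P) (proj₂ P) ≃ val P) _
      p₀≡ b≤ d≤ p₁≡ q₀≡ q₁≡ refl refl (λ _ _ _ D → D , D) (λ _ _ R → R , R) (λ _ _ → refl)
      (λ p q τ fr p≡ q≡ pq∈ rest → run-assign-real E p≡ q≡ (E≡ τ p q fr p≡ q≡ pq∈) λ z z≃ →
        (λ P P∉ → trans (update-elsewhere real x p q z τ _ _ (λ { (refl , refl) → P∉ pq∈ })) (rest P P∉)) ,
        ≃-trans (≡⇒≃ (update-same real x p q z τ)) z≃ ,
        λ Q D → [ (λ { (refl , refl , eq) → ≃-trans (≡⇒≃ eq) z≃ }) , (λ eq → ≃-trans (≡⇒≃ eq) D) ]′
          (update-cases real x p q z τ (proj₁ Q) (proj₂ Q)))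

opaque
  unfolding _⊕_ ⊖_ 𝟘

  ⊝-⊝ : ∀ x y z → (x ⊝ y) ⊝ z ≃ x ⊝ (y ⊕ z)
  ⊝-⊝ x y z = ≗⇒≃ λ i →
    solve 3 (λ x y z → (x :+ :- y) :+ :- z := x :+ :- (y :+ z)) refl (seq x i) (seq y i) (seq z i)
    where open ℚ-Solver

  ⊝-𝟘 : ∀ x → x ⊝ 𝟘 ≃ x
  ⊝-𝟘 x = ≗⇒≃ λ i → solve 1 (λ x → x :+ :- con ℚ.0ℚ := x) refl (seq x i)
    where open ℚ-Solver

  ⊝-self : ∀ x y → x ⊝ (x ⊝ y) ≃ y
  ⊝-self x y = ≗⇒≃ λ i → solve 2 (λ x y → x :+ :- (x :+ :- y) := y) refl (seq x i) (seq y i)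
    where open ℚ-Solver

-- Dividing out a direction

i-var x₀-var x₁-var y₀-var y₁-var w-var t-var e-var s-var : ℕ
i-var  = 10
x₀-var = 11
x₁-var = 12
y₀-var = 13
y₁-var = 14
w-var  = 15
t-var  = 16
e-var  = 18
s-var  = 19

lineExp : Exp int → Exp int → Exp int → Exp int
lineExp h p q = op sub (op mul (3 [ h , lit 0ℤ ]) q) (op mul (4 [ h , lit 0ℤ ]) p)

-- Array 7 holds the reach of each direction.
reachExp negReachExp sucReachExp : ℕ → Exp int
reachExp x    = 7 [ var x , lit 0ℤ ]
negReachExp x = op sub (lit 0ℤ) (reachExp x)
sucReachExp x = op add (reachExp x) (lit 1ℤ)

-- What the phases after the survey read and never write. v is defined for every k, while reaches
-- are stored only for the directions in use.
record Const (m n : ℕ) (v : ℕ → Point) (count : ℕ) (τ : Store) : Set where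
  field
    width-is  : value τ 0 ≡ + m
    height-is : value τ 1 ≡ + n
    dir₁      : ∀ k → τ int 3 (+ k) 0ℤ ≡ proj₁ (v k)
    dir₂      : ∀ k → τ int 4 (+ k) 0ℤ ≡ proj₂ (v k)
    count-is  : value τ 25 ≡ + count
    reach-is  : ∀ k → k ℕ.< count → τ int 7 (+ k) 0ℤ ≡ + reach m n (v k)

open Const public

module _ {m n : ℕ} {v : ℕ → Point} {count : ℕ} where

  Const-frame : ∀ P {σ τ} → writes P int 0 ≡ false → writes P int 1 ≡ false →
    writes P int 3 ≡ false → writes P int 4 ≡ false → writes P int 25 ≡ false → writes P int 7 ≡ false →
    Frame P σ τ → Const m n v count σ → Const m n v count τ
  Const-frame P e₀ e₁ e₃ e₄ e₂₅ e₇ fr C = record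
    { width-is  = trans (fr int 0 e₀ 0ℤ 0ℤ) (width-is C)
    ; height-is = trans (fr int 1 e₁ 0ℤ 0ℤ) (height-is C)
    ; dir₁      = λ k → trans (fr int 3 e₃ (+ k) 0ℤ) (dir₁ C k)
    ; dir₂      = λ k → trans (fr int 4 e₄ (+ k) 0ℤ) (dir₂ C k)
    ; count-is  = trans (fr int 25 e₂₅ 0ℤ 0ℤ) (count-is C)
    ; reach-is  = λ k k< → trans (fr int 7 e₇ (+ k) 0ℤ) (reach-is C k k<)
    }

  eval-line : ∀ {τ h p q k p′ q′} → Const m n v count τ → eval τ h ≡ + k → eval τ p ≡ p′ → eval τ q ≡ q′ →
    eval τ (lineExp h p q) ≡ line (v k) (p′ , q′)
  eval-line {τ} {h} {p} {q} {k} C h≡ p≡ q≡ = cong₂ ℤ._-_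
    (cong₂ ℤ._*_ (trans (cong (λ z → τ int 3 z 0ℤ) h≡) (dir₁ C k)) q≡)
    (cong₂ ℤ._*_ (trans (cong (λ z → τ int 4 z 0ℤ) h≡) (dir₂ C k)) p≡)

  R : ℕ → ℕ
  R k = reach m n (v k)

  eval-reach : ∀ {τ} x {k} → Const m n v count τ → value τ x ≡ + k → k ℕ.< count →
    eval τ (reachExp x) ≡ + R k
  eval-reach {τ} x C x≡ k< = trans (cong (λ z → τ int 7 z 0ℤ) x≡) (reach-is C _ k<)

  eval-negReach : ∀ {τ} x {k} → Const m n v count τ → value τ x ≡ + k → k ℕ.< count →
    eval τ (negReachExp x) ≡ ℤ.- + R k
  eval-negReach x {k} C x≡ k< =
    trans (cong (λ i → 0ℤ ℤ.- i) (eval-reach x C x≡ k<)) (ℤₚ.+-identityˡ (ℤ.- + R k))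

  eval-sucReach : ∀ {τ} x {k} → Const m n v count τ → value τ x ≡ + k → k ℕ.< count →
    eval τ (sucReachExp x) ≡ + R k ℤ.+ 1ℤ
  eval-sucReach x C x≡ k< = cong (ℤ._+ 1ℤ) (eval-reach x C x≡ k<)

  sucReach : ∀ k → + R k ℤ.+ 1ℤ ≡ ℤ.- + R k ℤ.+ + width₂ (R k)
  sucReach k = identity (+ R k)
    where
    identity : ∀ r → r ℤ.+ 1ℤ ≡ ℤ.- r ℤ.+ (1ℤ ℤ.+ (r ℤ.+ r))
    identity = solve-∀

-- Arrays 5 and 6 hold the coordinates of the point chosen on line c of direction i.
-- It is arbitrary for a line that misses the window; as the line sum is then 0,
-- this does no harm.
rep : Store → ℕ → ℤ → Point
rep τ i c = τ int 5 (+ i) c , τ int 6 (+ i) c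

cellExp : Exp int
cellExp = lineExp (var i-var) (var p-var) (var q-var)

representBody represent : Program
representBody = 5 [ var i-var , cellExp ]≔ var p-var ⨾ 6 [ var i-var , cellExp ]≔ var q-var
represent = scan (var x₀-var) (var x₁-var) (var y₀-var) (var y₁-var) representBody

boxOf : Store → Box
boxOf τ = (value τ x₀-var , value τ x₁-var) , (value τ y₀-var , value τ y₁-var)

repStore : ℕ → ℤ → Point → Store → Store
repStore i c (p , q) τ = update int 6 (+ i) c q (update int 5 (+ i) c p τ)

rep-cases : ∀ i c P τ c′ →
  (c′ ≡ c × rep (repStore i c P τ) i c′ ≡ P) ⊎ rep (repStore i c P τ) i c′ ≡ rep τ i c′
rep-cases i c (p , q) τ c′ with c′ ℤ.≟ c
... | yes refl = inj₁ (refl , cong₂ _,_ (update-same int 5 (+ i) c p τ) (update-same int 6 (+ i) c q τ′))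
  where τ′ = update int 5 (+ i) c p τ
... | no c′≢c = inj₂ (cong₂ _,_
  (update-elsewhere int 5 (+ i) c p τ (+ i) c′ (c′≢c ∘ proj₂))
  (update-elsewhere int 6 (+ i) c q τ′ (+ i) c′ (c′≢c ∘ proj₂)))
  where τ′ = update int 5 (+ i) c p τ

module _ {m n : ℕ} {v : ℕ → Point} {count : ℕ} where

  private
    C : Store → Set
    C = Const m n v count

  -- A later point of a line overwrites an earlier one, and any of them will do, so one sweep of the
  -- window serves all lines of the direction. A visit costs 8: two assignments, each with an index
  -- of cost 3.
  represent-rule : ∀ σ i → C σ → value σ i-var ≡ + i →
    proj₂ (proj₁ (boxOf σ)) ℤ.≤ proj₁ (proj₁ (boxOf σ)) ℤ.+ + m →
    proj₂ (proj₂ (boxOf σ)) ℤ.≤ proj₁ (proj₂ (boxOf σ)) ℤ.+ + n →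
    Run represent σ (scanCost (var x₀-var) (var x₁-var) (var y₀-var) (var y₁-var) m n 8) (λ τ →
      (∀ k → k ≢ i → ∀ c → rep τ k c ≡ rep σ k c) × Represents (v i) (boxOf σ) (rep τ i))
  represent-rule σ i Cσ i≡ wide high =
    scan-rule (var x₀-var) (var x₁-var) (var y₀-var) (var y₁-var) representBody σ m n 8
      Done Rest refl wide high
      (λ τ fr → fr int x₁-var refl 0ℤ 0ℤ) (λ τ fr → fr int y₀-var refl 0ℤ 0ℤ) (λ τ fr → fr int y₁-var refl 0ℤ 0ℤ)
      refl refl (λ _ _ _ D → D , D) (λ _ _ r → r , r) (λ _ _ _ → refl) body
    where
    W = boxOf σ
    Done : Point → Store → Set
    Done P τ = InBox W (rep τ i (line (v i) P)) × line (v i) (rep τ i (line (v i) P)) ≡ line (v i) P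
    Rest : Store → Set
    Rest τ = ∀ k → k ≢ i → ∀ c → rep τ k c ≡ rep σ k c
    body : ∀ p q τ → Frame represent σ τ → value τ p-var ≡ p → value τ q-var ≡ q → InBox W (p , q) →
      Rest τ → Run representBody τ 8 (λ υ → Rest υ × Done (p , q) υ × (∀ Q → Done Q τ → Done Q υ))
    body p q τ fr p≡ q≡ pq∈W rest =
      assign-then i≡′ (eval-line {h = var i-var} {p = var p-var} {q = var q-var} Cτ i≡′ p≡ q≡) p≡
        (run-assign i≡′ (eval-line {h = var i-var} {p = var p-var} {q = var q-var} Cτ i≡′ p≡ q≡) q≡
          (rest′ , here , kept))
      where
      c = line (v i) (p , q)
      Cτ = Const-frame represent refl refl refl refl refl refl fr Cσ
      i≡′ : value τ i-var ≡ + i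
      i≡′ = trans (fr int i-var refl 0ℤ 0ℤ) i≡
      υ = repStore i c (p , q) τ
      rest′ : Rest υ
      rest′ k k≢i c′ = trans (cong₂ _,_
        (update-elsewhere int 5 (+ i) c p τ (+ k) c′ (k≢i ∘ ℤₚ.+-injective ∘ proj₁))
        (update-elsewhere int 6 (+ i) c q (update int 5 (+ i) c p τ) (+ k) c′ (k≢i ∘ ℤₚ.+-injective ∘ proj₁)))
        (rest k k≢i c′)
      Good : ℤ → Point → Set
      Good c′ r = InBox W r × line (v i) r ≡ c′
      good : ∀ c′ → c′ ≡ c → Good c′ (p , q)
      good _ refl = pq∈W , refl
      kept : ∀ Q → Done Q τ → Done Q υ
      kept Q D with rep-cases i c (p , q) τ (line (v i) Q)
      ... | inj₁ (c≡ , r≡) = subst (Good (line (v i) Q)) (sym r≡) (good _ c≡)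
      ... | inj₂ r≡        = subst (Good (line (v i) Q)) (sym r≡) D
      here : Done (p , q) υ
      here = subst (Good c) (sym (cong₂ _,_ (update-same int 5 (+ i) c p τ)
        (update-same int 6 (+ i) c q (update int 5 (+ i) c p τ)))) (pq∈W , refl)

eval-sub : ∀ τ (e e′ : Exp real) {x y} → eval τ e ≡ x → eval τ e′ ≡ y → eval τ (op sub e e′) ≃ x ⊝ y
eval-sub τ e e′ refl refl = -ᴿ≃⊝ (eval τ e) (eval τ e′)

eval-add : ∀ τ (e e′ : Exp real) {x y} → eval τ e ≡ x → eval τ e′ ≡ y → eval τ (op add e e′) ≃ x ⊕ y
eval-add τ e e′ refl refl = ≡⇒≃ (+ᴿ≡⊕ (eval τ e) (eval τ e′))

update-⊝ : ∀ x k ℓ z y τ c → z ≃ τ real x k ℓ ⊝ y →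
  update real x k ℓ z τ real x k c ≃ τ real x k c ⊝ gate (does (ℓ ℤ.≟ c)) y
update-⊝ x k ℓ z y τ c z≃ = split (ℓ ℤ.≟ c)
  where
  split : Dec (ℓ ≡ c) → update real x k ℓ z τ real x k c ≃ τ real x k c ⊝ gate (does (ℓ ℤ.≟ c)) y
  split (yes refl) = ≃-trans (≡⇒≃ (update-same real x k ℓ z τ)) (≃-trans z≃
    (⊝-cong ≃-refl (≡⇒≃ (cong (λ b → gate b y) (sym (dec-true (ℓ ℤ.≟ ℓ) refl))))))
  split (no ℓ≢c) = ≃-trans (≡⇒≃ (update-elsewhere real x k ℓ z τ k c (ℓ≢c ∘ sym ∘ proj₂)))
    (≃-trans (≃-sym (⊝-𝟘 _))
      (⊝-cong ≃-refl (≡⇒≃ (cong (λ b → gate b y) (sym (dec-false (ℓ ℤ.≟ c) ℓ≢c))))))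

update-⊕ : ∀ x P z y τ Q → z ≃ τ real x (proj₁ P) (proj₂ P) ⊕ y →
  update real x (proj₁ P) (proj₂ P) z τ real x (proj₁ Q) (proj₂ Q) ≃
    τ real x (proj₁ Q) (proj₂ Q) ⊕ gate (at Q P) y
update-⊕ x P@(i , j) z y τ Q@(k , l) z≃ = split (≡-dec ℤ._≟_ ℤ._≟_ P Q)
  where
  split : Dec (P ≡ Q) → update real x i j z τ real x k l ≃ τ real x k l ⊕ gate (at Q P) y
  split (yes refl) = ≃-trans (≡⇒≃ (update-same real x i j z τ)) (≃-trans z≃
    (⊕-cong ≃-refl (≡⇒≃ (cong (λ b → gate b y) (sym (at-refl P))))))
  split (no P≢Q) = ≃-trans
    (≡⇒≃ (update-elsewhere real x i j z τ k l λ { (refl , refl) → P≢Q refl }))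
    (≃-trans (≃-sym (⊕-identityʳ (τ real x k l)))
      (⊕-cong ≃-refl (≡⇒≃ (cong (λ b → gate b y) (sym (at-≢ P Q P≢Q))))))

overLines : ℕ → Program → Program
overLines x P = for t-var (negReachExp x) (sucReachExp x) P

repLineExp : Exp int
repLineExp = lineExp (var w-var) (5 [ var i-var , var t-var ]) (6 [ var i-var , var t-var ])

subtractExp addExp : Exp real
subtractExp = op sub (0 [ var w-var , repLineExp ]) (0 [ var i-var , var t-var ])
addExp = op add (1 [ 5 [ var i-var , var t-var ] , 6 [ var i-var , var t-var ] ]) (0 [ var i-var , var t-var ])

subtractBody subtract addBody add-back : Program
subtractBody = 0 [ var w-var , repLineExp ]≔ subtractExp
subtract = overLines i-var subtractBody
addBody = 1 [ 5 [ var i-var , var t-var ] , 6 [ var i-var , var t-var ] ]≔ addExp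
add-back = overLines i-var addBody

lineLoopCost : ℕ → ℕ → ℕ
lineLoopCost r k = forCost (negReachExp 0) (sucReachExp 0) (width₂ r) (λ _ → k)

module _ {m n : ℕ} {v : ℕ → Point} {count : ℕ} where

  private
    C : Store → Set
    C = Const m n v count
    R′ : ℕ → ℕ
    R′ k = reach m n (v k)

  -- A chosen point carries the whole line sum of its line and lies on one line of direction k, so
  -- one subtraction per line of direction i removes r from the line sums of direction k. Row i is
  -- read while row k changes, hence i ≢ k.
  subtract-rule : ∀ σ i k → C σ → i ℕ.< count → i ≢ k → value σ i-var ≡ + i → value σ w-var ≡ + k →
    Run subtract σ (lineLoopCost (R′ i) 8) (λ τ →
      (∀ c → τ real 0 (+ k) c ≃ σ real 0 (+ k) c ⊝
        rangeSum (ℤ.- + R′ i) (width₂ (R′ i)) (λ t → gate (onLine (v k) c (rep σ i t)) (σ real 0 (+ i) t))) ×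
      (∀ j → j ≢ k → ∀ c → τ real 0 (+ j) c ≡ σ real 0 (+ j) c))
  subtract-rule σ i k Cσ i<count i≢k i≡ k≡ = for-rule t-var _ _ subtractBody σ (width₂ (R′ i)) (λ _ → 8) Inv
    (eval-negReach i-var Cσ i≡ i<count)
    (ℤₚ.≤-reflexive (sucReach {m} {n} {v} {count} i))
    (λ τ fr → eval-sucReach i-var (Cτ fr) (i≡′ fr) i<count)
    refl (λ _ _ _ inv → inv) ((λ c → ≃-sym (⊝-𝟘 _)) , λ _ _ _ → refl) body (sucReach {m} {n} {v} {count} i)
    where
    lo = ℤ.- + R′ i
    F : ℤ → ℤ → ℝ
    F c t = gate (onLine (v k) c (rep σ i t)) (σ real 0 (+ i) t)
    Inv : ℕ → Store → Set
    Inv u τ = (∀ c → τ real 0 (+ k) c ≃ σ real 0 (+ k) c ⊝ rangeSum lo u (F c)) ×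
      (∀ j → j ≢ k → ∀ c → τ real 0 (+ j) c ≡ σ real 0 (+ j) c)
    Cτ : ∀ {τ} → Frame subtract σ τ → C τ
    Cτ fr = Const-frame subtract refl refl refl refl refl refl fr Cσ
    i≡′ : ∀ {τ} → Frame subtract σ τ → value τ i-var ≡ + i
    i≡′ fr = trans (fr int i-var refl 0ℤ 0ℤ) i≡
    k≡′ : ∀ {τ} → Frame subtract σ τ → value τ w-var ≡ + k
    k≡′ fr = trans (fr int w-var refl 0ℤ 0ℤ) k≡
    body : ∀ u τ → Frame subtract σ τ → value τ t-var ≡ lo ℤ.+ + u → lo ℤ.+ + u ℤ.< + R′ i ℤ.+ 1ℤ →
      Inv u τ → Run subtractBody τ 8 (Inv (suc u))
    body u τ fr t≡ _ (main , others) = run-assign-real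
      subtractExp (k≡′ fr) ℓ≡
      (eval-sub τ (0 [ var w-var , repLineExp ]) (0 [ var i-var , var t-var ])
        (cong₂ (τ real 0) (k≡′ fr) ℓ≡) (trans (cong₂ (τ real 0) (i≡′ fr) t≡) (others i i≢k t)))
      λ z z≃ →
        (λ c → ≃-trans (update-⊝ 0 (+ k) ℓ z (σ real 0 (+ i) t) τ c z≃)
          (≃-trans (⊝-cong (main c) ≃-refl) (⊝-⊝ (σ real 0 (+ k) c) (rangeSum lo u (F c)) (F c t)))) ,
        (λ j j≢k c → trans
          (update-elsewhere real 0 (+ k) ℓ z τ (+ j) c (j≢k ∘ ℤₚ.+-injective ∘ proj₁)) (others j j≢k c))
      where
      t = lo ℤ.+ + u
      ℓ = line (v k) (rep σ i t)
      X≡ : τ int 5 (value τ i-var) (value τ t-var) ≡ σ int 5 (+ i) t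
      X≡ = trans (cong₂ (τ int 5) (i≡′ fr) t≡) (fr int 5 refl (+ i) t)
      Y≡ : τ int 6 (value τ i-var) (value τ t-var) ≡ σ int 6 (+ i) t
      Y≡ = trans (cong₂ (τ int 6) (i≡′ fr) t≡) (fr int 6 refl (+ i) t)
      ℓ≡ : eval τ repLineExp ≡ ℓ
      ℓ≡ = eval-line {h = var w-var} {p = 5 [ var i-var , var t-var ]} {q = 6 [ var i-var , var t-var ]}
        (Cτ fr) (k≡′ fr) X≡ Y≡

  add-rule : ∀ σ i → C σ → i ℕ.< count → value σ i-var ≡ + i →
    Run add-back σ (lineLoopCost (R′ i) 2) (λ τ → ∀ k l →
      τ real 1 k l ≃ σ real 1 k l ⊕
        rangeSum (ℤ.- + R′ i) (width₂ (R′ i)) (λ t → gate (at (k , l) (rep σ i t)) (σ real 0 (+ i) t)))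
  add-rule σ i Cσ i<count i≡ = for-rule t-var _ _ addBody σ (width₂ (R′ i)) (λ _ → 2) Inv
    (eval-negReach i-var Cσ i≡ i<count)
    (ℤₚ.≤-reflexive (sucReach {m} {n} {v} {count} i))
    (λ τ fr → eval-sucReach i-var (Cτ fr) (i≡′ fr) i<count)
    refl (λ _ _ _ inv → inv) (λ k l → ≃-sym (⊕-identityʳ _)) body (sucReach {m} {n} {v} {count} i)
    where
    lo = ℤ.- + R′ i
    F : ℤ → ℤ → ℤ → ℝ
    F k l t = gate (at (k , l) (rep σ i t)) (σ real 0 (+ i) t)
    Inv : ℕ → Store → Set
    Inv u τ = ∀ k l → τ real 1 k l ≃ σ real 1 k l ⊕ rangeSum lo u (F k l)
    Cτ : ∀ {τ} → Frame add-back σ τ → C τ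
    Cτ fr = Const-frame add-back refl refl refl refl refl refl fr Cσ
    i≡′ : ∀ {τ} → Frame add-back σ τ → value τ i-var ≡ + i
    i≡′ fr = trans (fr int i-var refl 0ℤ 0ℤ) i≡
    body : ∀ u τ → Frame add-back σ τ → value τ t-var ≡ lo ℤ.+ + u → lo ℤ.+ + u ℤ.< + R′ i ℤ.+ 1ℤ →
      Inv u τ → Run addBody τ 2 (Inv (suc u))
    body u τ fr t≡ _ main = run-assign-real
      addExp X≡ Y≡
      (eval-add τ (1 [ 5 [ var i-var , var t-var ] , 6 [ var i-var , var t-var ] ]) (0 [ var i-var , var t-var ])
        (cong₂ (τ real 1) X≡ Y≡) (trans (cong₂ (τ real 0) (i≡′ fr) t≡) (fr real 0 refl (+ i) t)))
      λ z z≃ k l → ≃-trans (update-⊕ 1 (rep σ i t) z (σ real 0 (+ i) t) τ (k , l) z≃)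
        (≃-trans (⊕-cong (main k l) ≃-refl)
          (⊕-assoc (σ real 1 k l) (rangeSum lo u (F k l)) (F k l t)))
      where
      t = lo ℤ.+ + u
      X≡ : τ int 5 (value τ i-var) (value τ t-var) ≡ σ int 5 (+ i) t
      X≡ = trans (cong₂ (τ int 5) (i≡′ fr) t≡) (fr int 5 refl (+ i) t)
      Y≡ : τ int 6 (value τ i-var) (value τ t-var) ≡ σ int 6 (+ i) t
      Y≡ = trans (cong₂ (τ int 6) (i≡′ fr) t≡) (fr int 6 refl (+ i) t)

unit-abs : ∀ e c → e ℤ.* e ≡ 1ℤ → ℤ.∣ e ℤ.* c ∣ ≡ ℤ.∣ c ∣
unit-abs e c ee≡1 = trans (ℤₚ.abs-* e c) (trans (cong (ℕ._* ℤ.∣ c ∣)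
  (ℕₚ.m*n≡1⇒m≡1 ℤ.∣ e ∣ ℤ.∣ e ∣ (trans (sym (ℤₚ.abs-* e e)) (cong ℤ.∣_∣ ee≡1))))
  (ℕₚ.*-identityˡ ℤ.∣ c ∣))

inside : ∀ r x → ℤ.∣ x ∣ ≤ r → ℤ.- + r ℤ.≤ x × x ℤ.< ℤ.- + r ℤ.+ + width₂ r
inside r x ∣x∣≤r with bounded⇒inRange r x ∣x∣≤r
... | k , k< , refl = ≤l+ (ℤ.- + r) k , ℤₚ.+-monoʳ-< (ℤ.- + r) (ℤ.+<+ k<)

stepExp : Exp int
stepExp = op mul (var e-var) (var t-var)

divideExp : Exp real
divideExp = op sub (0 [ var w-var , op sub stepExp (var s-var) ]) (0 [ var w-var , stepExp ])

-- Solves T(c) = H(c − s) − H(c) for H in place, in the order of increasing e c,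
-- where e is the sign of s.
divideBody divideLoop divide-out : Program
divideBody = 0 [ var w-var , stepExp ]≔ divideExp
divideLoop = overLines w-var divideBody
divide-out =
  s-var ≔ lineExp (var w-var) (3 [ var i-var , lit 0ℤ ]) (4 [ var i-var , lit 0ℤ ]) ⨾
  cond (var s-var ≺ lit 0ℤ) (e-var ≔ lit (ℤ.- 1ℤ)) (e-var ≔ lit 1ℤ) ⨾
  divideLoop

module _ {m n : ℕ} {v : ℕ → Point} {count : ℕ} where

  private
    C : Store → Set
    C = Const m n v count
    R′ : ℕ → ℕ
    R′ k = reach m n (v k)

  -- When c is reached, cell c - s is earlier in the order and already holds H(c - s), while cell c
  -- still holds T(c); their difference is H(c). Outside the range of the loop T and H are both 0,
  -- so the cells there are right from the start.
  divideLoop-rule : ∀ σ k s e (H : ℤ → ℝ) → C σ → k ℕ.< count → value σ w-var ≡ + k →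
    value σ s-var ≡ s → value σ e-var ≡ e → e ℤ.* e ≡ 1ℤ → e ℤ.* s ≡ + ℤ.∣ s ∣ → s ≢ 0ℤ →
    (∀ c → σ real 0 (+ k) c ≃ H (c ℤ.- s) ⊝ H c) →
    (∀ c → R′ k ℕ.< ℤ.∣ c ∣ → H c ≃ 𝟘) →
    (∀ c → R′ k ℕ.< ℤ.∣ c ∣ → σ real 0 (+ k) c ≃ 𝟘) →
    Run divideLoop σ (lineLoopCost (R′ k) 6) (λ τ →
      (∀ c → τ real 0 (+ k) c ≃ H c) × (∀ j → j ≢ k → ∀ c → τ real 0 (+ j) c ≡ σ real 0 (+ j) c))
  divideLoop-rule σ k s e H Cσ k<count k≡ s≡ e≡ ee≡1 es≡ s≢0 quotient H-far σ-far =
    run-map finish (for-rule t-var _ _ divideBody σ (width₂ (R′ k)) (λ _ → 6) Inv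
      (eval-negReach w-var Cσ k≡ k<count)
      (ℤₚ.≤-reflexive (sucReach {m} {n} {v} {count} k))
      (λ τ fr → eval-sucReach w-var (Cτ fr) (k≡′ fr) k<count)
      refl (λ _ _ _ inv → inv) start body (sucReach {m} {n} {v} {count} k))
    where
    lo = ℤ.- + R′ k
    Inv : ℕ → Store → Set
    Inv u τ = (∀ c → e ℤ.* c ℤ.< lo ℤ.+ + u → τ real 0 (+ k) c ≃ H c) ×
      (∀ c → lo ℤ.+ + u ℤ.≤ e ℤ.* c → τ real 0 (+ k) c ≡ σ real 0 (+ k) c) ×
      (∀ j → j ≢ k → ∀ c → τ real 0 (+ j) c ≡ σ real 0 (+ j) c)
    Cτ : ∀ {τ} → Frame divideLoop σ τ → C τ
    Cτ fr = Const-frame divideLoop refl refl refl refl refl refl fr Cσ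
    k≡′ : ∀ {τ} → Frame divideLoop σ τ → value τ w-var ≡ + k
    k≡′ fr = trans (fr int w-var refl 0ℤ 0ℤ) k≡
    far : ∀ c → ¬ (lo ℤ.≤ e ℤ.* c × e ℤ.* c ℤ.< lo ℤ.+ + width₂ (R′ k)) → R′ k ℕ.< ℤ.∣ c ∣
    far c outside = ℕₚ.≰⇒> λ ≤R →
      outside (inside (R′ k) (e ℤ.* c) (subst (ℕ._≤ R′ k) (sym (unit-abs e c ee≡1)) ≤R))
    settled : ∀ c → R′ k ℕ.< ℤ.∣ c ∣ → σ real 0 (+ k) c ≃ H c
    settled c R< = ≃-trans (σ-far c R<) (≃-sym (H-far c R<))
    start : Inv 0 σ
    start = (λ c < → settled c (far c λ (≤ , _) → not-empty (≤ , <))) , (λ _ _ → refl) , (λ _ _ _ → refl)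
    finish : ∀ τ → Inv (width₂ (R′ k)) τ →
      (∀ c → τ real 0 (+ k) c ≃ H c) × (∀ j → j ≢ k → ∀ c → τ real 0 (+ j) c ≡ σ real 0 (+ j) c)
    finish τ (below , above , others) = all , others
      where
      all : ∀ c → τ real 0 (+ k) c ≃ H c
      all c with e ℤ.* c ℤₚ.<? lo ℤ.+ + width₂ (R′ k)
      ... | yes < = below c <
      ... | no  ≮ = ≃-trans (≡⇒≃ (above c (ℤₚ.≮⇒≥ ≮))) (settled c (far c λ (_ , <) → ≮ <))
    body : ∀ u τ → Frame divideLoop σ τ → value τ t-var ≡ lo ℤ.+ + u → lo ℤ.+ + u ℤ.< + R′ k ℤ.+ 1ℤ →
      Inv u τ → Run divideBody τ 6 (Inv (suc u))
    body u τ fr t≡ _ (below , above , others) = run-assign-real divideExp (k≡′ fr) c₀≡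
      (eval-sub τ (0 [ var w-var , op sub stepExp (var s-var) ]) (0 [ var w-var , stepExp ])
        (cong₂ (τ real 0) (k≡′ fr) (cong₂ ℤ._-_ c₀≡ (trans (fr int s-var refl 0ℤ 0ℤ) s≡)))
        (cong₂ (τ real 0) (k≡′ fr) c₀≡))
      (λ z z≃ → new z z≃ , kept z ,
        λ j j≢k c → trans
          (update-elsewhere real 0 (+ k) c₀ z τ (+ j) c (j≢k ∘ ℤₚ.+-injective ∘ proj₁)) (others j j≢k c))
      where
      t = lo ℤ.+ + u
      c₀ = e ℤ.* t
      c₀≡ : eval τ stepExp ≡ c₀
      c₀≡ = cong₂ ℤ._*_ (trans (fr int e-var refl 0ℤ 0ℤ) e≡) t≡
      regroup : ∀ e x → e ℤ.* (e ℤ.* x) ≡ e ℤ.* e ℤ.* x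
      regroup = solve-∀
      involutive : ∀ x → e ℤ.* (e ℤ.* x) ≡ x
      involutive x = trans (regroup e x) (trans (cong (ℤ._* x) ee≡1) (ℤₚ.*-identityˡ x))
      -- e (c₀ - s) = t - |s|, and s ≠ 0 makes this strictly less than t.
      earlier : e ℤ.* (c₀ ℤ.- s) ℤ.< t
      earlier = subst (ℤ._< t) (sym step-back) (decrease (ℤ.∣ s ∣) (s≢0 ∘ ℤₚ.∣i∣≡0⇒i≡0))
        where
        distribute : ∀ e c s → e ℤ.* (c ℤ.- s) ≡ e ℤ.* c ℤ.- e ℤ.* s
        distribute = solve-∀
        step-back : e ℤ.* (c₀ ℤ.- s) ≡ t ℤ.- + ℤ.∣ s ∣
        step-back = trans (distribute e c₀ s) (cong₂ ℤ._-_ (involutive t) es≡)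
        decrease : ∀ j → j ≢ 0 → t ℤ.- + j ℤ.< t
        decrease zero    j≢0 = contradiction refl j≢0
        decrease (suc j) _   = ℤₚ.suc[i]≤j⇒i<j (linear₁ (ℤ.+≤+ (ℕ.z≤n {j})) (identity t (+ j)))
          where
          identity : ∀ t j → j ℤ.- 0ℤ ≡ t ℤ.- (1ℤ ℤ.+ (t ℤ.- (1ℤ ℤ.+ j)))
          identity = solve-∀
      module _ (z : ℝ) (z≃ : z ≃ τ real 0 (+ k) (c₀ ℤ.- s) ⊝ τ real 0 (+ k) c₀) where
        υ = update real 0 (+ k) c₀ z τ
        z≃H : z ≃ H c₀
        z≃H = ≃-trans z≃ (≃-trans
          (⊝-cong (below (c₀ ℤ.- s) earlier)
            (≃-trans (≡⇒≃ (above c₀ (ℤₚ.≤-reflexive (sym (involutive t))))) (quotient c₀)))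
          (⊝-self (H (c₀ ℤ.- s)) (H c₀)))
        here : ∀ c → c ≡ c₀ → υ real 0 (+ k) c ≃ H c
        here _ refl = ≃-trans (≡⇒≃ (update-same real 0 (+ k) c₀ z τ)) z≃H
        new : ∀ c → e ℤ.* c ℤ.< lo ℤ.+ + suc u → υ real 0 (+ k) c ≃ H c
        new c < with <⇒<suc lo u <
        ... | inj₂ ≡t = here c (trans (sym (involutive c)) (cong (λ i → e ℤ.* i) ≡t))
        ... | inj₁ <t with update-cases real 0 (+ k) c₀ z τ (+ k) c
        ...   | inj₁ (_ , c≡ , _) = here c c≡
        ...   | inj₂ same         = ≃-trans (≡⇒≃ same) (below c <t)
      kept : ∀ z c → lo ℤ.+ + suc u ℤ.≤ e ℤ.* c → update real 0 (+ k) c₀ z τ real 0 (+ k) c ≡ σ real 0 (+ k) c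
      kept z c ≤ = trans
        (update-elsewhere real 0 (+ k) c₀ z τ (+ k) c λ { (_ , refl) →
          ℤₚ.<-irrefl refl (ℤₚ.<-≤-trans t<next (subst (lo ℤ.+ + suc u ℤ.≤_) (involutive t) ≤)) })
        (above c (ℤₚ.<⇒≤ (ℤₚ.<-≤-trans t<next ≤)))
        where
        t<next : t ℤ.< lo ℤ.+ + suc u
        t<next = ℤₚ.+-monoʳ-< lo (ℤ.+<+ ℕₚ.≤-refl)

  divideCost : ℕ → ℕ
  divideCost k = 4 ℕ.+ (3 ℕ.+ lineLoopCost (R′ k) 6)

  divide-rule : ∀ σ i k (H : ℤ → ℝ) → C σ → k ℕ.< count → value σ i-var ≡ + i → value σ w-var ≡ + k →
    line (v k) (v i) ≢ 0ℤ →
    (∀ c → σ real 0 (+ k) c ≃ H (c ℤ.- line (v k) (v i)) ⊝ H c) →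
    (∀ c → R′ k ℕ.< ℤ.∣ c ∣ → H c ≃ 𝟘) →
    (∀ c → R′ k ℕ.< ℤ.∣ c ∣ → σ real 0 (+ k) c ≃ 𝟘) →
    Run divide-out σ (divideCost k) (λ τ →
      (∀ c → τ real 0 (+ k) c ≃ H c) × (∀ j → j ≢ k → ∀ c → τ real 0 (+ j) c ≡ σ real 0 (+ j) c))
  divide-rule σ i k H Cσ k<count i≡ k≡ s≢0 quotient H-far σ-far =
    assign-then refl refl (eval-line {h = var w-var} {p = 3 [ var i-var , lit 0ℤ ]} {q = 4 [ var i-var , lit 0ℤ ]}
        Cσ k≡ (trans (cong (λ z → σ int 3 z 0ℤ) i≡) (dir₁ Cσ i)) (trans (cong (λ z → σ int 4 z 0ℤ) i≡) (dir₂ Cσ i)))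
      (run-cond {K = 1} {L = 1} {Q = Signed} refl refl
          (λ s<0 → run-assign refl refl refl (record { with-sign = refl , refl , negative s<0 ; frame-σ = λ _ _ → refl ; scalars = refl , refl ; const = record { Const Cσ } }))
          (λ s≮0 → run-assign refl refl refl (record { with-sign = refl , refl , nonNegative s≮0 ; frame-σ = λ _ _ → refl ; scalars = refl , refl ; const = record { Const Cσ } }))
        then λ τ signed → let open Signed signed in
          run-map (λ υ (main , others) → main , λ j j≢k c → trans (others j j≢k c) (frame-σ (+ j) c))
            (divideLoop-rule τ k s e H const k<count (trans (proj₁ scalars) k≡) (proj₂ scalars)
              (proj₁ with-sign) (proj₁ (proj₂ with-sign)) (proj₂ (proj₂ with-sign)) s≢0
              (λ c → ≃-trans (≡⇒≃ (frame-σ (+ k) c)) (quotient c)) H-far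
              (λ c R< → ≃-trans (≡⇒≃ (frame-σ (+ k) c)) (σ-far c R<))))
    where
    s = line (v k) (v i)
    record Signed (τ : Store) : Set where
      field
        {e}       : ℤ
        with-sign : value τ e-var ≡ e × e ℤ.* e ≡ 1ℤ × e ℤ.* s ≡ + ℤ.∣ s ∣
        frame-σ   : ∀ k l → τ real 0 k l ≡ σ real 0 k l
        scalars   : value τ w-var ≡ value σ w-var × value τ s-var ≡ s
        const     : C τ
    negative : s ℤ.< 0ℤ → ℤ.- 1ℤ ℤ.* s ≡ + ℤ.∣ s ∣
    negative s<0 = lemma s s<0
      where
      lemma : ∀ x → x ℤ.< 0ℤ → ℤ.- 1ℤ ℤ.* x ≡ + ℤ.∣ x ∣
      lemma -[1+ j ] _ = cong (+_ ∘ suc) (ℕₚ.+-identityʳ j)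
      lemma (+ _) (ℤ.+<+ ())
    nonNegative : ¬ s ℤ.< 0ℤ → 1ℤ ℤ.* s ≡ + ℤ.∣ s ∣
    nonNegative s≮0 = trans (ℤₚ.*-identityˡ s) (sym (ℤₚ.0≤i⇒+∣i∣≡i (ℤₚ.≮⇒≥ s≮0)))

opaque
  unfolding _⊕_ ⊖_ 𝟘

  ⊕-⊝-cancel : ∀ x y → (x ⊕ y) ⊝ x ≃ y
  ⊕-⊝-cancel x y = ≗⇒≃ λ i → solve 2 (λ x y → (x :+ y) :+ :- x := y) refl (seq x i) (seq y i)
    where open ℚ-Solver

relocate-supported : ∀ W W′ v (ρ : ℤ → Point) f → Supported W f →
  (∀ P → InBox W P → InBox W′ (ρ (line v P))) → Supported W′ (relocate (ρ ∘ line v) f)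
relocate-supported W W′ v ρ f f∈ ρ∈ = Allₚ.map⁺ (All.map (λ {t} P∈ → ρ∈ (proj₁ t) P∈) f∈)

eliminateBody eliminate : Program
eliminateBody = subtract ⨾ divide-out
eliminate = for w-var (op add (var i-var) (lit 1ℤ)) (var 25) eliminateBody

module _ {m n : ℕ} {v : ℕ → Point} {count : ℕ} where

  private
    C : Store → Set
    C = Const m n v count
    R′ : ℕ → ℕ
    R′ k = reach m n (v k)
    G : Box
    G = grid {m} {n}

  bounded : ∀ k f → Supported G f → All (λ (P , _) → ℤ.∣ line (v k) P ∣ ≤ R′ k) f
  bounded k f = All.map λ {t} P∈ → line-bound m n (v k) (proj₁ t) P∈

  inRange : ∀ k f → Supported G f → All (λ (P , _) → InRange (ℤ.- + R′ k) (width₂ (R′ k)) (line (v k) P)) f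
  inRange k f f∈ = All.map (λ {t} ≤R → bounded⇒inRange (R′ k) (line (v k) (proj₁ t)) ≤R) (bounded k f f∈)

  eliminateCost : ℕ → ℕ → ℕ
  eliminateCost i k = lineLoopCost (R′ i) 8 ℕ.+ divideCost {m} {n} {v} {count} k

  module _ (σ : Store) (i : ℕ) (Cσ : C σ) (i<count : i ℕ.< count) (i≡ : value σ i-var ≡ + i)
    (f h : Formal) (f∈ : Supported G f) (h∈ : Supported G h)
    (rel∈ : Supported G (relocate (rep σ i ∘ line (v i)) f))
    (decomposition : ∀ χ → ⟦ f ⟧ χ ≃ ⟦ relocate (rep σ i ∘ line (v i)) f ⟧ χ ⊕ δ (v i) h χ)
    (rows : ∀ k c → i ≤ k → k ℕ.< count → σ real 0 (+ k) c ≃ lineTotal (v k) c f)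
    (det : ∀ k → k ≢ i → k ℕ.< count → line (v k) (v i) ≢ 0ℤ)
    where

    private
      rel : Formal
      rel = relocate (rep σ i ∘ line (v i)) f

      Inv : ℕ → Store → Set
      Inv u τ = (∀ k c → i ℕ.< k → k ℕ.< suc i ℕ.+ u → τ real 0 (+ k) c ≃ lineTotal (v k) c h) ×
        (∀ k c → k ≤ i ⊎ suc i ℕ.+ u ≤ k → τ real 0 (+ k) c ≡ σ real 0 (+ k) c)

    -- Removing the line sums of r from those of f leaves those of (v - 1) h. Shifting by v takes
    -- line c - s to line c, so this is T(c) = H(c - s) - H(c) with H the line sums of h. Rows up to
    -- i stay intact for the backward pass.
    eliminate-rule : Run eliminate σ
      (forCost (op add (var i-var) (lit 1ℤ)) (var 25) (count ℕ.∸ suc i) (λ u → eliminateCost i (suc i ℕ.+ u)))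
      (λ τ → (∀ k c → i ℕ.< k → k ℕ.< count → τ real 0 (+ k) c ≃ lineTotal (v k) c h) ×
        (∀ k c → k ≤ i → τ real 0 (+ k) c ≡ σ real 0 (+ k) c))
    eliminate-rule = run-map
      (λ τ (done , same) → (λ k c i<k k< → done k c i<k (subst (k ℕ.<_) (sym (ℕₚ.m+[n∸m]≡n i<count)) k<)) ,
        (λ k c k≤i → same k c (inj₁ k≤i)))
      (for-rule w-var _ _ eliminateBody σ N (λ u → eliminateCost i (suc i ℕ.+ u)) Inv
        (trans (cong (ℤ._+ 1ℤ) i≡) (ℤₚ.+-comm (+ i) 1ℤ)) (ℤₚ.≤-reflexive end)
        (λ τ fr → trans (fr int 25 refl 0ℤ 0ℤ) (count-is Cσ))
        refl (λ _ _ _ inv → inv)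
        ((λ k c i<k k< → contradiction (ℕₚ.≤-pred (subst (k ℕ.<_) (ℕₚ.+-identityʳ (suc i)) k<)) (ℕₚ.<⇒≱ i<k)) ,
          λ _ _ _ → refl)
        body end)
      where
      N = count ℕ.∸ suc i
      end : + count ≡ + suc i ℤ.+ + N
      end = cong +_ (sym (ℕₚ.m+[n∸m]≡n i<count))
      body : ∀ u τ → Frame eliminate σ τ → value τ w-var ≡ + (suc i ℕ.+ u) → + (suc i ℕ.+ u) ℤ.< + count →
        Inv u τ → Run eliminateBody τ (eliminateCost i (suc i ℕ.+ u)) (Inv (suc u))
      body u τ fr w≡ (ℤ.+<+ k<count) (done , same) =
        framed (subtract-rule τ i k (Const-frame eliminate refl refl refl refl refl refl fr Cσ) i<count
          i≢k (trans (fr int i-var refl 0ℤ 0ℤ) i≡) w≡)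
        then λ υ (fr′ , new , others) → run-map
          (λ ω (H≃ , others′) →
            (λ j c i<j j< → [ (λ j<k → ≃-trans
                (≡⇒≃ (trans (others′ j (ℕₚ.<⇒≢ j<k) c) (others j (ℕₚ.<⇒≢ j<k) c))) (done j c i<j j<k))
              , (λ { refl → H≃ c }) ]′ (ℕₚ.m≤n⇒m<n∨m≡n (ℕₚ.≤-pred (subst (j ℕ.<_) (ℕₚ.+-suc (suc i) u) j<)))) ,
            (λ j c outside → let j≢k = apart j outside in
              trans (others′ j j≢k c) (trans (others j j≢k c) (same j c
                ([ inj₁ , (λ k<j → inj₂ (ℕₚ.<⇒≤ (subst (ℕ._≤ j) (ℕₚ.+-suc (suc i) u) k<j))) ]′ outside)))))
          (divide-rule υ i k (λ c → lineTotal (v k) c h)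
            (Const-frame subtract refl refl refl refl refl refl fr′
              (Const-frame eliminate refl refl refl refl refl refl fr Cσ))
            k<count (trans (fr′ int i-var refl 0ℤ 0ℤ) (trans (fr int i-var refl 0ℤ 0ℤ) i≡))
            (trans (fr′ int w-var refl 0ℤ 0ℤ) w≡) (det k (i≢k ∘ sym) k<count)
            (λ c → ≃-trans (difference υ new c) (quotient c))
            (λ c R< → lineTotal-zero (R′ k) (v k) c h (bounded k h h∈) R<)
            -- T vanishes beyond the reach because f and r both lie in the grid.
            (λ c R< → ≃-trans (difference υ new c) (≃-trans (⊝-cong
              (lineTotal-zero (R′ k) (v k) c f (bounded k f f∈) R<)
              (lineTotal-zero (R′ k) (v k) c rel (bounded k rel rel∈) R<)) (⊝-𝟘 𝟘))))
        where
        k = suc i ℕ.+ u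
        i<k : i ℕ.< k
        i<k = ℕₚ.m≤m+n (suc i) u
        i≢k : i ≢ k
        i≢k = ℕₚ.<⇒≢ i<k
        apart : ∀ j → j ≤ i ⊎ suc i ℕ.+ suc u ≤ j → j ≢ k
        apart j (inj₁ j≤i) = ℕₚ.<⇒≢ (ℕₚ.≤-<-trans j≤i i<k)
        apart j (inj₂ k<j) = ℕₚ.<⇒≢ (subst (ℕ._≤ j) (ℕₚ.+-suc (suc i) u) k<j) ∘ sym
        lo = ℤ.- + R′ i
        difference : ∀ υ → (∀ c → υ real 0 (+ k) c ≃ τ real 0 (+ k) c ⊝
            rangeSum lo (width₂ (R′ i)) (λ t → gate (onLine (v k) c (rep τ i t)) (τ real 0 (+ i) t))) →
          ∀ c → υ real 0 (+ k) c ≃ lineTotal (v k) c f ⊝ lineTotal (v k) c rel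
        difference υ new c = ≃-trans (new c) (⊝-cong
          (≃-trans (≡⇒≃ (same k c (inj₂ ℕₚ.≤-refl))) (rows k c (ℕₚ.<⇒≤ i<k) k<count))
          (≃-trans (rangeSum-cong lo (width₂ (R′ i)) (λ t → ≃-trans
            (≡⇒≃ (cong₂ (λ x y → gate (onLine (v k) c (x , y)) (τ real 0 (+ i) t))
              (fr int 5 refl (+ i) t) (fr int 6 refl (+ i) t)))
            (gate-cong (onLine (v k) c (rep σ i t))
              (≃-trans (≡⇒≃ (same i t (inj₁ ℕₚ.≤-refl))) (rows i t ℕₚ.≤-refl i<count)))))
            (rangeSum-relocate lo (width₂ (R′ i)) (v i) (rep σ i) f (inRange i f f∈) (onLine (v k) c))))
        quotient : ∀ c → lineTotal (v k) c f ⊝ lineTotal (v k) c rel ≃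
          lineTotal (v k) (c ℤ.- line (v k) (v i)) h ⊝ lineTotal (v k) c h
        quotient c = ≃-trans (⊝-cong (decomposition (onLine (v k) c)) ≃-refl)
          (≃-trans (⊕-⊝-cancel (lineTotal (v k) c rel) (δ (v i) h (onLine (v k) c)))
            (⊝-cong (≡⇒≃ (lineTotal-shift (v i) (v k) c h)) ≃-refl))

shrink-neg : ∀ {a} I → a ℤ.< 0ℤ → (proj₁ I ℤ.- a , proj₂ I) ≡ shrink a I
shrink-neg { -[1+ _ ]} I a<0 = refl
shrink-neg {+ _}       I (ℤ.+<+ ())

shrink-nonNeg : ∀ {a} I → ¬ a ℤ.< 0ℤ → (proj₁ I , proj₂ I ℤ.- a) ≡ shrink a I
shrink-nonNeg { -[1+ _ ]} I a≮0 = contradiction ℤ.-<+ a≮0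
shrink-nonNeg {+ _}       I a≮0 = refl

stepArray : ℕ → Exp int
stepArray x = x [ var i-var , lit 0ℤ ]

narrow-x narrow-y stage forward : Program
narrow-x = cond (stepArray 3 ≺ lit 0ℤ) (x₀-var ≔ op sub (var x₀-var) (stepArray 3))
  (x₁-var ≔ op sub (var x₁-var) (stepArray 3))
narrow-y = cond (stepArray 4 ≺ lit 0ℤ) (y₀-var ≔ op sub (var y₀-var) (stepArray 4))
  (y₁-var ≔ op sub (var y₁-var) (stepArray 4))
stage = represent ⨾ eliminate ⨾ narrow-x ⨾ narrow-y
forward = for i-var (lit 0ℤ) (var 25) stage

module _ {m n : ℕ} {v : ℕ → Point} {count : ℕ} where

  private
    C : Store → Set
    C = Const m n v count
    R′ : ℕ → ℕ
    R′ k = reach m n (v k)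
    G : Box
    G = grid {m} {n}

  narrow-rule : ∀ σ i W → C σ → value σ i-var ≡ + i → boxOf σ ≡ W →
    Run (narrow-x ⨾ narrow-y) σ 10 (λ τ → boxOf τ ≡ shrinkBox (v i) W)
  narrow-rule σ i W Cσ i≡ box≡ = framed x-rule then λ τ (fr , (I≡ , J≡)) →
      run-map (λ υ eq → trans eq (cong₂ _,_ (trans I≡ (cong (shrink (proj₁ (v i)) ∘ proj₁) box≡))
        (cong (shrink (proj₂ (v i))) (trans J≡ (cong proj₂ box≡)))))
      (y-rule τ (trans (cong (λ z → τ int 4 z 0ℤ) (trans (fr int i-var refl 0ℤ 0ℤ) i≡))
        (trans (fr int 4 refl (+ i) 0ℤ) (dir₂ Cσ i))))
    where
    α = proj₁ (v i)
    β = proj₂ (v i)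
    a≡ : eval σ (stepArray 3) ≡ α
    a≡ = trans (cong (λ z → σ int 3 z 0ℤ) i≡) (dir₁ Cσ i)
    x-rule : Run narrow-x σ 5 (λ τ → proj₁ (boxOf τ) ≡ shrink α (proj₁ (boxOf σ)) × proj₂ (boxOf τ) ≡ proj₂ (boxOf σ))
    x-rule = run-cond a≡ refl
      (λ a<0 → run-assign refl refl (cong (λ z → value σ x₀-var ℤ.- z) a≡) (shrink-neg _ a<0 , refl))
      (λ a≮0 → run-assign refl refl (cong (λ z → value σ x₁-var ℤ.- z) a≡) (shrink-nonNeg _ a≮0 , refl))
    y-rule : ∀ τ → eval τ (stepArray 4) ≡ β →
      Run narrow-y τ 5 (λ υ → boxOf υ ≡ (proj₁ (boxOf τ) , shrink β (proj₂ (boxOf τ))))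
    y-rule τ b≡ = run-cond b≡ refl
      (λ b<0 → run-assign refl refl (cong (λ z → value τ y₀-var ℤ.- z) b≡) (cong (proj₁ (boxOf τ) ,_) (shrink-neg _ b<0)))
      (λ b≮0 → run-assign refl refl (cong (λ z → value τ y₁-var ℤ.- z) b≡) (cong (proj₁ (boxOf τ) ,_) (shrink-nonNeg _ b≮0)))

  window : ℕ → Box
  window zero    = G
  window (suc i) = shrinkBox (v i) (window i)

  window⊆grid : ∀ i P → InBox (window i) P → InBox G P
  window⊆grid zero    P P∈ = P∈
  window⊆grid (suc i) P P∈ = window⊆grid i P (proj₁ (shrinkBox⁻ (v i) (window i) P P∈))

  private
    -- An upper bound only, since a window can be empty with its upper end below the lower one. It
    -- lets every sweep of a window be charged as a sweep of the whole grid.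
    Narrow : ℕ → ℤ × ℤ → Set
    Narrow l (lo , hi) = hi ℤ.≤ lo ℤ.+ + l

    narrow-shrink : ∀ a l I → Narrow l I → Narrow l (shrink a I)
    narrow-shrink a@(+ k) l (lo , hi) hi≤ = linear₂ hi≤ (ℤ.+≤+ (ℕ.z≤n {k})) (identity lo hi (+ l) a)
      where
      identity : ∀ lo hi l a → ((lo ℤ.+ l) ℤ.- hi) ℤ.+ (a ℤ.- 0ℤ) ≡ (lo ℤ.+ l) ℤ.- (hi ℤ.- a)
      identity = solve-∀
    narrow-shrink a@(-[1+ k ]) l (lo , hi) hi≤ = linear₂ {x′ = a} {y′ = 0ℤ} hi≤ ℤ.-≤+ (identity lo hi (+ l) a)
      where
      identity : ∀ lo hi l a → ((lo ℤ.+ l) ℤ.- hi) ℤ.+ (0ℤ ℤ.- a) ≡ ((lo ℤ.- a) ℤ.+ l) ℤ.- hi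
      identity = solve-∀

  window-narrow : ∀ i → Narrow m (proj₁ (window i)) × Narrow n (proj₂ (window i))
  window-narrow zero    = ℤₚ.≤-reflexive (sym (ℤₚ.+-identityˡ (+ m))) , ℤₚ.≤-reflexive (sym (ℤₚ.+-identityˡ (+ n)))
  window-narrow (suc i) = narrow-shrink (proj₁ (v i)) m _ (proj₁ (window-narrow i))
                        , narrow-shrink (proj₂ (v i)) n _ (proj₂ (window-narrow i))

  -- f is the function left after the first i directions have been divided out.
  data History (f₀ : Formal) (τ : Store) : ℕ → Formal → Set where
    start : Supported G f₀ → History f₀ τ 0 f₀
    next  : ∀ {i f h} (ρ : ℤ → Point) → History f₀ τ i f → Supported (window (suc i)) h →
      (∀ c → rep τ i c ≡ ρ c) → Represents (v i) (window i) ρ →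
      (∀ c → τ real 0 (+ i) c ≃ lineTotal (v i) c f) →
      (∀ χ → ⟦ f ⟧ χ ≃ ⟦ relocate (ρ ∘ line (v i)) f ⟧ χ ⊕ δ (v i) h χ) →
      History f₀ τ (suc i) h

  history-supported : ∀ {f₀ τ i f} → History f₀ τ i f → Supported (window i) f
  history-supported (start f₀∈)          = f₀∈
  history-supported (next _ _ h∈ _ _ _ _) = h∈

  -- A history depends on the store only through the chosen points and the rows of the directions
  -- before i, none of which a later stage changes.
  history-resp : ∀ {f₀ σ τ i f} → (∀ k → k ℕ.< i → ∀ c → rep τ k c ≡ rep σ k c) →
    (∀ k → k ℕ.< i → ∀ c → τ real 0 (+ k) c ≡ σ real 0 (+ k) c) → History f₀ σ i f → History f₀ τ i f
  history-resp reps rows (start f₀∈) = start f₀∈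
  history-resp reps rows (next {i} ρ H h∈ ρ≡ good L≃ eq) =
    next ρ (history-resp (λ k k<i → reps k (ℕₚ.m≤n⇒m≤1+n k<i)) (λ k k<i → rows k (ℕₚ.m≤n⇒m≤1+n k<i)) H) h∈
      (λ c → trans (reps i ℕₚ.≤-refl c) (ρ≡ c)) good
      (λ c → ≃-trans (≡⇒≃ (rows i ℕₚ.≤-refl c)) (L≃ c)) eq

  Forward : Formal → ℕ → Store → Set
  Forward f₀ i τ = ∃[ f ] (History f₀ τ i f × boxOf τ ≡ window i ×
    (∀ k c → i ≤ k → k ℕ.< count → τ real 0 (+ k) c ≃ lineTotal (v k) c f))

  representCost : ℕ
  representCost = scanCost (var x₀-var) (var x₁-var) (var y₀-var) (var y₁-var) m n 8

  stageCost : ℕ → ℕ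
  stageCost i = representCost ℕ.+
    (forCost (op add (var i-var) (lit 1ℤ)) (var 25) (count ℕ.∸ suc i)
      (λ u → eliminateCost {m} {n} {v} {count} i (suc i ℕ.+ u)) ℕ.+ 10)

  -- The new function h comes from `decompose` and is not computed. It survives as a witness in
  -- `History`; the store holds just its line sums in the later directions.
  stage-rule : ∀ σ i f₀ → C σ → Primitive (v i) → (∀ k → k ≢ i → k ℕ.< count → line (v k) (v i) ≢ 0ℤ) →
    i ℕ.< count → value σ i-var ≡ + i → Forward f₀ i σ → Run stage σ (stageCost i) (Forward f₀ (suc i))
  stage-rule σ i f₀ Cσ prim det i<count i≡ (f , H , box≡ , rows) =
    framed (represent-rule σ i Cσ i≡ (proj₁ (narrow (window-narrow i))) (proj₂ (narrow (window-narrow i)))) then λ τ (fr , reps , good) →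
    let Cτ = Const-frame represent refl refl refl refl refl refl fr Cσ
        good′ = subst (λ W → Represents (v i) W (rep τ i)) box≡ good
    in afterwards τ fr reps Cτ good′ (decompose (v i) (window i) prim (rep τ i) good′ f (history-supported H))
    where
    W = window i
    narrow : Narrow m (proj₁ W) × Narrow n (proj₂ W) → Narrow m (proj₁ (boxOf σ)) × Narrow n (proj₂ (boxOf σ))
    narrow = subst (λ W → Narrow m (proj₁ W) × Narrow n (proj₂ W)) (sym box≡)
    afterwards : ∀ τ → Frame represent σ τ → (∀ k → k ≢ i → ∀ c → rep τ k c ≡ rep σ k c) → C τ →
      Represents (v i) W (rep τ i) → Decomposed (v i) W (rep τ i ∘ line (v i)) f →
      Run (eliminate ⨾ narrow-x ⨾ narrow-y) τ
        (forCost (op add (var i-var) (lit 1ℤ)) (var 25) (count ℕ.∸ suc i)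
          (λ u → eliminateCost {m} {n} {v} {count} i (suc i ℕ.+ u)) ℕ.+ 10) (Forward f₀ (suc i))
    afterwards τ fr reps Cτ good (h , h∈ , eq) =
      framed (eliminate-rule τ i Cτ i<count (trans (fr int i-var refl 0ℤ 0ℤ) i≡) f h
        (All.map (λ {t} → window⊆grid i (proj₁ t)) (history-supported H))
        (All.map (λ {t} → window⊆grid (suc i) (proj₁ t)) h∈)
        (relocate-supported W G (v i) (rep τ i) f (history-supported H) (λ P P∈ → window⊆grid i _ (proj₁ (good P P∈))))
        eq (λ k c i≤k k< → ≃-trans (≡⇒≃ (fr real 0 refl (+ k) c)) (rows k c i≤k k<)) det)
      then λ υ (fr′ , new , same) → run-map
        (λ ω (fr″ , box≡′) → h ,
          next (rep τ i)
            (history-resp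
              (λ k k<i c → trans (cong₂ _,_ (trans (fr″ int 5 refl (+ k) c) (fr′ int 5 refl (+ k) c))
                (trans (fr″ int 6 refl (+ k) c) (fr′ int 6 refl (+ k) c))) (reps k (ℕₚ.<⇒≢ k<i) c))
              (λ k k<i c → trans (fr″ real 0 refl (+ k) c) (trans (same k c (ℕₚ.<⇒≤ k<i)) (fr real 0 refl (+ k) c)))
              H)
            h∈
            (λ c → cong₂ _,_ (trans (fr″ int 5 refl (+ i) c) (fr′ int 5 refl (+ i) c))
                (trans (fr″ int 6 refl (+ i) c) (fr′ int 6 refl (+ i) c)))
            good
            (λ c → ≃-trans (≡⇒≃ (trans (fr″ real 0 refl (+ i) c) (trans (same i c ℕₚ.≤-refl) (fr real 0 refl (+ i) c))))
              (rows i c ℕₚ.≤-refl i<count))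
            eq ,
          box≡′ ,
          λ k c i<k k< → ≃-trans (≡⇒≃ (fr″ real 0 refl (+ k) c)) (new k c i<k k<))
        (framed (narrow-rule υ i W
          (Const-frame eliminate refl refl refl refl refl refl fr′ Cτ)
          (trans (fr′ int i-var refl 0ℤ 0ℤ) (trans (fr int i-var refl 0ℤ 0ℤ) i≡))
          (trans (cong₂ _,_ (cong₂ _,_ (fr′ int x₀-var refl 0ℤ 0ℤ) (fr′ int x₁-var refl 0ℤ 0ℤ))
                            (cong₂ _,_ (fr′ int y₀-var refl 0ℤ 0ℤ) (fr′ int y₁-var refl 0ℤ 0ℤ)))
            (trans (cong₂ _,_ (cong₂ _,_ (fr int x₀-var refl 0ℤ 0ℤ) (fr int x₁-var refl 0ℤ 0ℤ))
                            (cong₂ _,_ (fr int y₀-var refl 0ℤ 0ℤ) (fr int y₁-var refl 0ℤ 0ℤ))) box≡))))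

  forward-rule : ∀ σ f₀ → C σ → (∀ k → k ℕ.< count → Primitive (v k)) →
    (∀ i k → i ℕ.< count → k ℕ.< count → k ≢ i → line (v k) (v i) ≢ 0ℤ) →
    Forward f₀ 0 σ → Run forward σ (forCost (lit 0ℤ) (var 25) count stageCost) (Forward f₀ count)
  forward-rule σ f₀ Cσ prim det inv₀ = for-rule i-var _ _ stage σ count stageCost (Forward f₀)
    refl (ℤₚ.≤-reflexive end) (λ τ fr → trans (fr int 25 refl 0ℤ 0ℤ) (count-is Cσ)) refl
    (λ u x τ (f , H , box , rows) → f , history-resp (λ _ _ _ → refl) (λ _ _ _ → refl) H , box , rows) inv₀
    (λ { u τ fr i≡ (ℤ.+<+ u<count) inv → stage-rule τ u f₀
      (Const-frame forward refl refl refl refl refl refl fr Cσ) (prim u u<count)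
      (λ k k≢u k< → det u k u<count k< k≢u) u<count i≡ inv })
    end
    where
    end : + count ≡ + 0 ℤ.+ + count
    end = refl

-- Reassembling the solution

_-ᵖ_ : Point → Point → Point
(p , q) -ᵖ (α , β) = p ℤ.- α , q ℤ.- β

at-+ᵖ : ∀ P Q v → at P (Q +ᵖ v) ≡ at (P -ᵖ v) Q
at-+ᵖ (k , l) (i , j) (α , β) = cong₂ _∧_
  (does-⇔ (mk⇔ (forth i α k) (back i α k)) (i ℤ.+ α ℤ.≟ k) (i ℤ.≟ k ℤ.- α))
  (does-⇔ (mk⇔ (forth j β l) (back j β l)) (j ℤ.+ β ℤ.≟ l) (j ℤ.≟ l ℤ.- β))
  where
  forth : ∀ i α k → i ℤ.+ α ≡ k → i ≡ k ℤ.- α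
  forth i α _ refl = identity i α
    where
    identity : ∀ i α → i ≡ i ℤ.+ α ℤ.- α
    identity = solve-∀
  back : ∀ i α k → i ≡ k ℤ.- α → i ℤ.+ α ≡ k
  back _ α k refl = identity k α
    where
    identity : ∀ k α → k ℤ.- α ℤ.+ α ≡ k
    identity = solve-∀

⟦shift⟧-at : ∀ v f P → ⟦ shift v f ⟧ (at P) ≡ ⟦ f ⟧ (at (P -ᵖ v))
⟦shift⟧-at v f P = trans (⟦⟧-relocate (_+ᵖ v) f (at P))
  (⟦⟧-cong f (All.universal (λ t → at-+ᵖ P (proj₁ t) v) f))

inBox? : ∀ W P → Dec (InBox W P)
inBox? ((a₀ , a₁) , (b₀ , b₁)) (p , q) =
  (a₀ ℤₚ.≤? p ×-dec p ℤₚ.<? a₁) ×-dec (b₀ ℤₚ.≤? q ×-dec q ℤₚ.<? b₁)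

unsupported : ∀ W f P → Supported W f → ¬ InBox W P → ⟦ f ⟧ (at P) ≃ 𝟘
unsupported W f P f∈ P∉ = ⟦⟧-zero f (All.map (λ {t} Q∈ → at-≢ (proj₁ t) P λ { refl → P∉ Q∈ }) f∈)

-- A shift along v maps each line of direction v to itself. So (v - 1) g never affects the line sums
-- in direction v, and r alone accounts for them.
δ-self : ∀ v g c → δ v g (onLine v c) ≃ 𝟘
δ-self v g c = ≃-trans (⊝-cong (≡⇒≃ (trans (lineTotal-shift v v c g)
    (cong (λ i → lineTotal v i g) (trans (cong (λ i → c ℤ.- i) (line-self v)) (ℤₚ.+-identityʳ c))))) ≃-refl)
  (⊖-inverseʳ (lineTotal v c g))

δ-cong : ∀ v w g h → (∀ c → lineTotal w c g ≃ lineTotal w c h) →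
  ∀ c → δ v g (onLine w c) ≃ δ v h (onLine w c)
δ-cong v w g h eq c = ⊝-cong
  (≃-trans (≡⇒≃ (lineTotal-shift v w c g))
    (≃-trans (eq (c ℤ.- line w v)) (≡⇒≃ (sym (lineTotal-shift v w c h)))))
  (eq c)

u-var : ℕ
u-var = 29

shiftedExp differenceExp : Exp real
shiftedExp = 2 [ op sub (var p-var) (stepArray 3) , op sub (var q-var) (stepArray 4) ]
differenceExp = op sub shiftedExp (2 [ var p-var , var q-var ])

-- Array 2 is a copy of the output that is 0 on a margin around the grid.
copy difference back-stage backward clear-output clear-buffer : Program
copy       = fill 2 (lit 0ℤ) (var 0) (lit 0ℤ) (var 1) (1 [ var p-var , var q-var ])
difference = fill 1 (lit 0ℤ) (var 0) (lit 0ℤ) (var 1) differenceExp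
back-stage = i-var ≔ op sub (op sub (var 25) (lit 1ℤ)) (var u-var) ⨾ copy ⨾ difference ⨾ add-back
backward   = for u-var (lit 0ℤ) (var 25) back-stage
clear-output = fill 1 (lit 0ℤ) (var 0) (lit 0ℤ) (var 1) (toReal (lit 0ℤ))
clear-buffer = fill 2 (op sub (lit 0ℤ) (var 0)) (op add (var 0) (var 0))
  (op sub (lit 0ℤ) (var 1)) (op add (var 1) (var 1)) (toReal (lit 0ℤ))

module _ {m n : ℕ} {v : ℕ → Point} {count : ℕ} (f₀ : Formal) (d : ℕ) where

  private
    C : Store → Set
    C = Const m n v count
    R′ : ℕ → ℕ
    R′ k = reach m n (v k)
    G halo : Box
    G = grid {m} {n}
    -- Large enough to contain P − v for all P in the grid, since |a| < m and |b| < n.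
    halo = (0ℤ ℤ.- + m , + m ℤ.+ + m) , (0ℤ ℤ.- + n , + n ℤ.+ + n)
    W : ℕ → Box
    W = window {m} {n} {v} {count}
    Hist : Store → ℕ → Formal → Set
    Hist = History {m} {n} {v} {count} f₀

  Small : Point → Set
  Small (α , β) = ℤ.∣ α ∣ ℕ.< m × ℤ.∣ β ∣ ℕ.< n

  private
    halo₁ : ∀ l x α → InInterval (0ℤ , + l) x → ℤ.∣ α ∣ ℕ.< l → InInterval (0ℤ ℤ.- + l , + l ℤ.+ + l) (x ℤ.- α)
    halo₁ l x α@(+ k) (0≤x , x<l) k<l =
      linear₂ 0≤x (ℤ.+≤+ (ℕₚ.<⇒≤ k<l)) (identity₁ x (+ l) α) ,
      ℤₚ.suc[i]≤j⇒i<j (linear₂ {x′ = 0ℤ} {+ l ℤ.+ + k} (ℤₚ.i<j⇒suc[i]≤j x<l) (ℤ.+≤+ ℕ.z≤n) (identity₂ x (+ l) α))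
      where
      identity₁ : ∀ x l α → (x ℤ.- 0ℤ) ℤ.+ (l ℤ.- α) ≡ (x ℤ.- α) ℤ.- (0ℤ ℤ.- l)
      identity₁ = solve-∀
      identity₂ : ∀ x l α → (l ℤ.- (1ℤ ℤ.+ x)) ℤ.+ (l ℤ.+ α ℤ.- 0ℤ) ≡ (l ℤ.+ l) ℤ.- (1ℤ ℤ.+ (x ℤ.- α))
      identity₂ = solve-∀
    halo₁ l x α@(-[1+ k ]) (0≤x , x<l) k<l =
      linear₂ {x′ = 0ℤ} {+ l ℤ.+ + suc k} 0≤x (ℤ.+≤+ ℕ.z≤n) (identity₁ x (+ l) (+ suc k)) ,
      ℤₚ.suc[i]≤j⇒i<j (linear₂ {x′ = + suc k} (ℤₚ.i<j⇒suc[i]≤j x<l) (ℤ.+≤+ (ℕₚ.<⇒≤ k<l)) (identity₂ x (+ l) (+ suc k)))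
      where
      identity₁ : ∀ x l α → (x ℤ.- 0ℤ) ℤ.+ (l ℤ.+ α ℤ.- 0ℤ) ≡ (x ℤ.- ℤ.- α) ℤ.- (0ℤ ℤ.- l)
      identity₁ = solve-∀
      identity₂ : ∀ x l α → (l ℤ.- (1ℤ ℤ.+ x)) ℤ.+ (l ℤ.- α) ≡ (l ℤ.+ l) ℤ.- (1ℤ ℤ.+ (x ℤ.- ℤ.- α))
      identity₂ = solve-∀

  shifted∈halo : ∀ v P → Small v → InBox G P → InBox halo (P -ᵖ v)
  shifted∈halo (α , β) (p , q) (α< , β<) (p∈ , q∈) = halo₁ m p α p∈ α< , halo₁ n q β q∈ β<

  cell : Store → ℕ → Point → ℝ
  cell τ x (p , q) = τ real x p q

  -- Array 2 is constrained on the margin only, as its grid part is rewritten in every round. Line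
  -- sums agree for all k from i up to d, not just up to `count`, so the directions never divided
  -- out are carried along.
  Backward : ℕ → Store → Set
  Backward i τ = ∃[ f ] ∃[ g ] (Hist τ i f × Supported (W i) g ×
    (∀ P → InBox G P → cell τ 1 P ≃ ⟦ g ⟧ (at P)) ×
    (∀ P → InBox halo P → ¬ InBox G P → cell τ 2 P ≃ 𝟘) ×
    (∀ k c → i ≤ k → k ℕ.< d → lineTotal (v k) c g ≃ lineTotal (v k) c f))

  whole-grid : ∀ {l} → + l ℤ.≤ 0ℤ ℤ.+ + l
  whole-grid = ℤₚ.≤-refl

  copy-rule : ∀ σ → C σ → Run copy σ (fillCost 2 (lit 0ℤ) (var 0) (lit 0ℤ) (var 1) (1 [ var p-var , var q-var ]) m n)
    (λ τ → (∀ P → ¬ InBox G P → cell τ 2 P ≡ cell σ 2 P) × (∀ P → InBox G P → cell τ 2 P ≃ cell σ 1 P))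
  copy-rule σ Cσ = fill-rule 2 _ _ _ _ (1 [ var p-var , var q-var ]) σ m n (cell σ 1) refl whole-grid whole-grid
    (λ τ fr → trans (fr int 0 refl 0ℤ 0ℤ) (width-is Cσ)) (λ _ _ → refl)
    (λ τ fr → trans (fr int 1 refl 0ℤ 0ℤ) (height-is Cσ))
    (λ τ p q fr p≡ q≡ _ → ≡⇒≃ (trans (cong₂ (τ real 1) p≡ q≡) (fr real 1 refl p q)))

  -- Both values are read from the copy, since in array 1 the cell at P - v may already have been
  -- overwritten.
  difference-rule : ∀ σ i → C σ → value σ i-var ≡ + i →
    Run difference σ (fillCost 1 (lit 0ℤ) (var 0) (lit 0ℤ) (var 1) differenceExp m n)
      (λ τ → ∀ P → InBox G P → cell τ 1 P ≃ cell σ 2 (P -ᵖ v i) ⊝ cell σ 2 P)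
  difference-rule σ i Cσ i≡ = run-map (λ _ → proj₂)
    (fill-rule 1 _ _ _ _ differenceExp σ m n (λ P → cell σ 2 (P -ᵖ v i) ⊝ cell σ 2 P) refl whole-grid whole-grid
      (λ τ fr → trans (fr int 0 refl 0ℤ 0ℤ) (width-is Cσ)) (λ _ _ → refl)
      (λ τ fr → trans (fr int 1 refl 0ℤ 0ℤ) (height-is Cσ))
      (λ τ p q fr p≡ q≡ _ → value≃ τ p q fr p≡ q≡))
    where
    component : ∀ τ → Frame difference σ τ → ∀ x → writes difference int x ≡ false → (π : Point → ℤ) →
      σ int x (+ i) 0ℤ ≡ π (v i) → eval τ (stepArray x) ≡ π (v i)
    component τ fr x e π eq = trans (cong (λ z → τ int x z 0ℤ) (trans (fr int i-var refl 0ℤ 0ℤ) i≡))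
      (trans (fr int x e (+ i) 0ℤ) eq)
    shifted : ∀ τ p q → Frame difference σ τ → value τ p-var ≡ p → value τ q-var ≡ q →
      eval τ shiftedExp ≡ cell σ 2 ((p , q) -ᵖ v i)
    shifted τ p q fr p≡ q≡ = trans (cong₂ (τ real 2)
        (cong₂ ℤ._-_ p≡ (component τ fr 3 refl proj₁ (dir₁ Cσ i)))
        (cong₂ ℤ._-_ q≡ (component τ fr 4 refl proj₂ (dir₂ Cσ i))))
      (fr real 2 refl (p ℤ.- proj₁ (v i)) (q ℤ.- proj₂ (v i)))
    value≃ : ∀ τ p q → Frame difference σ τ → value τ p-var ≡ p → value τ q-var ≡ q →
      eval τ differenceExp ≃ cell σ 2 ((p , q) -ᵖ v i) ⊝ cell σ 2 (p , q)
    value≃ τ p q fr p≡ q≡ = eval-sub τ shiftedExp (2 [ var p-var , var q-var ])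
      (shifted τ p q fr p≡ q≡) (trans (cong₂ (τ real 2) p≡ q≡) (fr real 2 refl p q))

  backCost : ℕ → ℕ
  backCost i = 3 ℕ.+
    (fillCost 2 (lit 0ℤ) (var 0) (lit 0ℤ) (var 1) (1 [ var p-var , var q-var ]) m n ℕ.+
    (fillCost 1 (lit 0ℤ) (var 0) (lit 0ℤ) (var 1) differenceExp m n ℕ.+ lineLoopCost (R′ i) 2))

  private
    module Step (i : ℕ) (i<count : i ℕ.< count) (small : Small (v i))
      (σ : Store) (Cσ : C σ) (i≡ : value σ i-var ≡ + i)
      (f h g : Formal) (ρ : ℤ → Point) (H : Hist σ i f) (h∈ : Supported (W (suc i)) h)
      (ρ≡ : ∀ c → rep σ i c ≡ ρ c) (good : Represents (v i) (W i) ρ)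
      (L≃ : ∀ c → σ real 0 (+ i) c ≃ lineTotal (v i) c f)
      (eq : ∀ χ → ⟦ f ⟧ χ ≃ ⟦ relocate (ρ ∘ line (v i)) f ⟧ χ ⊕ δ (v i) h χ)
      (g∈ : Supported (W (suc i)) g)
      (output≃ : ∀ P → InBox G P → cell σ 1 P ≃ ⟦ g ⟧ (at P))
      (buffer≃ : ∀ P → InBox halo P → ¬ InBox G P → cell σ 2 P ≃ 𝟘)
      (totals : ∀ k c → suc i ≤ k → k ℕ.< d → lineTotal (v k) c g ≃ lineTotal (v k) c h)
      where

      w = v i
      rel new : Formal
      rel = relocate (ρ ∘ line w) f
      -- r + (v - 1) g: the decomposition of f with g in place of h.
      new = rel ++ (shift w g ++ negate g)

      f∈ : Supported G f
      f∈ = All.map (λ {t} → window⊆grid {m} {n} {v} {count} i (proj₁ t)) (history-supported H)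

      g∈G : Supported G g
      g∈G = All.map (λ {t} → window⊆grid {m} {n} {v} {count} (suc i) (proj₁ t)) g∈

      new∈ : Supported (W i) new
      new∈ = Allₚ.++⁺ (relocate-supported (W i) (W i) w ρ f (history-supported H) λ P P∈ → proj₁ (good P P∈))
        (Allₚ.++⁺ (Allₚ.map⁺ (All.map (λ {t} P∈ → proj₂ (shrinkBox⁻ w (W i) (proj₁ t) P∈)) g∈))
          (Allₚ.map⁺ (All.map (λ {t} P∈ → proj₁ (shrinkBox⁻ w (W i) (proj₁ t) P∈)) g∈)))

      ⟦new⟧ : ∀ χ → ⟦ new ⟧ χ ≃ ⟦ rel ⟧ χ ⊕ δ w g χ
      ⟦new⟧ χ = ≃-trans (⟦⟧-++ rel _ χ) (⊕-cong ≃-refl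
        (≃-trans (⟦⟧-++ (shift w g) (negate g) χ) (⊕-cong ≃-refl (⟦⟧-negate g χ))))

      -- In a later direction the line sums of (v - 1) g depend only on those of g, which agree with
      -- those of h. In direction v itself they vanish for g and for h alike.
      new-totals : ∀ k c → i ≤ k → k ℕ.< d → lineTotal (v k) c new ≃ lineTotal (v k) c f
      new-totals k c i≤k k<d = ≃-trans (⟦new⟧ (onLine (v k) c))
        (≃-trans (⊕-cong ≃-refl (same (ℕₚ.m≤n⇒m<n∨m≡n i≤k))) (≃-sym (eq (onLine (v k) c))))
        where
        same : i ℕ.< k ⊎ i ≡ k → δ w g (onLine (v k) c) ≃ δ w h (onLine (v k) c)
        same (inj₁ i<k)  = δ-cong w (v k) g h (λ c → totals k c i<k k<d) c
        same (inj₂ refl) = ≃-trans (δ-self w g c) (≃-sym (δ-self w h c))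

      -- Off the grid g has no mass and the buffer is 0, so a shifted read that leaves the grid
      -- still returns the value of g.
      copied : ∀ τ → (∀ P → ¬ InBox G P → cell τ 2 P ≡ cell σ 2 P) → (∀ P → InBox G P → cell τ 2 P ≃ cell σ 1 P) →
        ∀ P → InBox halo P → cell τ 2 P ≃ ⟦ g ⟧ (at P)
      copied τ out inn P P∈halo with inBox? G P
      ... | yes P∈ = ≃-trans (inn P P∈) (output≃ P P∈)
      ... | no  P∉ = ≃-trans (≡⇒≃ (out P P∉))
        (≃-trans (buffer≃ P P∈halo P∉) (≃-sym (unsupported G g P g∈G P∉)))

      grid⊆halo : ∀ P → InBox G P → InBox halo P
      grid⊆halo (p , q) ((0≤p , p<m) , (0≤q , q<n)) =
        (ℤₚ.≤-trans (ℤₚ.≤-trans (ℤₚ.≤-reflexive (ℤₚ.+-identityˡ (ℤ.- + m))) (ℤₚ.neg-≤-pos {m} {0})) 0≤p ,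
          ℤₚ.<-≤-trans p<m (≤l+ (+ m) m)) ,
        (ℤₚ.≤-trans (ℤₚ.≤-trans (ℤₚ.≤-reflexive (ℤₚ.+-identityˡ (ℤ.- + n))) (ℤₚ.neg-≤-pos {n} {0})) 0≤q ,
          ℤₚ.<-≤-trans q<n (≤l+ (+ n) n))

      -- Row i still holds the line sums of f in direction i from the moment before that direction
      -- was divided out, so r can be rebuilt without f.
      placed : ∀ τ → (∀ c → rep τ i c ≡ rep σ i c) → (∀ c → τ real 0 (+ i) c ≡ σ real 0 (+ i) c) → ∀ χ →
        rangeSum (ℤ.- + R′ i) (width₂ (R′ i)) (λ t → gate (χ (rep τ i t)) (τ real 0 (+ i) t)) ≃ ⟦ rel ⟧ χ
      placed τ reps rows χ = ≃-trans
        (rangeSum-cong (ℤ.- + R′ i) (width₂ (R′ i)) λ t → ≃-trans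
          (≡⇒≃ (cong₂ (λ P x → gate (χ P) x) (trans (reps t) (ρ≡ t)) (rows t)))
          (gate-cong (χ (ρ t)) (L≃ t)))
        (rangeSum-relocate (ℤ.- + R′ i) (width₂ (R′ i)) w ρ f (inRange {m} {n} {v} {count} i f f∈) χ)

    back-step : ∀ i → i ℕ.< count → Small (v i) → ∀ σ → C σ → value σ i-var ≡ + i → Backward (suc i) σ →
      Run (copy ⨾ difference ⨾ add-back) σ
        (fillCost 2 (lit 0ℤ) (var 0) (lit 0ℤ) (var 1) (1 [ var p-var , var q-var ]) m n ℕ.+
        (fillCost 1 (lit 0ℤ) (var 0) (lit 0ℤ) (var 1) differenceExp m n ℕ.+ lineLoopCost (R′ i) 2))
        (Backward i)
    back-step i i<count small σ Cσ i≡ (h , g , next {f = f} ρ H h∈ ρ≡ good L≃ eq , g∈ , output≃ , buffer≃ , totals) =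
      framed (copy-rule σ Cσ) then λ τ (fr , out , inn) →
      framed (difference-rule τ i (Const-frame copy refl refl refl refl refl refl fr Cσ)
        (trans (fr int i-var refl 0ℤ 0ℤ) i≡)) then λ υ (fr′ , diff) → run-map
      (λ ω (fr″ , added) → f , S.new ,
        history-resp
          (λ k _ c → trans (cong₂ _,_ (fr″ int 5 refl (+ k) c) (fr″ int 6 refl (+ k) c))
            (trans (cong₂ _,_ (fr′ int 5 refl (+ k) c) (fr′ int 6 refl (+ k) c))
              (cong₂ _,_ (fr int 5 refl (+ k) c) (fr int 6 refl (+ k) c))))
          (λ k _ c → trans (fr″ real 0 refl (+ k) c) (trans (fr′ real 0 refl (+ k) c) (fr real 0 refl (+ k) c))) H ,
        S.new∈ ,
        (λ P P∈ → ≃-trans (added (proj₁ P) (proj₂ P)) (≃-trans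
          (⊕-cong
            (≃-trans (diff P P∈) (⊝-cong
              (≃-trans (S.copied τ out inn (P -ᵖ v i) (shifted∈halo (v i) P small P∈))
                (≡⇒≃ (sym (⟦shift⟧-at (v i) g P))))
              (S.copied τ out inn P (S.grid⊆halo P P∈))))
            (S.placed υ
              (λ c → trans (cong₂ _,_ (fr′ int 5 refl (+ i) c) (fr′ int 6 refl (+ i) c))
                (cong₂ _,_ (fr int 5 refl (+ i) c) (fr int 6 refl (+ i) c)))
              (λ c → trans (fr′ real 0 refl (+ i) c) (fr real 0 refl (+ i) c)) (at P)))
          (≃-trans (⊕-comm _ _) (≃-sym (S.⟦new⟧ (at P)))))) ,
        (λ P P∈halo P∉ → ≃-trans
          (≡⇒≃ (trans (fr″ real 2 refl _ _) (trans (fr′ real 2 refl _ _) (out P P∉)))) (buffer≃ P P∈halo P∉)) ,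
        S.new-totals)
      (framed (add-rule υ i
        (Const-frame difference refl refl refl refl refl refl fr′
          (Const-frame copy refl refl refl refl refl refl fr Cσ))
        i<count (trans (fr′ int i-var refl 0ℤ 0ℤ) (trans (fr int i-var refl 0ℤ 0ℤ) i≡))))
      where
      module S = Step i i<count small σ Cσ i≡ f h g ρ H h∈ ρ≡ good L≃ eq g∈ output≃ buffer≃ totals

  backward-rule : ∀ σ → C σ → (∀ k → k ℕ.< count → Small (v k)) → Backward count σ →
    Run backward σ (forCost (lit 0ℤ) (var 25) count (λ u → backCost (count ℕ.∸ suc u))) (Backward 0)
  backward-rule σ Cσ small inv₀ = run-map (λ τ → subst (λ i → Backward i τ) (ℕₚ.n∸n≡0 count))
    (for-rule u-var _ _ back-stage σ count (λ u → backCost (count ℕ.∸ suc u)) (λ u → Backward (count ℕ.∸ u))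
      refl (ℤₚ.≤-reflexive end) (λ τ fr → trans (fr int 25 refl 0ℤ 0ℤ) (count-is Cσ)) refl
      (λ u x τ (f , g , H , rest) → f , g , history-resp (λ _ _ _ → refl) (λ _ _ _ → refl) H , rest)
      inv₀ body end)
    where
    end : + count ≡ + 0 ℤ.+ + count
    end = refl
    body : ∀ u τ → Frame backward σ τ → value τ u-var ≡ + 0 ℤ.+ + u → + 0 ℤ.+ + u ℤ.< + count →
      Backward (count ℕ.∸ u) τ → Run back-stage τ (backCost (count ℕ.∸ suc u)) (Backward (count ℕ.∸ suc u))
    body u τ fr u≡ (ℤ.+<+ u<count) (f , g , H , rest) =
      assign-then refl refl i≡
        (back-step i i<count (small i i<count) υ record { Const Cτ } refl
          (subst (λ j → Backward j υ) suc-i (f , g , history-resp (λ _ _ _ → refl) (λ _ _ _ → refl) H , rest)))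
      where
      -- The counter runs upwards while the directions are undone from the last to the first.
      i = count ℕ.∸ suc u
      υ = setVar i-var (+ i) τ
      Cτ = Const-frame backward refl refl refl refl refl refl fr Cσ
      suc-i : count ℕ.∸ u ≡ suc i
      suc-i = ℕₚ.+-∸-assoc 1 u<count
      i<count : i ℕ.< count
      i<count = subst (ℕ._≤ count) suc-i (ℕₚ.m∸n≤m count u)
      i≡ : value τ 25 ℤ.- 1ℤ ℤ.- value τ u-var ≡ + i
      i≡ = trans (cong₂ (λ x y → x ℤ.- 1ℤ ℤ.- y) (count-is Cτ) u≡) (trans (identity (+ count) (+ u))
        (trans (ℤₚ.[+m]-[+n]≡m⊖n count (suc u)) (ℤₚ.⊖-≥ u<count)))
        where
        identity : ∀ x y → x ℤ.- 1ℤ ℤ.- y ≡ x ℤ.- (1ℤ ℤ.+ y)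
        identity = solve-∀

-- Selecting the directions

bad-var a-sum-var b-sum-var count-var h-var a-var b-var : ℕ
bad-var   = 22
a-sum-var = 23
b-sum-var = 24
count-var = 25
h-var     = 26
a-var     = 27
b-var     = 28

-- bad-var is the index of a direction with |a| ≥ m or |b| ≥ n, or −1 if there is
-- none; count-var is the number of directions that are used.
absolute : ℕ → ℕ → Program
absolute x y = x ≔ y [ var h-var , lit 0ℤ ] ⨾ cond (var x ≺ lit 0ℤ) (x ≔ op sub (lit 0ℤ) (var x)) skip

reachValue : Exp int
reachValue = op add (op mul (var a-var) (var 1)) (op mul (var b-var) (var 0))

classify grow extend survey-body survey-loop survey : Program
classify = cond (var a-var ≺ var 0) (cond (var b-var ≺ var 1) skip (bad-var ≔ var h-var)) (bad-var ≔ var h-var)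
grow = 7 [ var h-var , lit 0ℤ ]≔ reachValue ⨾
  a-sum-var ≔ op add (var a-sum-var) (var a-var) ⨾
  b-sum-var ≔ op add (var b-sum-var) (var b-var) ⨾
  count-var ≔ op add (var h-var) (lit 1ℤ)
extend = cond (var a-sum-var ≺ var 0) (cond (var b-sum-var ≺ var 1) grow skip) skip
survey-body = absolute a-var 3 ⨾ absolute b-var 4 ⨾ classify ⨾ extend
survey-loop = for h-var (lit 0ℤ) (var 2) survey-body
survey = bad-var ≔ lit (ℤ.- 1ℤ) ⨾ a-sum-var ≔ lit 0ℤ ⨾ b-sum-var ≔ lit 0ℤ ⨾ count-var ≔ lit 0ℤ ⨾ survey-loop

absolute-rule : ∀ σ x y k i → value σ h-var ≡ + k → σ int y (+ k) 0ℤ ≡ i →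
  Run (absolute x y) σ 4 (λ τ → value τ x ≡ + ℤ.∣ i ∣)
absolute-rule σ x y k i k≡ i≡ = assign-then refl refl (trans (cong (λ z → σ int y z 0ℤ) k≡) i≡)
  (run-cond {K = 2} {L = 0} (value-setVar x i σ) refl
    (λ i<0 → run-assign refl refl (cong (λ z → 0ℤ ℤ.- z) (value-setVar x i σ))
      (trans (value-setVar x _ (setVar x i σ)) (negative i i<0)))
    (λ i≮0 → run-skip (trans (value-setVar x i σ) (sym (ℤₚ.0≤i⇒+∣i∣≡i (ℤₚ.≮⇒≥ i≮0))))))
  where
  negative : ∀ i → i ℤ.< 0ℤ → 0ℤ ℤ.- i ≡ + ℤ.∣ i ∣
  negative -[1+ _ ] _ = refl
  negative (+ _) (ℤ.+<+ ())

module _ {m n : ℕ} {v : ℕ → Point} (d : ℕ) where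

  record Given (τ : Store) : Set where
    field
      width≡  : value τ 0 ≡ + m
      height≡ : value τ 1 ≡ + n
      size≡   : value τ 2 ≡ + d
      first≡  : ∀ k → τ int 3 (+ k) 0ℤ ≡ proj₁ (v k)
      second≡ : ∀ k → τ int 4 (+ k) 0ℤ ≡ proj₂ (v k)

  open Given

  Given-frame : ∀ P {σ τ} → writes P int 0 ≡ false → writes P int 1 ≡ false →
    writes P int 2 ≡ false → writes P int 3 ≡ false → writes P int 4 ≡ false →
    Frame P σ τ → Given σ → Given τ
  Given-frame P e₀ e₁ e₂ e₃ e₄ fr I = record
    { width≡  = trans (fr int 0 e₀ 0ℤ 0ℤ) (width≡ I)
    ; height≡ = trans (fr int 1 e₁ 0ℤ 0ℤ) (height≡ I)
    ; size≡   = trans (fr int 2 e₂ 0ℤ 0ℤ) (size≡ I)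
    ; first≡  = λ k → trans (fr int 3 e₃ (+ k) 0ℤ) (first≡ I k)
    ; second≡ = λ k → trans (fr int 4 e₄ (+ k) 0ℤ) (second≡ I k)
    }

  private
    α β : ℕ → ℕ
    α k = ℤ.∣ proj₁ (v k) ∣
    β k = ℤ.∣ proj₂ (v k) ∣

  a-sum b-sum : ℕ → ℕ
  a-sum zero    = 0
  a-sum (suc k) = a-sum k ℕ.+ α k
  b-sum zero    = 0
  b-sum (suc k) = b-sum k ℕ.+ β k

  Small′ : ℕ → Set
  Small′ k = α k ℕ.< m × β k ℕ.< n

  Classified : ℕ → Store → Set
  Classified u τ = (value τ bad-var ≡ ℤ.- 1ℤ × (∀ k → k ℕ.< u → Small′ k)) ⊎
    (∃[ k ] (k ℕ.< u × value τ bad-var ≡ + k × ¬ Small′ k))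

  Saturated : ℕ → Set
  Saturated c = m ≤ a-sum c ⊎ n ≤ b-sum c

  -- The counted directions form an initial segment, because saturated sums stop growing and fail
  -- the test for good. `unfilled` records that both sums were too small before each counted
  -- direction, so only the last one can overshoot.
  record Counted (u : ℕ) (τ : Store) : Set where
    field
      counted  : ℕ
      c≤u      : counted ≤ u
      complete : counted ≡ u ⊎ Saturated counted
      count≡   : value τ count-var ≡ + counted
      a-sum≡   : value τ a-sum-var ≡ + a-sum counted
      b-sum≡   : value τ b-sum-var ≡ + b-sum counted
      reach≡   : ∀ k → k ℕ.< counted → τ int 7 (+ k) 0ℤ ≡ + reach m n (v k)
      unfilled : ∀ k → k ℕ.< counted → a-sum k ℕ.< m × b-sum k ℕ.< n

  open Counted

  private
    drop-< : ∀ {i j} → + i ℤ.< + j → i ℕ.< j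
    drop-< (ℤ.+<+ i<j) = i<j

    lift-≮ : ∀ {i j} → ¬ + i ℤ.< + j → j ≤ i
    lift-≮ ≮ = ℕₚ.≮⇒≥ (≮ ∘ ℤ.+<+)

  classify-rule : ∀ σ u → Given σ → value σ h-var ≡ + u → value σ a-var ≡ + α u → value σ b-var ≡ + β u →
    Classified u σ → Run classify σ 4 (Classified (suc u))
  classify-rule σ u I u≡ a≡ b≡ cls = run-cond {K = 2} {L = 1} a≡ (width≡ I)
    (λ a<m → run-cond {K = 0} {L = 1} b≡ (height≡ I)
      (λ b<n → run-skip (extended (drop-< a<m , drop-< b<n) cls))
      (λ b≮n → mark λ (_ , b<n) → ℕₚ.<⇒≱ b<n (lift-≮ b≮n)))
    (λ a≮m → mark λ (a<m , _) → ℕₚ.<⇒≱ a<m (lift-≮ a≮m))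
    where
    mark : ¬ Small′ u → Run (bad-var ≔ var h-var) σ 1 (Classified (suc u))
    mark big = run-assign refl refl u≡ (inj₂ (u , ℕₚ.≤-refl , refl , big))
    extended : Small′ u → Classified u σ → Classified (suc u) σ
    extended small (inj₁ (bad≡ , smalls)) = inj₁ (bad≡ , λ k k≤u →
      [ smalls k , (λ { refl → small }) ]′ (ℕₚ.m≤n⇒m<n∨m≡n (ℕₚ.≤-pred k≤u)))
    extended small (inj₂ (k , k<u , bad≡ , big)) = inj₂ (k , ℕₚ.m≤n⇒m≤1+n k<u , bad≡ , big)

  extend-rule : ∀ σ u → Given σ → value σ h-var ≡ + u → value σ a-var ≡ + α u → value σ b-var ≡ + β u →
    Counted u σ → Run extend σ 12 (Counted (suc u))
  extend-rule σ u I u≡ a≡ b≡ K = run-cond {K = 11} {L = 0} (a-sum≡ K) (width≡ I)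
    (λ a<m → run-cond {K = 10} {L = 0} (b-sum≡ K) (height≡ I)
      (λ b<n → grow-rule (drop-< a<m) (drop-< b<n) (complete K))
      (λ b≮n → run-skip (saturated (inj₂ (lift-≮ b≮n)))))
    (λ a≮m → run-skip (saturated (inj₁ (lift-≮ a≮m))))
    where
    c = counted K
    saturated : Saturated c → Counted (suc u) σ
    saturated sat = record { Counted K ; c≤u = ℕₚ.m≤n⇒m≤1+n (c≤u K) ; complete = inj₂ sat }
    grow-rule : a-sum c ℕ.< m → b-sum c ℕ.< n → c ≡ u ⊎ Saturated c → Run grow σ 10 (Counted (suc u))
    -- A successful test excludes saturation, so all earlier directions were counted and the current
    -- one is number c.
    grow-rule a< b< (inj₂ (inj₁ m≤)) = contradiction m≤ (ℕₚ.<⇒≱ a<)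
    grow-rule a< b< (inj₂ (inj₂ n≤)) = contradiction n≤ (ℕₚ.<⇒≱ b<)
    grow-rule a< b< (inj₁ refl) =
      assign-then u≡ refl reach-value≡ (assign-then refl refl (cong₂ ℤ._+_ (a-sum≡ K) a≡)
        (assign-then refl refl (cong₂ ℤ._+_ (b-sum≡ K) b≡)
          (run-assign refl refl (cong (ℤ._+ 1ℤ) u≡) (record
            { counted  = suc c
            ; c≤u      = ℕₚ.≤-refl
            ; complete = inj₁ refl
            ; count≡   = cong +_ (ℕₚ.+-comm c 1)
            ; a-sum≡   = refl
            ; b-sum≡   = refl
            ; reach≡   = λ k k≤c → reach-at k (ℕₚ.m≤n⇒m<n∨m≡n (ℕₚ.≤-pred k≤c))
            ; unfilled = λ k k≤c → [ unfilled K k , (λ { refl → a< , b< }) ]′ (ℕₚ.m≤n⇒m<n∨m≡n (ℕₚ.≤-pred k≤c))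
            }))))
      where
      r = + reach m n (v c)
      reach-value≡ : eval σ reachValue ≡ r
      reach-value≡ = trans (cong₂ ℤ._+_ (cong₂ ℤ._*_ a≡ (height≡ I)) (cong₂ ℤ._*_ b≡ (width≡ I)))
        (cong₂ ℤ._+_ (sym (ℤₚ.pos-* (α c) n)) (sym (ℤₚ.pos-* (β c) m)))
      reach-at : ∀ k → k ℕ.< c ⊎ k ≡ c → update int 7 (+ c) 0ℤ r σ int 7 (+ k) 0ℤ ≡ + reach m n (v k)
      reach-at k (inj₁ k<c)  = trans (update-elsewhere int 7 (+ c) 0ℤ r σ (+ k) 0ℤ
        (ℕₚ.<⇒≢ k<c ∘ ℤₚ.+-injective ∘ proj₁)) (reach≡ K k k<c)
      reach-at k (inj₂ refl) = update-same int 7 (+ c) 0ℤ r σ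

  Surveyed : ℕ → Store → Set
  Surveyed u τ = Classified u τ × Counted u τ

  -- 24 = 4 + 4 + 4 + 12: two absolute values, the classification and the extension.
  survey-rule : ∀ σ → Given σ → Run survey σ (4 ℕ.+ forCost (lit 0ℤ) (var 2) d (λ _ → 24)) (Surveyed d)
  survey-rule σ I = assign-then refl refl refl (assign-then refl refl refl (assign-then refl refl refl
    (assign-then refl refl refl (for-rule h-var _ _ survey-body σ₀ d (λ _ → 24) Surveyed
      refl (ℤₚ.≤-reflexive end) (λ τ fr → size≡ (given τ fr)) refl
      (λ u x τ (cls , K) → cls , record { Counted K })
      (inj₁ (refl , λ _ ()) , record
        { counted = 0 ; c≤u = ℕ.z≤n ; complete = inj₁ refl ; count≡ = refl ; a-sum≡ = refl ; b-sum≡ = refl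
        ; reach≡ = λ _ () ; unfilled = λ _ () })
      (λ u τ fr u≡ _ inv → body u τ (given τ fr) u≡ inv) end))))
    where
    σ₀ = setVar count-var 0ℤ (setVar b-sum-var 0ℤ (setVar a-sum-var 0ℤ (setVar bad-var (ℤ.- 1ℤ) σ)))
    end : + d ≡ + 0 ℤ.+ + d
    end = refl
    given : ∀ τ → Frame survey-loop σ₀ τ → Given τ
    given τ fr = Given-frame survey-loop refl refl refl refl refl fr record { Given I }
    body : ∀ u τ → Given τ → value τ h-var ≡ + u → Surveyed u τ → Run survey-body τ 24 (Surveyed (suc u))
    body u τ I u≡ (cls , K) =
      framed (absolute-rule τ a-var 3 u (proj₁ (v u)) u≡ (first≡ I u)) then λ υ (fr₁ , a≡) →
      let I₁ = Given-frame (absolute a-var 3) refl refl refl refl refl fr₁ I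
          u≡₁ = trans (fr₁ int h-var refl 0ℤ 0ℤ) u≡
      in framed (absolute-rule υ b-var 4 u (proj₂ (v u)) u≡₁ (second≡ I₁ u)) then λ ω (fr₂ , b≡) →
      let I₂ = Given-frame (absolute b-var 4) refl refl refl refl refl fr₂ I₁
          u≡₂ = trans (fr₂ int h-var refl 0ℤ 0ℤ) u≡₁
          a≡₂ = trans (fr₂ int a-var refl 0ℤ 0ℤ) a≡
      in framed (classify-rule ω u I₂ u≡₂ a≡₂ b≡ (classified τ ω
          (trans (fr₂ int bad-var refl 0ℤ 0ℤ) (fr₁ int bad-var refl 0ℤ 0ℤ)) cls)) then λ χ (fr₃ , cls′) →
        run-map (λ ψ (fr₄ , K′) → classified χ ψ (fr₄ int bad-var refl 0ℤ 0ℤ) cls′ , K′)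
          (framed (extend-rule χ u (Given-frame classify refl refl refl refl refl fr₃ I₂)
            (trans (fr₃ int h-var refl 0ℤ 0ℤ) u≡₂) (trans (fr₃ int a-var refl 0ℤ 0ℤ) a≡₂)
            (trans (fr₃ int b-var refl 0ℤ 0ℤ) b≡)
            (record
              { Counted K
              ; count≡ = trans (fr₃ int count-var refl 0ℤ 0ℤ) (trans (fr₂ int count-var refl 0ℤ 0ℤ)
                  (trans (fr₁ int count-var refl 0ℤ 0ℤ) (count≡ K)))
              ; a-sum≡ = trans (fr₃ int a-sum-var refl 0ℤ 0ℤ) (trans (fr₂ int a-sum-var refl 0ℤ 0ℤ)
                  (trans (fr₁ int a-sum-var refl 0ℤ 0ℤ) (a-sum≡ K)))
              ; b-sum≡ = trans (fr₃ int b-sum-var refl 0ℤ 0ℤ) (trans (fr₂ int b-sum-var refl 0ℤ 0ℤ)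
                  (trans (fr₁ int b-sum-var refl 0ℤ 0ℤ) (b-sum≡ K)))
              ; reach≡ = λ k k< → trans (fr₃ int 7 refl (+ k) 0ℤ) (trans (fr₂ int 7 refl (+ k) 0ℤ)
                  (trans (fr₁ int 7 refl (+ k) 0ℤ) (reach≡ K k k<)))
              })))
      where
      classified : ∀ {u} σ τ → value τ bad-var ≡ value σ bad-var → Classified u σ → Classified u τ
      classified σ τ eq (inj₁ (bad≡ , smalls))         = inj₁ (trans eq bad≡ , smalls)
      classified σ τ eq (inj₂ (k , k< , bad≡ , big))   = inj₂ (k , k< , trans eq bad≡ , big)

-- Running time

sumFrom-mono : ∀ u N {K L} → (∀ k → u ≤ k → k ℕ.< u ℕ.+ N → K k ≤ L k) → sumFrom u N K ≤ sumFrom u N L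
sumFrom-mono u zero    K≤L = ℕ.z≤n
sumFrom-mono u (suc N) K≤L = ℕₚ.+-mono-≤ (K≤L u ℕₚ.≤-refl (ℕₚ.m<m+n u (ℕ.s≤s ℕ.z≤n)))
  (sumFrom-mono (suc u) N λ k u<k k< → K≤L k (ℕₚ.<⇒≤ u<k) (subst (k ℕ.<_) (sym (ℕₚ.+-suc u N)) k<))

sumFrom-const : ∀ u N c → sumFrom u N (λ _ → c) ≡ N * c
sumFrom-const u zero    c = refl
sumFrom-const u (suc N) c = cong (c ℕ.+_) (sumFrom-const (suc u) N c)

sumFrom-bound : ∀ u N {K} c → (∀ k → u ≤ k → k ℕ.< u ℕ.+ N → K k ≤ c) → sumFrom u N K ≤ N * c
sumFrom-bound u N c K≤ = ℕₚ.≤-trans (sumFrom-mono u N K≤) (ℕₚ.≤-reflexive (sumFrom-const u N c))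

sumFrom-+ : ∀ u N K L → sumFrom u N (λ k → K k ℕ.+ L k) ≡ sumFrom u N K ℕ.+ sumFrom u N L
sumFrom-+ u zero    K L = refl
sumFrom-+ u (suc N) K L = trans (cong (K u ℕ.+ L u ℕ.+_) (sumFrom-+ (suc u) N K L))
  (identity (K u) (L u) (sumFrom (suc u) N K) (sumFrom (suc u) N L))
  where
  identity : ∀ a b c d → a ℕ.+ b ℕ.+ (c ℕ.+ d) ≡ a ℕ.+ c ℕ.+ (b ℕ.+ d)
  identity = ℕ-Ring.solve-∀

sumFrom-* : ∀ u N c K → sumFrom u N (λ k → c * K k) ≡ c * sumFrom u N K
sumFrom-* u zero    c K = sym (ℕₚ.*-zeroʳ c)
sumFrom-* u (suc N) c K =
  trans (cong (c * K u ℕ.+_) (sumFrom-* (suc u) N c K)) (sym (ℕₚ.*-distribˡ-+ c (K u) _))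

sumFrom-shift : ∀ j u N K → sumFrom u N (λ k → K (j ℕ.+ k)) ≡ sumFrom (j ℕ.+ u) N K
sumFrom-shift j u zero    K = refl
sumFrom-shift j u (suc N) K = cong (K (j ℕ.+ u) ℕ.+_)
  (trans (sumFrom-shift j (suc u) N K) (cong (λ l → sumFrom l N K) (ℕₚ.+-suc j u)))

sumFrom-split : ∀ u M N K → sumFrom u (M ℕ.+ N) K ≡ sumFrom u M K ℕ.+ sumFrom (u ℕ.+ M) N K
sumFrom-split u zero    N K = cong (λ l → sumFrom l N K) (sym (ℕₚ.+-identityʳ u))
sumFrom-split u (suc M) N K = trans (cong (K u ℕ.+_) (trans (sumFrom-split (suc u) M N K)
    (cong (λ l → sumFrom (suc u) M K ℕ.+ sumFrom l N K) (sym (ℕₚ.+-suc u M)))))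
  (sym (ℕₚ.+-assoc (K u) _ _))

sumFrom-suffix : ∀ j N K → sumFrom j N K ≤ sumFrom 0 (j ℕ.+ N) K
sumFrom-suffix j N K = subst (sumFrom j N K ℕ.≤_) (sym (sumFrom-split 0 j N K)) (ℕₚ.m≤n+m _ (sumFrom 0 j K))

sumFrom-last : ∀ N K → sumFrom 0 (suc N) K ≡ sumFrom 0 N K ℕ.+ K N
sumFrom-last N K = trans (cong (λ l → sumFrom 0 l K) (ℕₚ.+-comm 1 N))
  (trans (sumFrom-split 0 N 1 K) (cong (sumFrom 0 N K ℕ.+_) (ℕₚ.+-identityʳ (K N))))

term≤sumFrom : ∀ N k K → k ℕ.< N → K k ≤ sumFrom 0 N K
term≤sumFrom (suc N) k K k≤N with ℕₚ.m≤n⇒m<n∨m≡n (ℕₚ.≤-pred k≤N)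
... | inj₁ k<N  = subst (K k ℕ.≤_) (sym (sumFrom-last N K)) (ℕₚ.≤-trans (term≤sumFrom N k K k<N) (ℕₚ.m≤m+n _ (K N)))
... | inj₂ refl = subst (K k ℕ.≤_) (sym (sumFrom-last N K)) (ℕₚ.m≤n+m (K k) _)

overhead : Exp int → Exp int → ℕ
overhead lo hi = 5 ℕ.+ expCost lo ℕ.+ (expCost hi ℕ.+ expCost hi)

-- The setup and the final failing test are charged to the rounds, of which there is at least one.
forCost-const : ∀ lo hi N K → 1 ≤ N → forCost lo hi N (λ _ → K) ≤ N * (overhead lo hi ℕ.+ K)
forCost-const lo hi N K 1≤N = begin
  1 ℕ.+ x ℕ.+ (sumFrom 0 N (λ _ → 1 ℕ.+ y ℕ.+ (K ℕ.+ 2)) ℕ.+ (1 ℕ.+ y))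
    ≡⟨ cong (λ s → 1 ℕ.+ x ℕ.+ (s ℕ.+ (1 ℕ.+ y))) (sumFrom-const 0 N _) ⟩
  1 ℕ.+ x ℕ.+ (N * (1 ℕ.+ y ℕ.+ (K ℕ.+ 2)) ℕ.+ (1 ℕ.+ y))
    ≡⟨ identity₁ x y K N ⟩
  1 * (2 ℕ.+ x ℕ.+ y) ℕ.+ N * (3 ℕ.+ y ℕ.+ K)
    ≤⟨ ℕₚ.+-monoˡ-≤ _ (ℕₚ.*-monoˡ-≤ (2 ℕ.+ x ℕ.+ y) 1≤N) ⟩
  N * (2 ℕ.+ x ℕ.+ y) ℕ.+ N * (3 ℕ.+ y ℕ.+ K)
    ≡⟨ identity₂ x y K N ⟩
  N * (5 ℕ.+ x ℕ.+ (y ℕ.+ y) ℕ.+ K) ∎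
  where
  open ℕₚ.≤-Reasoning
  x = expCost lo
  y = expCost hi
  identity₁ : ∀ x y K N → 1 ℕ.+ x ℕ.+ (N * (1 ℕ.+ y ℕ.+ (K ℕ.+ 2)) ℕ.+ (1 ℕ.+ y)) ≡
    1 * (2 ℕ.+ x ℕ.+ y) ℕ.+ N * (3 ℕ.+ y ℕ.+ K)
  identity₁ = ℕ-Ring.solve-∀
  identity₂ : ∀ x y K N → N * (2 ℕ.+ x ℕ.+ y) ℕ.+ N * (3 ℕ.+ y ℕ.+ K) ≡
    N * (5 ℕ.+ x ℕ.+ (y ℕ.+ y) ℕ.+ K)
  identity₂ = ℕ-Ring.solve-∀

scanCost-bound : ∀ p₀ p₁ q₀ q₁ M N K → 1 ≤ M → 1 ≤ N →
  scanCost p₀ p₁ q₀ q₁ M N K ≤ (overhead p₀ p₁ ℕ.+ (overhead q₀ q₁ ℕ.+ K)) * (M * N)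
scanCost-bound p₀ p₁ q₀ q₁ M N K 1≤M 1≤N = begin
  scanCost p₀ p₁ q₀ q₁ M N K
    ≤⟨ forCost-const p₀ p₁ M (forCost q₀ q₁ N (λ _ → K)) 1≤M ⟩
  M * (x ℕ.+ forCost q₀ q₁ N (λ _ → K))
    ≤⟨ ℕₚ.*-monoʳ-≤ M (ℕₚ.+-mono-≤ (subst (ℕ._≤ N * x) (ℕₚ.*-identityˡ x) (ℕₚ.*-monoˡ-≤ x 1≤N))
         (forCost-const q₀ q₁ N K 1≤N)) ⟩
  M * (N * x ℕ.+ N * (y ℕ.+ K))
    ≡⟨ identity M N x (y ℕ.+ K) ⟩
  (x ℕ.+ (y ℕ.+ K)) * (M * N) ∎
  where
  open ℕₚ.≤-Reasoning
  x = overhead p₀ p₁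
  y = overhead q₀ q₁
  identity : ∀ M N x z → M * (N * x ℕ.+ N * z) ≡ (x ℕ.+ z) * (M * N)
  identity = ℕ-Ring.solve-∀

-- There are 2 r + 1 ≤ 3 r rounds, and 8 is the `overhead` of the two loop bounds.
lineLoopCost-bound : ∀ r k → 1 ≤ r → lineLoopCost r k ≤ (3 * (8 ℕ.+ k)) * r
lineLoopCost-bound r k 1≤r = begin
  lineLoopCost r k                     ≤⟨ forCost-const (negReachExp 0) (sucReachExp 0) (width₂ r) k (ℕ.s≤s ℕ.z≤n) ⟩
  (1 ℕ.+ (r ℕ.+ r)) * (8 ℕ.+ k)      ≤⟨ ℕₚ.*-monoˡ-≤ (8 ℕ.+ k) (ℕₚ.+-monoˡ-≤ (r ℕ.+ r) 1≤r) ⟩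
  (r ℕ.+ (r ℕ.+ r)) * (8 ℕ.+ k)      ≡⟨ identity r k ⟩
  (3 * (8 ℕ.+ k)) * r              ∎
  where
  open ℕₚ.≤-Reasoning
  identity : ∀ r k → (r ℕ.+ (r ℕ.+ r)) * (8 ℕ.+ k) ≡ (3 * (8 ℕ.+ k)) * r
  identity = ℕ-Ring.solve-∀

module _ {m n : ℕ} {v : ℕ → Point} {count : ℕ} (1≤m : 1 ≤ m) (1≤n : 1 ≤ n)
  (positive : ∀ k → k ℕ.< count → 1 ≤ reach m n (v k)) where

  private
    R′ : ℕ → ℕ
    R′ k = reach m n (v k)
    S T : ℕ
    S = sumFrom 0 count R′
    T = m * n

    1≤T : 1 ≤ T
    1≤T = ℕₚ.*-mono-≤ 1≤m 1≤n

  -- 48 = 3 (8 + 8) for subtracting and 42 = 3 (8 + 6) for dividing. The constant 10 is charged to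
  -- `R′ k`, and 48 is rounded up to the resulting 52. The added 3 is what the surrounding loop
  -- spends per round.
  eliminateCost-bound : ∀ i k → i ℕ.< count → k ℕ.< count →
    3 ℕ.+ eliminateCost {m} {n} {v} {count} i k ≤ 52 * (R′ i ℕ.+ R′ k)
  eliminateCost-bound i k i< k< = begin
    3 ℕ.+ (lineLoopCost (R′ i) 8 ℕ.+ (4 ℕ.+ (3 ℕ.+ lineLoopCost (R′ k) 6)))
      ≤⟨ ℕₚ.+-monoʳ-≤ 3 (ℕₚ.+-mono-≤ (lineLoopCost-bound (R′ i) 8 (positive i i<))
           (ℕₚ.+-monoʳ-≤ 7 (lineLoopCost-bound (R′ k) 6 (positive k k<)))) ⟩
    3 ℕ.+ (48 * R′ i ℕ.+ (7 ℕ.+ 42 * R′ k))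
      ≡⟨ identity₁ (R′ i) (R′ k) ⟩
    10 * 1 ℕ.+ (48 * R′ i ℕ.+ 42 * R′ k)
      ≤⟨ ℕₚ.+-mono-≤ (ℕₚ.*-monoʳ-≤ 10 (positive k k<)) (ℕₚ.+-monoˡ-≤ _ (ℕₚ.*-monoˡ-≤ (R′ i) {48} {52} (ℕₚ.≤ᵇ⇒≤ 48 52 _))) ⟩
    10 * R′ k ℕ.+ (52 * R′ i ℕ.+ 42 * R′ k)
      ≡⟨ identity₂ (R′ i) (R′ k) ⟩
    52 * (R′ i ℕ.+ R′ k) ∎
    where
    open ℕₚ.≤-Reasoning
    identity₁ : ∀ x y → 3 ℕ.+ (48 * x ℕ.+ (7 ℕ.+ 42 * y)) ≡ 10 * 1 ℕ.+ (48 * x ℕ.+ 42 * y)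
    identity₁ = ℕ-Ring.solve-∀
    identity₂ : ∀ x y → 10 * y ℕ.+ (52 * x ℕ.+ 42 * y) ≡ 52 * (x ℕ.+ y)
    identity₂ = ℕ-Ring.solve-∀

  -- 18 = 5 + 5 + 8 per point of the sweep and 16 for the constants. The last term bounds the sum of
  -- `R′ i` + `R′ k` over the later directions k.
  stageCost-bound : ∀ i → i ℕ.< count →
    3 ℕ.+ stageCost {m} {n} {v} {count} i ≤ 34 * T ℕ.+ 52 * (count * R′ i ℕ.+ S)
  stageCost-bound i i< = begin
    3 ℕ.+ (representCost {m} {n} {v} {count} ℕ.+ (2 ℕ.+ (sumFrom 0 N (λ u → 1 ℕ.+ (eliminateCost {m} {n} {v} {count} i (suc i ℕ.+ u) ℕ.+ 2)) ℕ.+ 1) ℕ.+ 10))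
      ≤⟨ ℕₚ.+-monoʳ-≤ 3 (ℕₚ.+-mono-≤ (scanCost-bound (var x₀-var) (var x₁-var) (var y₀-var) (var y₁-var) m n 8 1≤m 1≤n)
           (ℕₚ.+-monoˡ-≤ 10 (ℕₚ.+-monoʳ-≤ 2 (ℕₚ.+-monoˡ-≤ 1 (sumFrom-mono 0 N inner))))) ⟩
    3 ℕ.+ (18 * T ℕ.+ (2 ℕ.+ (sumFrom 0 N (λ u → 52 * (R′ i ℕ.+ R′ (suc i ℕ.+ u))) ℕ.+ 1) ℕ.+ 10))
      ≡⟨ cong (λ s → 3 ℕ.+ (18 * T ℕ.+ (2 ℕ.+ (s ℕ.+ 1) ℕ.+ 10))) (sumFrom-* 0 N 52 (λ u → R′ i ℕ.+ R′ (suc i ℕ.+ u))) ⟩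
    3 ℕ.+ (18 * T ℕ.+ (2 ℕ.+ (52 * sumFrom 0 N (λ u → R′ i ℕ.+ R′ (suc i ℕ.+ u)) ℕ.+ 1) ℕ.+ 10))
      ≡⟨ identity₁ T (52 * sumFrom 0 N (λ u → R′ i ℕ.+ R′ (suc i ℕ.+ u))) ⟩
    16 * 1 ℕ.+ 18 * T ℕ.+ 52 * sumFrom 0 N (λ u → R′ i ℕ.+ R′ (suc i ℕ.+ u))
      ≤⟨ ℕₚ.+-mono-≤ (ℕₚ.+-monoˡ-≤ (18 * T) (ℕₚ.*-monoʳ-≤ 16 1≤T)) (ℕₚ.*-monoʳ-≤ 52 total) ⟩
    16 * T ℕ.+ 18 * T ℕ.+ 52 * (count * R′ i ℕ.+ S)
      ≡⟨ cong (ℕ._+ 52 * (count * R′ i ℕ.+ S)) (ℕₚ.*-distribʳ-+ T 16 18) ⟨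
    34 * T ℕ.+ 52 * (count * R′ i ℕ.+ S) ∎
    where
    open ℕₚ.≤-Reasoning
    N = count ℕ.∸ suc i
    end : suc i ℕ.+ N ≡ count
    end = ℕₚ.m+[n∸m]≡n i<
    identity₁ : ∀ t s → 3 ℕ.+ (18 * t ℕ.+ (2 ℕ.+ (s ℕ.+ 1) ℕ.+ 10)) ≡ 16 * 1 ℕ.+ 18 * t ℕ.+ s
    identity₁ = ℕ-Ring.solve-∀
    rotate : ∀ x → 1 ℕ.+ (x ℕ.+ 2) ≡ 3 ℕ.+ x
    rotate = ℕ-Ring.solve-∀
    inner : ∀ u → 0 ≤ u → u ℕ.< N → 1 ℕ.+ (eliminateCost {m} {n} {v} {count} i (suc i ℕ.+ u) ℕ.+ 2) ≤
      52 * (R′ i ℕ.+ R′ (suc i ℕ.+ u))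
    inner u _ u<N = ℕₚ.≤-trans (ℕₚ.≤-reflexive (rotate (eliminateCost {m} {n} {v} {count} i (suc i ℕ.+ u))))
      (eliminateCost-bound i (suc i ℕ.+ u) i< (subst (suc i ℕ.+ u ℕ.<_) end (ℕₚ.+-monoʳ-< (suc i) u<N)))
    total : sumFrom 0 N (λ u → R′ i ℕ.+ R′ (suc i ℕ.+ u)) ≤ count * R′ i ℕ.+ S
    total = begin
      sumFrom 0 N (λ u → R′ i ℕ.+ R′ (suc i ℕ.+ u))
        ≡⟨ sumFrom-+ 0 N (λ _ → R′ i) (λ u → R′ (suc i ℕ.+ u)) ⟩
      sumFrom 0 N (λ _ → R′ i) ℕ.+ sumFrom 0 N (λ u → R′ (suc i ℕ.+ u))
        ≡⟨ cong₂ ℕ._+_ (sumFrom-const 0 N (R′ i)) (trans (sumFrom-shift (suc i) 0 N R′)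
             (cong (λ j → sumFrom j N R′) (ℕₚ.+-identityʳ (suc i)))) ⟩
      N * R′ i ℕ.+ sumFrom (suc i) N R′
        ≤⟨ ℕₚ.+-mono-≤ (ℕₚ.*-monoˡ-≤ (R′ i) (ℕₚ.m∸n≤m count (suc i)))
             (subst (λ l → sumFrom (suc i) N R′ ≤ sumFrom 0 l R′) end (sumFrom-suffix (suc i) N R′)) ⟩
      count * R′ i ℕ.+ S ∎

  -- Summed over i, the terms `count * R′ i` and S each give `count * S`, whence 104 = 2 · 52. With
  -- S of order m n this is the decisive contribution to the running time.
  forwardCost-bound : forCost (lit 0ℤ) (var 25) count (stageCost {m} {n} {v} {count}) ≤
    2 ℕ.+ (count * (34 * T) ℕ.+ 104 * (count * S))
  forwardCost-bound = begin
    1 ℕ.+ (sumFrom 0 count (λ i → 1 ℕ.+ (stageCost {m} {n} {v} {count} i ℕ.+ 2)) ℕ.+ 1)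
      ≤⟨ ℕₚ.+-monoʳ-≤ 1 (ℕₚ.+-monoˡ-≤ 1 (sumFrom-mono 0 count λ i _ i< →
           ℕₚ.≤-trans (ℕₚ.≤-reflexive (rotate (stageCost {m} {n} {v} {count} i))) (stageCost-bound i i<))) ⟩
    1 ℕ.+ (sumFrom 0 count (λ i → 34 * T ℕ.+ 52 * (count * R′ i ℕ.+ S)) ℕ.+ 1)
      ≡⟨ cong (λ s → 1 ℕ.+ (s ℕ.+ 1)) split ⟩
    1 ℕ.+ (count * (34 * T) ℕ.+ 52 * (count * S ℕ.+ count * S) ℕ.+ 1)
      ≡⟨ identity (count * (34 * T)) (count * S) ⟩
    2 ℕ.+ (count * (34 * T) ℕ.+ 104 * (count * S)) ∎
    where
    open ℕₚ.≤-Reasoning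
    rotate : ∀ x → 1 ℕ.+ (x ℕ.+ 2) ≡ 3 ℕ.+ x
    rotate = ℕ-Ring.solve-∀
    identity : ∀ x y → 1 ℕ.+ (x ℕ.+ 52 * (y ℕ.+ y) ℕ.+ 1) ≡ 2 ℕ.+ (x ℕ.+ 104 * y)
    identity = ℕ-Ring.solve-∀
    split : sumFrom 0 count (λ i → 34 * T ℕ.+ 52 * (count * R′ i ℕ.+ S)) ≡
      count * (34 * T) ℕ.+ 52 * (count * S ℕ.+ count * S)
    split = trans (sumFrom-+ 0 count (λ _ → 34 * T) (λ i → 52 * (count * R′ i ℕ.+ S)))
      (cong₂ ℕ._+_ (sumFrom-const 0 count (34 * T))
        (trans (sumFrom-* 0 count 52 (λ i → count * R′ i ℕ.+ S))
          (cong (52 ℕ.*_) (trans (sumFrom-+ 0 count (λ i → count * R′ i) (λ _ → S))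
            (cong₂ ℕ._+_ (sumFrom-* 0 count count R′) (sumFrom-const 0 count S))))))

  -- 11 = 5 + 5 + 1 for the copy, 14 = 5 + 5 + 4 for the difference, 30 = 3 (8 + 2) for putting r
  -- back, and 6 for the constants. Bounding `R′ i` by S is crude but no worse than the forward
  -- pass.
  backwardCost-bound : ∀ f₀ d →
    forCost (lit 0ℤ) (var 25) count (λ u → backCost {m} {n} {v} {count} f₀ d (count ℕ.∸ suc u)) ≤
      2 ℕ.+ count * (31 * T ℕ.+ 30 * S)
  backwardCost-bound f₀ d = begin
    1 ℕ.+ (sumFrom 0 count (λ u → 1 ℕ.+ (backCost {m} {n} {v} {count} f₀ d (count ℕ.∸ suc u) ℕ.+ 2)) ℕ.+ 1)
      ≤⟨ ℕₚ.+-monoʳ-≤ 1 (ℕₚ.+-monoˡ-≤ 1 (sumFrom-bound 0 count (31 * T ℕ.+ 30 * S) bound)) ⟩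
    1 ℕ.+ (count * (31 * T ℕ.+ 30 * S) ℕ.+ 1)
      ≡⟨ cong (1 ℕ.+_) (ℕₚ.+-comm _ 1) ⟩
    2 ℕ.+ count * (31 * T ℕ.+ 30 * S) ∎
    where
    open ℕₚ.≤-Reasoning
    identity : ∀ t s → 1 ℕ.+ (3 ℕ.+ (11 * t ℕ.+ (14 * t ℕ.+ s)) ℕ.+ 2) ≡ 6 * 1 ℕ.+ (25 * t ℕ.+ s)
    identity = ℕ-Ring.solve-∀
    identity₂ : ∀ t s → 6 * t ℕ.+ (25 * t ℕ.+ s) ≡ 31 * t ℕ.+ s
    identity₂ = ℕ-Ring.solve-∀
    bound : ∀ u → 0 ≤ u → u ℕ.< count →
      1 ℕ.+ (backCost {m} {n} {v} {count} f₀ d (count ℕ.∸ suc u) ℕ.+ 2) ≤ 31 * T ℕ.+ 30 * S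
    bound u _ u<count = begin
      1 ℕ.+ (backCost {m} {n} {v} {count} f₀ d i ℕ.+ 2)
        ≤⟨ ℕₚ.+-monoʳ-≤ 1 (ℕₚ.+-monoˡ-≤ 2 (ℕₚ.+-monoʳ-≤ 3 (ℕₚ.+-mono-≤
             (scanCost-bound (lit 0ℤ) (var 0) (lit 0ℤ) (var 1) m n 1 1≤m 1≤n)
             (ℕₚ.+-mono-≤ (scanCost-bound (lit 0ℤ) (var 0) (lit 0ℤ) (var 1) m n 4 1≤m 1≤n)
               (lineLoopCost-bound (R′ i) 2 (positive i i<)))))) ⟩
      1 ℕ.+ (3 ℕ.+ (11 * T ℕ.+ (14 * T ℕ.+ 30 * R′ i)) ℕ.+ 2)
        ≡⟨ identity T (30 * R′ i) ⟩
      6 * 1 ℕ.+ (25 * T ℕ.+ 30 * R′ i)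
        ≤⟨ ℕₚ.+-mono-≤ (ℕₚ.*-monoʳ-≤ 6 1≤T) (ℕₚ.+-monoʳ-≤ (25 * T) (ℕₚ.*-monoʳ-≤ 30 (term≤sumFrom count i R′ i<))) ⟩
      6 * T ℕ.+ (25 * T ℕ.+ 30 * S)
        ≡⟨ identity₂ T (30 * S) ⟩
      31 * T ℕ.+ 30 * S ∎
      where
      i = count ℕ.∸ suc u
      i< : i ℕ.< count
      i< = subst (ℕ._≤ count) (ℕₚ.+-∸-assoc 1 u<count) (ℕₚ.m∸n≤m count u)

-- Lets constant costs be charged to the reach. The zero vector is not primitive, as 2 divides both
-- coordinates.
primitive-reach : ∀ m n v → 1 ≤ m → 1 ≤ n → Primitive v → 1 ≤ reach m n v
primitive-reach m n (+ 0 , + 0) 1≤m 1≤n prim with prim {2} (2 ∣0 , 2 ∣0)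
... | ()
primitive-reach m n (+ suc x , β) 1≤m 1≤n prim =
  ℕₚ.≤-trans (ℕₚ.*-mono-≤ (ℕ.s≤s (ℕ.z≤n {x})) 1≤n) (ℕₚ.m≤m+n _ _)
primitive-reach m n (-[1+ x ] , β) 1≤m 1≤n prim =
  ℕₚ.≤-trans (ℕₚ.*-mono-≤ (ℕ.s≤s (ℕ.z≤n {x})) 1≤n) (ℕₚ.m≤m+n _ _)
primitive-reach m n (+ 0 , + suc x) 1≤m 1≤n prim = ℕₚ.*-mono-≤ (ℕ.s≤s (ℕ.z≤n {x})) 1≤m
primitive-reach m n (+ 0 , -[1+ x ]) 1≤m 1≤n prim = ℕₚ.*-mono-≤ (ℕ.s≤s (ℕ.z≤n {x})) 1≤m

-- The complete program

directExp : Exp real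
directExp = 0 [ var bad-var , lineExp (var bad-var) (var p-var) (var q-var) ]

set-box solve-all direct reconstruct : Program
direct = fill 1 (lit 0ℤ) (var 0) (lit 0ℤ) (var 1) directExp
set-box = x₀-var ≔ lit 0ℤ ⨾ x₁-var ≔ var 0 ⨾ y₀-var ≔ lit 0ℤ ⨾ y₁-var ≔ var 1
solve-all = clear-output ⨾ clear-buffer ⨾ set-box ⨾ forward ⨾ backward
reconstruct = survey ⨾ cond (var bad-var ≺ lit 0ℤ) solve-all direct

module _ {m n : ℕ} {v : ℕ → Point} {count : ℕ} (d : ℕ) where

  private
    C : Store → Set
    C = Const m n v count
    G : Box
    G = grid {m} {n}
    halo : Box
    halo = (0ℤ ℤ.- + m , + m ℤ.+ + m) , (0ℤ ℤ.- + n , + n ℤ.+ + n)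
    W : ℕ → Box
    W = window {m} {n} {v} {count}

  private
    thrice : ∀ l → + l ℤ.+ + l ℤ.≤ 0ℤ ℤ.- + l ℤ.+ + (l ℕ.+ l ℕ.+ l)
    thrice l = ℤₚ.≤-reflexive (identity (+ l))
      where
      identity : ∀ i → i ℤ.+ i ≡ 0ℤ ℤ.- i ℤ.+ (i ℤ.+ i ℤ.+ i)
      identity = solve-∀

  clear-output-rule : ∀ σ → C σ →
    Run clear-output σ (fillCost 1 (lit 0ℤ) (var 0) (lit 0ℤ) (var 1) (toReal (lit 0ℤ)) m n)
      (λ τ → ∀ P → InBox G P → τ real 1 (proj₁ P) (proj₂ P) ≃ 𝟘)
  clear-output-rule σ Cσ = run-map (λ _ → proj₂)
    (fill-rule 1 _ _ _ _ (toReal (lit 0ℤ)) σ m n (λ _ → 𝟘) refl ℤₚ.≤-refl ℤₚ.≤-refl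
      (λ τ fr → trans (fr int 0 refl 0ℤ 0ℤ) (width-is Cσ)) (λ _ _ → refl)
      (λ τ fr → trans (fr int 1 refl 0ℤ 0ℤ) (height-is Cσ))
      (λ _ _ _ _ _ _ _ → ≡⇒≃ fromℤ0≡𝟘))

  clearBufferCost : ℕ
  clearBufferCost = fillCost 2 (op sub (lit 0ℤ) (var 0)) (op add (var 0) (var 0))
    (op sub (lit 0ℤ) (var 1)) (op add (var 1) (var 1)) (toReal (lit 0ℤ)) (m ℕ.+ m ℕ.+ m) (n ℕ.+ n ℕ.+ n)

  clear-buffer-rule : ∀ σ → C σ → Run clear-buffer σ clearBufferCost
    (λ τ → ∀ P → InBox halo P → τ real 2 (proj₁ P) (proj₂ P) ≃ 𝟘)
  clear-buffer-rule σ Cσ = run-map (λ _ → proj₂)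
    (fill-rule 2 _ _ _ _ (toReal (lit 0ℤ)) σ (m ℕ.+ m ℕ.+ m) (n ℕ.+ n ℕ.+ n) (λ _ → 𝟘)
      (cong (λ i → 0ℤ ℤ.- i) (width-is Cσ)) (thrice m) (thrice n)
      (λ τ fr → cong₂ ℤ._+_ (m≡ τ fr) (m≡ τ fr))
      (λ τ fr → cong (λ i → 0ℤ ℤ.- i) (n≡ τ fr))
      (λ τ fr → cong₂ ℤ._+_ (n≡ τ fr) (n≡ τ fr))
      (λ _ _ _ _ _ _ _ → ≡⇒≃ fromℤ0≡𝟘))
    where
    m≡ : ∀ τ → Frame clear-buffer σ τ → value τ 0 ≡ + m
    m≡ τ fr = trans (fr int 0 refl 0ℤ 0ℤ) (width-is Cσ)
    n≡ : ∀ τ → Frame clear-buffer σ τ → value τ 1 ≡ + n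
    n≡ τ fr = trans (fr int 1 refl 0ℤ 0ℤ) (height-is Cσ)

  set-box-rule : ∀ σ → C σ → Run set-box σ 4 (λ τ → boxOf τ ≡ G)
  set-box-rule σ Cσ = assign-then refl refl refl (assign-then refl refl (width-is Cσ)
    (assign-then refl refl refl (run-assign refl refl (height-is Cσ) refl)))

  solveAllCost : Formal → ℕ
  solveAllCost f₀ =
    fillCost 1 (lit 0ℤ) (var 0) (lit 0ℤ) (var 1) (toReal (lit 0ℤ)) m n ℕ.+ (clearBufferCost ℕ.+ (4 ℕ.+
      (forCost (lit 0ℤ) (var 25) count (stageCost {m} {n} {v} {count}) ℕ.+
        forCost (lit 0ℤ) (var 25) count (λ u → backCost {m} {n} {v} {count} f₀ d (count ℕ.∸ suc u)))))

  -- After the forward pass 0 has the line sums of the remaining function in the directions from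
  -- `count` to d: either there are none, or the window is empty and so is the formal sum. Hence the
  -- backward pass may start from 0.
  solve-all-rule : ∀ σ f₀ → C σ → Supported G f₀ →
    (∀ k → k ℕ.< count → Primitive (v k)) →
    (∀ k → k ℕ.< count → Small {m} {n} {v} {count} f₀ d (v k)) →
    (∀ i k → i ℕ.< count → k ℕ.< count → k ≢ i → line (v k) (v i) ≢ 0ℤ) →
    (∀ k c → k ℕ.< count → σ real 0 (+ k) c ≃ lineTotal (v k) c f₀) →
    (count ≡ d ⊎ (∀ P → ¬ InBox (W count) P)) →
    Run solve-all σ (solveAllCost f₀) (λ τ → ∃[ g ] (Supported G g ×
      (∀ P → InBox G P → τ real 1 (proj₁ P) (proj₂ P) ≃ ⟦ g ⟧ (at P)) ×
      (∀ k c → k ℕ.< d → lineTotal (v k) c g ≃ lineTotal (v k) c f₀)))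
  solve-all-rule σ f₀ Cσ f₀∈ prim small det rows exhausted =
    framed (clear-output-rule σ Cσ) then λ σ₁ (fr₁ , out₁) →
    let C₁ = Const-frame clear-output refl refl refl refl refl refl fr₁ Cσ in
    framed (clear-buffer-rule σ₁ C₁) then λ σ₂ (fr₂ , buf₂) →
    let C₂ = Const-frame clear-buffer refl refl refl refl refl refl fr₂ C₁ in
    framed (set-box-rule σ₂ C₂) then λ σ₃ (fr₃ , box₃) →
    let C₃ = Const-frame set-box refl refl refl refl refl refl fr₃ C₂ in
    framed (forward-rule σ₃ f₀ C₃ prim det (f₀ , start f₀∈ , box₃ , λ k c _ k< → ≃-trans
      (≡⇒≃ (trans (fr₃ real 0 refl (+ k) c) (trans (fr₂ real 0 refl (+ k) c) (fr₁ real 0 refl (+ k) c))))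
      (rows k c k<))) then λ { σ₄ (fr₄ , f , H , _ , _) →
    let C₄ = Const-frame forward refl refl refl refl refl refl fr₄ C₃ in
    run-map (λ τ → finish τ)
      (backward-rule f₀ d σ₄ C₄ small (f , [] , H , [] ,
        (λ P P∈ → ≃-trans (≡⇒≃ (trans (fr₄ real 1 refl _ _) (trans (fr₃ real 1 refl _ _) (fr₂ real 1 refl _ _))))
          (out₁ P P∈)) ,
        (λ P P∈halo _ → ≃-trans (≡⇒≃ (trans (fr₄ real 2 refl _ _) (fr₃ real 2 refl _ _))) (buf₂ P P∈halo)) ,
        λ k c count≤k k<d → ≃-sym (vanishing f (history-supported H) exhausted k c count≤k k<d))) }
    where
    vanishing : ∀ f → Supported (W count) f → count ≡ d ⊎ (∀ P → ¬ InBox (W count) P) →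
      ∀ k c → count ≤ k → k ℕ.< d → lineTotal (v k) c f ≃ 𝟘
    vanishing f f∈ (inj₁ refl) k c count≤k k<d = contradiction k<d (ℕₚ.≤⇒≯ count≤k)
    vanishing [] [] (inj₂ _) k c _ _ = ≃-refl
    vanishing ((P , _) ∷ _) (P∈ ∷ _) (inj₂ empty) k c _ _ = contradiction P∈ (empty P)
    finish : ∀ τ → Backward {m} {n} {v} {count} f₀ d 0 τ → ∃[ g ] (Supported G g ×
      (∀ P → InBox G P → τ real 1 (proj₁ P) (proj₂ P) ≃ ⟦ g ⟧ (at P)) ×
      (∀ k c → k ℕ.< d → lineTotal (v k) c g ≃ lineTotal (v k) c f₀))
    finish τ (_ , g , start _ , g∈ , out , _ , totals) = g , g∈ , out , λ k c → totals k c ℕ.z≤n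

  directCost : ℕ
  directCost = fillCost 1 (lit 0ℤ) (var 0) (lit 0ℤ) (var 1) directExp m n

  direct-rule : ∀ σ k → C σ → value σ bad-var ≡ + k → Run direct σ directCost
    (λ τ → ∀ P → InBox G P → τ real 1 (proj₁ P) (proj₂ P) ≃ σ real 0 (+ k) (line (v k) P))
  direct-rule σ k Cσ k≡ = run-map (λ _ → proj₂)
    (fill-rule 1 _ _ _ _ directExp σ m n (λ P → σ real 0 (+ k) (line (v k) P)) refl ℤₚ.≤-refl ℤₚ.≤-refl
      (λ τ fr → trans (fr int 0 refl 0ℤ 0ℤ) (width-is Cσ)) (λ _ _ → refl)
      (λ τ fr → trans (fr int 1 refl 0ℤ 0ℤ) (height-is Cσ))
      (λ τ p q fr p≡ q≡ _ → ≡⇒≃ (trans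
        (cong₂ (τ real 0) (trans (fr int bad-var refl 0ℤ 0ℤ) k≡)
          (eval-line {h = var bad-var} {p = var p-var} {q = var q-var}
            (Const-frame direct refl refl refl refl refl refl fr Cσ) (trans (fr int bad-var refl 0ℤ 0ℤ) k≡) p≡ q≡))
        (fr real 0 refl (+ k) (line (v k) (p , q))))))

  private
    -- An equation between sums, because the length can become negative: every direction takes
    -- exactly |α| off it.
    shrink-width : ∀ α s l I → proj₂ I ℤ.+ + s ≡ proj₁ I ℤ.+ + l →
      proj₂ (shrink α I) ℤ.+ + (s ℕ.+ ℤ.∣ α ∣) ≡ proj₁ (shrink α I) ℤ.+ + l
    shrink-width α@(+ k) s l (lo , hi) eq = trans (identity hi (+ s) α) eq
      where
      identity : ∀ hi s α → hi ℤ.- α ℤ.+ (s ℤ.+ α) ≡ hi ℤ.+ s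
      identity = solve-∀
    shrink-width -[1+ k ] s l (lo , hi) eq = trans (identity₁ hi (+ s) (+ suc k))
      (trans (cong (λ i → i ℤ.+ + suc k) eq) (identity₂ lo (+ l) (+ suc k)))
      where
      identity₁ : ∀ hi s k → hi ℤ.+ (s ℤ.+ k) ≡ hi ℤ.+ s ℤ.+ k
      identity₁ = solve-∀
      identity₂ : ∀ lo l k → lo ℤ.+ l ℤ.+ k ≡ lo ℤ.- (ℤ.- k) ℤ.+ l
      identity₂ = solve-∀

    empty : ∀ s l I → proj₂ I ℤ.+ + s ≡ proj₁ I ℤ.+ + l → l ≤ s → ∀ x → ¬ InInterval I x
    empty s l (lo , hi) eq l≤s x (lo≤x , x<hi) = ℤₚ.<-irrefl refl
      (ℤₚ.<-≤-trans x<hi (ℤₚ.≤-trans (linear₁ (ℤ.+≤+ l≤s)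
        (trans (identity₁ (+ s) (+ l) lo) (trans (cong (λ i → lo ℤ.+ + s ℤ.- i) (sym eq)) (identity₂ lo hi (+ s))))) lo≤x))
      where
      identity₁ : ∀ s l lo → s ℤ.- l ≡ lo ℤ.+ s ℤ.- (lo ℤ.+ l)
      identity₁ = solve-∀
      identity₂ : ∀ lo hi s → lo ℤ.+ s ℤ.- (hi ℤ.+ s) ≡ lo ℤ.- hi
      identity₂ = solve-∀

  window-width : ∀ i → proj₂ (proj₁ (W i)) ℤ.+ + a-sum {m} {n} {v} d i ≡ proj₁ (proj₁ (W i)) ℤ.+ + m
  window-width zero    = ℤₚ.+-comm (+ m) 0ℤ
  window-width (suc i) = shrink-width (proj₁ (v i)) (a-sum {m} {n} {v} d i) m (proj₁ (W i)) (window-width i)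

  window-height : ∀ i → proj₂ (proj₂ (W i)) ℤ.+ + b-sum {m} {n} {v} d i ≡ proj₁ (proj₂ (W i)) ℤ.+ + n
  window-height zero    = ℤₚ.+-comm (+ n) 0ℤ
  window-height (suc i) = shrink-width (proj₂ (v i)) (b-sum {m} {n} {v} d i) n (proj₂ (W i)) (window-height i)

  saturated⇒empty : ∀ i → Saturated {m} {n} {v} d i → ∀ P → ¬ InBox (W i) P
  saturated⇒empty i (inj₁ m≤) (p , q) (p∈ , _) = empty _ m (proj₁ (W i)) (window-width i) m≤ p p∈
  saturated⇒empty i (inj₂ n≤) (p , q) (_ , q∈) = empty _ n (proj₂ (W i)) (window-height i) n≤ q q∈

-- Directions too long for the grid

module _ {m n : ℕ} (v : Point) (prim : Primitive v) (big : ¬ (ℤ.∣ proj₁ v ∣ ℕ.< m × ℤ.∣ proj₂ v ∣ ℕ.< n)) where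

  private
    G : Box
    G = grid {m} {n}

    gap : ∀ l x y k α → InInterval (0ℤ , + l) x → InInterval (0ℤ , + l) y → y ≡ x ℤ.+ k ℤ.* α → ℤ.∣ k ∣ * ℤ.∣ α ∣ ℕ.< l
    gap l (+ x) (+ y) k α (_ , ℤ.+<+ x<l) (_ , ℤ.+<+ y<l) eq = begin-strict
      ℤ.∣ k ∣ * ℤ.∣ α ∣     ≡⟨ ℤₚ.abs-* k α ⟨
      ℤ.∣ k ℤ.* α ∣           ≡⟨ cong ℤ.∣_∣ (trans (identity (+ x) (k ℤ.* α)) (cong (ℤ._- + x) (sym eq))) ⟩
      ℤ.∣ + y ℤ.- + x ∣       ≡⟨ cong ℤ.∣_∣ (ℤₚ.[+m]-[+n]≡m⊖n y x) ⟩
      ℤ.∣ y ℤ.⊖ x ∣           ≤⟨ ℤₚ.∣m⊝n∣≤m⊔n y x ⟩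
      y ℕ.⊔ x                 <⟨ ℕₚ.⊔-pres-<m y<l x<l ⟩
      l                       ∎
      where
      open ℕₚ.≤-Reasoning
      identity : ∀ x z → z ≡ x ℤ.+ z ℤ.- x
      identity = solve-∀

    none : ∀ k → ℤ.∣ k ∣ * ℤ.∣ proj₁ v ∣ ℕ.< m → ℤ.∣ k ∣ * ℤ.∣ proj₂ v ∣ ℕ.< n → k ≡ 0ℤ
    none k a< b< with ℤ.∣ k ∣ in eq
    ... | zero  = ℤₚ.∣i∣≡0⇒i≡0 eq
    -- For k ≠ 0 the coordinates of k v are at least those of v in absolute value, so v itself would
    -- fit into the grid.
    ... | suc j = contradiction
      (ℕₚ.≤-<-trans (ℕₚ.m≤m+n _ (j * ℤ.∣ proj₁ v ∣)) a< , ℕₚ.≤-<-trans (ℕₚ.m≤m+n _ (j * ℤ.∣ proj₂ v ∣)) b<) big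

    same-point : ∀ P Q → InBox G P → InBox G Q → ∃[ k ] Q ≡ P +ᵖ k *ᵖ v → Q ≡ P
    same-point P Q (p∈ , q∈) (p′∈ , q′∈) (k , Q≡) = trans Q≡ (trans (cong (λ k → P +ᵖ k *ᵖ v) k≡0) (*ᵖ-zero v G P))
      where
      k≡0 : k ≡ 0ℤ
      k≡0 = none k (gap m (proj₁ P) (proj₁ Q) k (proj₁ v) p∈ p′∈ (cong proj₁ Q≡))
        (gap n (proj₂ P) (proj₂ Q) k (proj₂ v) q∈ q′∈ (cong proj₂ Q≡))

  single-point : ∀ P Q → InBox G P → InBox G Q → line v P ≡ line v Q → Q ≡ P
  single-point P Q P∈ Q∈ same = same-point P Q P∈ Q∈ (collinear⇒shift v P Q prim same)

  lineTotal-single : (T : Table m n) → ∀ p q →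
    tableSum (onLine v (line v (position p q))) T ≃ T p q
  lineTotal-single T p q = ≃-trans
    (tableSum-single (onLine v (line v P)) T p q λ p′ q′ ≢ → ≡⇒≃ (cong (λ b → gate b (T p′ q′))
      (dec-false (line v (position p′ q′) ℤ.≟ line v P) λ same →
        ≢ (position-injective (single-point P (position p′ q′) (position∈grid p q) (position∈grid p′ q′) (sym same))))))
    (≡⇒≃ (cong (λ b → gate b (T p q)) (dec-true (line v P ℤ.≟ line v P) refl)))
    where
    P = position p q

-- Uniqueness outside the switching domains

module _ {m n d : ℕ} (D : DirectionSet d) (g f : Table m n) where

  private
    F : Table m n
    F p q = g p q ⊝ f p q

  difference-switching : SameLineSums D g f → Switching D F
  difference-switching same h c = ⌊ ≃-trans (lineSum≃tableSum (D h) c F)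
    (≃-trans (AbelianGroupProperties.identityˡ-unique ℝ-abelianGroup (tableSum χ F) (tableSum χ f) absorbed) (≡⇒≃ (sym 0ᴿ≡𝟘))) ⌋
    where
    χ = onLine (vec (D h)) c
    absorbed : tableSum χ F ⊕ tableSum χ f ≃ tableSum χ f
    absorbed = ≃-trans (≃-sym (tableSum-⊕ χ F f)) (≃-trans
      (tableSum-cong χ λ p q → ≃-trans (⊕-assoc (g p q) (⊖ f p q) (f p q))
        (≃-trans (⊕-cong ≃-refl (⊖-inverseˡ (f p q))) (⊕-identityʳ (g p q))))
      (≃-trans (≃-sym (lineSum≃tableSum (D h) c g)) (≃-trans ⌈ same h c ⌉ (lineSum≃tableSum (D h) c f))))

  -- Lying in no switching domain says only that F is not different from 0 at the point; stability
  -- of real equality removes the double negation.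
  determined : SameLineSums D g f → ∀ p q → ¬ InSomeSwitchingDomain D p q → g p q ≈ᴿ f p q
  determined same p q outside = ⌊ AbelianGroupProperties.x∙y⁻¹≈ε⇒x≈y ℝ-abelianGroup (g p q) (f p q) (≃-trans
    ⌈ ≈ᴿ-stable (F p q) 0ᴿ (λ F≉0 → outside (F , difference-switching same , F≉0)) ⌉ (≡⇒≃ 0ᴿ≡𝟘)) ⌋

-- The total number of lines and the final constant

module _ {m n : ℕ} {v : ℕ → Point} (d : ℕ) where

  private
    R′ : ℕ → ℕ
    R′ k = reach m n (v k)

  reach-total : ∀ c → sumFrom 0 c R′ ≡ a-sum {m} {n} {v} d c * n ℕ.+ b-sum {m} {n} {v} d c * m
  reach-total zero    = refl
  reach-total (suc c) = trans (sumFrom-last c R′) (trans (cong (ℕ._+ R′ c) (reach-total c))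
    (identity (a-sum {m} {n} {v} d c) (b-sum {m} {n} {v} d c) ℤ.∣ proj₁ (v c) ∣ ℤ.∣ proj₂ (v c) ∣ m n))
    where
    identity : ∀ a b x y m n → a * n ℕ.+ b * m ℕ.+ (x * n ℕ.+ y * m) ≡ (a ℕ.+ x) * n ℕ.+ (b ℕ.+ y) * m
    identity = ℕ-Ring.solve-∀

  -- Before the last counted direction Σ|a| < m and Σ|b| < n, and that direction adds less than m
  -- and n once more. So the sums stay below 2 m and 2 n, and 2 m n + 2 n m = 4 m n.
  reach-total-bound : ∀ c → (∀ k → k ℕ.< c → a-sum {m} {n} {v} d k ℕ.< m × b-sum {m} {n} {v} d k ℕ.< n) →
    (∀ k → k ℕ.< c → ℤ.∣ proj₁ (v k) ∣ ℕ.< m × ℤ.∣ proj₂ (v k) ∣ ℕ.< n) →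
    sumFrom 0 c R′ ≤ 4 * (m * n)
  reach-total-bound zero    unfilled small = ℕ.z≤n
  reach-total-bound (suc c) unfilled small = begin
    sumFrom 0 (suc c) R′
      ≡⟨ reach-total (suc c) ⟩
    a-sum {m} {n} {v} d (suc c) * n ℕ.+ b-sum {m} {n} {v} d (suc c) * m
      ≤⟨ ℕₚ.+-mono-≤
           (ℕₚ.*-monoˡ-≤ n (ℕₚ.<⇒≤ (ℕₚ.+-mono-< (proj₁ (unfilled c ℕₚ.≤-refl)) (proj₁ (small c ℕₚ.≤-refl)))))
           (ℕₚ.*-monoˡ-≤ m (ℕₚ.<⇒≤ (ℕₚ.+-mono-< (proj₂ (unfilled c ℕₚ.≤-refl)) (proj₂ (small c ℕₚ.≤-refl))))) ⟩
    (m ℕ.+ m) * n ℕ.+ (n ℕ.+ n) * m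
      ≡⟨ identity m n ⟩
    4 * (m * n) ∎
    where
    open ℕₚ.≤-Reasoning
    identity : ∀ m n → (m ℕ.+ m) * n ℕ.+ (n ℕ.+ n) * m ≡ 4 * (m * n)
    identity = ℕ-Ring.solve-∀

surveyCost : ℕ → ℕ
surveyCost d = 4 ℕ.+ forCost (lit 0ℤ) (var 2) d (λ _ → 24)

module _ {m n d : ℕ} (1≤m : 1 ≤ m) (1≤n : 1 ≤ n) (1≤d : 1 ≤ d) where

  private
    T V : ℕ
    T = m * n
    V = d * T

    1≤T : 1 ≤ T
    1≤T = ℕₚ.*-mono-≤ 1≤m 1≤n

    d≤V : d ≤ V
    d≤V = subst (ℕ._≤ V) (ℕₚ.*-identityʳ d) (ℕₚ.*-monoʳ-≤ d 1≤T)

    T≤V : T ≤ V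
    T≤V = subst (ℕ._≤ V) (ℕₚ.*-identityˡ T) (ℕₚ.*-monoˡ-≤ T 1≤d)

    scaled : ∀ c → c ≤ c * V
    scaled c = subst (ℕ._≤ c * V) (ℕₚ.*-identityʳ c) (ℕₚ.*-monoʳ-≤ c (ℕₚ.≤-trans 1≤d d≤V))

  surveyCost-bound : surveyCost d ≤ 33 * V
  surveyCost-bound = begin
    4 ℕ.+ forCost (lit 0ℤ) (var 2) d (λ _ → 24) ≤⟨ ℕₚ.+-mono-≤ (scaled 4) (forCost-const (lit 0ℤ) (var 2) d 24 1≤d) ⟩
    4 * V ℕ.+ d * 29                        ≤⟨ ℕₚ.+-monoʳ-≤ (4 * V) (ℕₚ.*-monoˡ-≤ 29 d≤V) ⟩
    4 * V ℕ.+ V * 29                        ≡⟨ identity V ⟩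
    33 * V                                    ∎
    where
    open ℕₚ.≤-Reasoning
    identity : ∀ V → 4 * V ℕ.+ V * 29 ≡ 33 * V
    identity = ℕ-Ring.solve-∀

  directCost-bound : ∀ {v count} → directCost {m} {n} {v} {count} d ≤ 14 * V
  directCost-bound = ℕₚ.≤-trans (scanCost-bound (lit 0ℤ) (var 0) (lit 0ℤ) (var 1) m n 4 1≤m 1≤n) (ℕₚ.*-monoʳ-≤ 14 T≤V)

  -- 164 = 11 + 17 · 9, where 9 accounts for the margin that triples both sides of the grid; 65 = 34
  -- + 31 and 134 = 104 + 30 join the two passes. With S ≤ 4 m n this gives 8 + 164 + 65 + 4 · 134 =
  -- 773.
  solveAllCost-bound : ∀ {v count} f₀ → count ≤ d → (∀ k → k ℕ.< count → 1 ≤ reach m n (v k)) →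
    sumFrom 0 count (λ k → reach m n (v k)) ≤ 4 * T →
    solveAllCost {m} {n} {v} {count} d f₀ ≤ 773 * V
  solveAllCost-bound {v} {count} f₀ count≤d positive S≤4T = begin
    solveAllCost {m} {n} {v} {count} d f₀
      ≤⟨ ℕₚ.+-mono-≤ (scanCost-bound (lit 0ℤ) (var 0) (lit 0ℤ) (var 1) m n 1 1≤m 1≤n)
           (ℕₚ.+-mono-≤ (scanCost-bound (op sub (lit 0ℤ) (var 0)) (op add (var 0) (var 0))
               (op sub (lit 0ℤ) (var 1)) (op add (var 1) (var 1)) (m ℕ.+ m ℕ.+ m) (n ℕ.+ n ℕ.+ n) 1
               (triple 1≤m) (triple 1≤n))
             (ℕₚ.+-monoʳ-≤ 4 (ℕₚ.+-mono-≤ (forwardCost-bound {v = v} 1≤m 1≤n positive)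
               (backwardCost-bound {v = v} 1≤m 1≤n positive f₀ d)))) ⟩
    11 * T ℕ.+ (17 * ((m ℕ.+ m ℕ.+ m) * (n ℕ.+ n ℕ.+ n)) ℕ.+ (4 ℕ.+
      (2 ℕ.+ (count * (34 * T) ℕ.+ 104 * (count * S)) ℕ.+ (2 ℕ.+ count * (31 * T ℕ.+ 30 * S)))))
      ≡⟨ identity₁ m n count S ⟩
    8 ℕ.+ (164 * T ℕ.+ (65 * (count * T) ℕ.+ 134 * (count * S)))
      ≤⟨ ℕₚ.+-mono-≤ (scaled 8) (ℕₚ.+-mono-≤ (ℕₚ.*-monoʳ-≤ 164 T≤V)
           (ℕₚ.+-mono-≤ (ℕₚ.*-monoʳ-≤ 65 (ℕₚ.*-monoˡ-≤ T count≤d)) (ℕₚ.*-monoʳ-≤ 134 (ℕₚ.*-mono-≤ count≤d S≤4T)))) ⟩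
    8 * V ℕ.+ (164 * V ℕ.+ (65 * V ℕ.+ 134 * (d * (4 * T))))
      ≡⟨ identity₂ d T ⟩
    773 * V ∎
    where
    open ℕₚ.≤-Reasoning
    S = sumFrom 0 count (λ k → reach m n (v k))
    triple : ∀ {l} → 1 ≤ l → 1 ≤ l ℕ.+ l ℕ.+ l
    triple {l} 1≤l = ℕₚ.≤-trans 1≤l (ℕₚ.m≤n+m l (l ℕ.+ l))
    identity₁ : ∀ m n c S → 11 * (m * n) ℕ.+ (17 * ((m ℕ.+ m ℕ.+ m) * (n ℕ.+ n ℕ.+ n)) ℕ.+ (4 ℕ.+
      (2 ℕ.+ (c * (34 * (m * n)) ℕ.+ 104 * (c * S)) ℕ.+ (2 ℕ.+ c * (31 * (m * n) ℕ.+ 30 * S)))))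
      ≡ 8 ℕ.+ (164 * (m * n) ℕ.+ (65 * (c * (m * n)) ℕ.+ 134 * (c * S)))
    identity₁ = ℕ-Ring.solve-∀
    identity₂ : ∀ d T → 8 * (d * T) ℕ.+ (164 * (d * T) ℕ.+ (65 * (d * T) ℕ.+ 134 * (d * (4 * T))))
      ≡ 773 * (d * T)
    identity₂ = ℕ-Ring.solve-∀

  -- 33 for the survey, 1 for the test on `bad-var` and 773 for the costlier branch.
  total-bound : surveyCost d ℕ.+ (1 ℕ.+ 773 * V) ≤ 807 * (d * m * n)
  total-bound = begin
    surveyCost d ℕ.+ (1 ℕ.+ 773 * V)    ≤⟨ ℕₚ.+-mono-≤ surveyCost-bound (ℕₚ.+-monoˡ-≤ (773 * V) (scaled 1)) ⟩
    33 * V ℕ.+ (1 * V ℕ.+ 773 * V)  ≡⟨ identity d m n ⟩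
    807 * (d * m * n)               ∎
    where
    open ℕₚ.≤-Reasoning
    identity : ∀ d m n → 33 * (d * (m * n)) ℕ.+ (1 * (d * (m * n)) ℕ.+ 773 * (d * (m * n))) ≡
      807 * (d * m * n)
    identity = ℕ-Ring.solve-∀

-- Correctness and cost for a given input

module _ {m n d : ℕ} (1≤m : 1 ≤ m) (1≤n : 1 ≤ n) (1≤d : 1 ≤ d)
  (D : DirectionSet d) (distinct : Distinct D) (f : Table m n) (σ : Store) (input : Input D f σ) where

  private
    open Input input

    -- Read off the store, so that it is defined beyond d without a default value.
    v : ℕ → Point
    v k = σ int 3 (+ k) 0ℤ , σ int 4 (+ k) 0ℤ

    G : Box
    G = grid {m} {n}

    v≡ : ∀ h → v (toℕ h) ≡ vec (D h)
    v≡ h = cong₂ _,_ (direction₁ h) (direction₂ h)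

    onFin : (P : ℕ → Set) → (∀ (h : Fin d) → P (toℕ h)) → ∀ k → k ℕ.< d → P k
    onFin P p k k<d = subst P (Finₚ.toℕ-fromℕ< k<d) (p (fromℕ< k<d))

    v-primitive : ∀ k → k ℕ.< d → Primitive (v k)
    v-primitive = onFin (λ k → Primitive (v k)) λ h → subst Primitive (sym (v≡ h)) (coprime (D h))

    parallel⇒≡ : ∀ h h′ → line (v (toℕ h)) (v (toℕ h′)) ≡ 0ℤ → h′ ≡ h
    parallel⇒≡ h h′ eq = distinct h′ h ([ (λ same → inj₁ (cong proj₁ same , cong proj₂ same))
      , (λ opposite → inj₂ (trans (cong proj₁ opposite) (ℤₚ.-1*i≡-i _) , trans (cong proj₂ opposite) (ℤₚ.-1*i≡-i _))) ]′
      (parallel⇒same (vec (D h)) (vec (D h′)) (coprime (D h)) (coprime (D h′))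
        (trans (cong₂ line (sym (v≡ h)) (sym (v≡ h′))) eq)))

    independent : ∀ i k → i ℕ.< d → k ℕ.< d → k ≢ i → line (v k) (v i) ≢ 0ℤ
    independent i k i<d k<d k≢i eq = k≢i (trans (sym (Finₚ.toℕ-fromℕ< k<d)) (trans
      (cong toℕ (sym (parallel⇒≡ (fromℕ< k<d) (fromℕ< i<d)
        (trans (cong₂ (λ k i → line (v k) (v i)) (Finₚ.toℕ-fromℕ< k<d) (Finₚ.toℕ-fromℕ< i<d)) eq))))
      (Finₚ.toℕ-fromℕ< i<d)))

    lineSum≃ : ∀ h c (U : Table m n) → lineSum (D h) c U ≃ tableSum (onLine (v (toℕ h)) c) U
    lineSum≃ h c U = ≃-trans (lineSum≃tableSum (D h) c U)
      (≡⇒≃ (cong (λ w → tableSum (onLine w c) U) (sym (v≡ h))))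

    row≃ : ∀ k → k ℕ.< d → ∀ c → σ real 0 (+ k) c ≃ tableSum (onLine (v k) c) f
    row≃ = onFin (λ k → ∀ c → σ real 0 (+ k) c ≃ tableSum (onLine (v k) c) f)
      λ h c → ≃-trans ⌈ line-sums h c ⌉ (lineSum≃ h c f)

    given : Given {m} {n} {v} d σ
    given = record { width≡ = width ; height≡ = height ; size≡ = size ; first≡ = λ _ → refl ; second≡ = λ _ → refl }

    same-table : ∀ (U : Table m n) → (∀ h c → tableSum (onLine (v (toℕ h)) c) U ≃ tableSum (onLine (v (toℕ h)) c) f) →
      SameLineSums D U f
    same-table U eq h c = ⌊ ≃-trans (lineSum≃ h c U) (≃-trans (eq h c) (≃-sym (lineSum≃ h c f))) ⌋

    Solved : Store → Set
    Solved τ = SameLineSums D (output τ) f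

    branch : ∀ τ → Frame survey σ τ → Surveyed {m} {n} {v} d d τ →
      Run (cond (var bad-var ≺ lit 0ℤ) solve-all direct) τ (1 ℕ.+ 773 * (d * (m * n))) Solved
    branch τ fr (cls , K) = by cls
      where
      open Counted K
      Cτ : Const m n v counted τ
      Cτ = record
        { width-is = Given.width≡ I ; height-is = Given.height≡ I ; dir₁ = Given.first≡ I ; dir₂ = Given.second≡ I
        ; count-is = count≡ ; reach-is = reach≡ }
        where I = Given-frame d survey refl refl refl refl refl fr given
      within : ∀ {k} → k ℕ.< counted → k ℕ.< d
      within k< = ℕₚ.<-≤-trans k< c≤u
      by : Classified {m} {n} {v} d d τ →
        Run (cond (var bad-var ≺ lit 0ℤ) solve-all direct) τ (1 ℕ.+ 773 * (d * (m * n))) Solved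
      -- The survey settles the outcome of the test, so the branch not taken is charged 0.
      by (inj₁ (bad≡ , small)) = run-cost {K = 1 ℕ.+ (solveAllCost {m} {n} {v} {counted} d (formal f) ℕ.+ 0)}
        (ℕₚ.+-monoʳ-≤ 1 (ℕₚ.≤-trans (ℕₚ.≤-reflexive (ℕₚ.+-identityʳ (solveAllCost {m} {n} {v} {counted} d (formal f))))
          (solveAllCost-bound 1≤m 1≤n 1≤d {v} {counted} (formal f) c≤u
            (λ k k< → primitive-reach m n (v k) 1≤m 1≤n (v-primitive k (within k<)))
            (reach-total-bound {v = v} d counted unfilled (λ k k< → small k (within k<))))))
        (run-cond {K = solveAllCost {m} {n} {v} {counted} d (formal f)} {L = 0} bad≡ refl
          (λ _ → run-map finish (solve-all-rule d τ (formal f) Cτ (formal-supported f)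
            (λ k k< → v-primitive k (within k<)) (λ k k< → small k (within k<))
            (λ i k i< k< → independent i k (within i<) (within k<))
            (λ k c k< → ≃-trans (≡⇒≃ (fr real 0 refl (+ k) c))
              (≃-trans (row≃ k (within k<) c) (≃-sym (⟦formal⟧ f (onLine (v k) c)))))
            ([ inj₁ , (λ sat → inj₂ (saturated⇒empty {m} {n} {v} {counted} d counted sat)) ]′ complete)))
          (λ ≮ → contradiction ℤ.-<+ ≮))
        where
        finish : ∀ υ → ∃[ g ] (Supported G g ×
          (∀ P → InBox G P → υ real 1 (proj₁ P) (proj₂ P) ≃ ⟦ g ⟧ (at P)) ×
          (∀ k c → k ℕ.< d → lineTotal (v k) c g ≃ lineTotal (v k) c (formal f))) → Solved υ
        finish υ (g , g∈ , out , totals) = same-table (output υ) λ h c →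
          let χ = onLine (v (toℕ h)) c in
          ≃-trans (tableSum-cong χ λ p q → out (position p q) (position∈grid p q))
            (≃-trans (tableSum-formal g g∈ χ)
              (≃-trans (totals (toℕ h) c (Finₚ.toℕ<n h)) (⟦formal⟧ f χ)))
      by (inj₂ (k , k<d , bad≡ , big)) = run-cost {K = 1 ℕ.+ directCost {m} {n} {v} {counted} d}
        (ℕₚ.+-monoʳ-≤ 1 (ℕₚ.≤-trans (directCost-bound 1≤m 1≤n 1≤d {v} {counted})
          (ℕₚ.*-monoˡ-≤ (d * (m * n)) {14} {773} (ℕₚ.≤ᵇ⇒≤ 14 773 _))))
        (run-cond {K = 0} {L = directCost {m} {n} {v} {counted} d} bad≡ refl
          (λ { (ℤ.+<+ ()) })
          (λ _ → run-map
            (λ υ out → same-table (output υ) λ h c → tableSum-cong (onLine (v (toℕ h)) c) λ p q →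
              ≃-trans (out (position p q) (position∈grid p q))
                (≃-trans (≡⇒≃ (fr real 0 refl (+ k) _))
                  (≃-trans (row≃ k k<d (line (v k) (position p q)))
                    (lineTotal-single (v k) (v-primitive k k<d) big f p q))))
            (direct-rule d τ k Cτ bad≡)))

  reconstruct-rule : Run reconstruct σ (surveyCost d ℕ.+ (1 ℕ.+ 773 * (d * (m * n)))) Solved
  reconstruct-rule = framed (survey-rule d σ given) then λ τ (fr , surveyed) → branch τ fr surveyed

theorem7 : ∃[ P ] ∃[ C ]
    (∀ (m n d : ℕ) .{{_ : NonZero m}} .{{_ : NonZero n}} .{{_ : NonZero d}}
    (D : DirectionSet d) → Distinct D →
    (f : Table m n) (σ : Store) → Input D f σ →
    ∃[ k ] ∃[ τ ]
    ( ⟨ P , σ ⟩⇓[ k ] τ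
    × k ≤ C * (d * m * n)
    × SameLineSums D (output τ) f
    × (∀ p q → ¬ InSomeSwitchingDomain D p q → output τ p q ≈ᴿ f p q)))
theorem7 = reconstruct , 807 , λ m n d D distinct f σ input →
  let 1≤m = ℕ.>-nonZero⁻¹ m
      1≤n = ℕ.>-nonZero⁻¹ n
      1≤d = ℕ.>-nonZero⁻¹ d
      k , τ , run , k≤ , same = reconstruct-rule 1≤m 1≤n 1≤d D distinct f σ input
  in k , τ , run , ℕₚ.≤-trans k≤ (total-bound 1≤m 1≤n 1≤d) , same , determined D (output τ) f same
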